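{- There are absolute constants $c_1,c_2>0$ such that $$c_1H\le D_3(3,H)\le c_2H \quad\text{and}\quad c_1H^{3/2}\le D_4(4,H)\le c_2H^{3/2}\quad\text{for every integer } H\ge1,$$ and $$c_1H\log H\le D_4(3,H)\le c_2H\log H\quad\text{for every integer } H\ge 2.$$
   Context: For a polynomial $f$ of degree $n \ge 1$ over $\mathbb{C}$ with roots $\alpha_1,\dots,\alpha_n$ (listed with multiplicity), put $r(f)=\max_{1\le i\le n}|\alpha_i|$. The roots of $f$ of maximal modulus are the roots of modulus $r(f)$; they are always counted with multiplicity. The height of $f$ is the maximum of the absolute values of its coefficients (including the leading one). For positive integers $k\le n$ and $H$, $D_n(k,H)$ denotes the number of monic integer polynomials $f$ of degree $n$ and height at most $H$ with exactly $k$ (not necessarily distinct) roots of maximal modulus. -}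

module Defs where

open import Level using (0ℓ) renaming (suc to lsuc)
open import Algebra.Bundles using (CommutativeRing; Semiring)
import Algebra.Construct.NaturalChoice.Max as Max
import Algebra.Definitions.RawSemiring as RawSemiringDefs
open import Axiom.ExcludedMiddle using (ExcludedMiddle)
open import Data.Integer.Base using (ℤ; +_; -[1+_]; ∣_∣; _⊖_)
open import Data.List.Base as List using (List; upTo; cartesianProductWith)
open import Data.Nat.Base as ℕ using (ℕ; zero; suc)
open import Data.Product.Base using (∃; _×_; _,_; proj₁)
open import Data.Vec.Base as Vec using (Vec; []; _∷_; _∷ʳ_)
open import Data.Vec.Relation.Binary.Pointwise.Inductive using (Pointwise)
open import Relation.Binary.Bundles using (TotalOrder)
open import Relation.Binary.PropositionalEquality.Core using (_≡_)
open import Relation.Binary.Structures using (IsTotalOrder)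
open import Relation.Nullary using (¬_; yes; no)

-- The axioms of the real numbers: a Dedekind-complete ordered field, which
-- is unique up to isomorphism.  The value of _⁻¹ at zero is unconstrained.
record CompleteOrderedField : Set (lsuc 0ℓ) where
  infix  4 _≤_
  infix  8 _⁻¹
  field
    commutativeRing : CommutativeRing 0ℓ 0ℓ

  open CommutativeRing commutativeRing public

  field
    _≤_          : Carrier → Carrier → Set
    _⁻¹          : Carrier → Carrier
    0≉1          : ¬ (0# ≈ 1#)
    *-inverseʳ   : ∀ x → ¬ (x ≈ 0#) → x * x ⁻¹ ≈ 1#
    isTotalOrder : IsTotalOrder _≈_ _≤_
    +-monoˡ-≤    : ∀ z {x y} → x ≤ y → x + z ≤ y + z
    *-nonNeg     : ∀ {x y} → 0# ≤ x → 0# ≤ y → 0# ≤ x * y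

  UpperBound : (Carrier → Set) → Carrier → Set
  UpperBound P b = ∀ x → P x → x ≤ b

  IsSupremum : (Carrier → Set) → Carrier → Set
  IsSupremum P s = UpperBound P s × (∀ b → UpperBound P b → s ≤ b)

  field
    complete : (P : Carrier → Set) → ∃ P → ∃ (UpperBound P) →
               ∃ (IsSupremum P)

  totalOrder : TotalOrder 0ℓ 0ℓ 0ℓ
  totalOrder = record { isTotalOrder = isTotalOrder }

-- Monic integer polynomials of degree n, encoded by their non-leading
-- coefficients, constant term first.
Monic : ℕ → Set
Monic n = Vec ℤ n

coefficients : ∀ {n} → Monic n → Vec ℤ (suc n)
coefficients f = f ∷ʳ + 1

height : ∀ {n} → Monic n → ℕ
height f = Vec.foldr′ ℕ._⊔_ 0 (Vec.map ∣_∣ (coefficients f))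

-- The integers -H, …, H.
range : ℕ → List ℤ
range H = List.map (_⊖ H) (upTo (suc (2 ℕ.* H)))

-- Every f whose non-leading coefficients lie in [-H, H], each listed once.
box : ∀ n → ℕ → List (Monic n)
box zero    H = [] List.∷ List.[]
box (suc n) H = cartesianProductWith _∷_ (range H) (box n H)

-- Excluded middle is needed for the count D below to be a natural number.
module Classical (em : ExcludedMiddle 0ℓ) (real : CompleteOrderedField) where

  open CompleteOrderedField real public renaming (Carrier to ℝ)
  open Max totalOrder public using (_⊔_)
  open RawSemiringDefs (Semiring.rawSemiring semiring) public using (_^_) renaming (_×_ to _·_)

  infix 4 _<_ _⟶_ _≈ℂ_

  _<_ : ℝ → ℝ → Set
  x < y = x ≤ y × ¬ (x ≈ y)

  fromℕ : ℕ → ℝ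
  fromℕ n = n · 1#

  fromℤ : ℤ → ℝ
  fromℤ (+ n)    = fromℕ n
  fromℤ -[1+ n ] = - fromℕ (suc n)

  -- The value is 0 when P is empty or unbounded above.
  sup : (ℝ → Set) → ℝ
  sup P with em {∃ P × ∃ (UpperBound P)}
  ... | yes (nonEmpty , bounded) = proj₁ (complete P nonEmpty bounded)
  ... | no  _                    = 0#

  -- Only used for x ≥ 0.
  √_ : ℝ → ℝ
  √ x = sup (λ y → y * y ≤ x)

  _⟶_ : (ℕ → ℝ) → ℝ → Set
  u ⟶ l = ∀ ε → 0# < ε →
    ∃ λ N → ∀ n → N ℕ.≤ n → (l - ε < u n) × (u n < l + ε)

  -- y is the natural logarithm of x, that is exp y ≈ x, where exp y is the
  -- limit of (1 + y/n)ⁿ (indexed from n = 1).  For x > 0 there is exactly one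
  -- such y.
  IsLog : ℝ → ℝ → Set
  IsLog x y = (λ n → (1# + y * fromℕ (suc n) ⁻¹) ^ suc n) ⟶ x

  record ℂ : Set where
    constructor _+i_
    field
      re im : ℝ

  open ℂ public

  _≈ℂ_ : ℂ → ℂ → Set
  z ≈ℂ w = (re z ≈ re w) × (im z ≈ im w)

  _+ℂ_ _*ℂ_ : ℂ → ℂ → ℂ
  z +ℂ w = (re z + re w) +i (im z + im w)
  z *ℂ w = (re z * re w - im z * im w) +i (re z * im w + im z * re w)

  -ℂ_ : ℂ → ℂ
  -ℂ z = (- re z) +i (- im z)

  realℂ : ℝ → ℂ
  realℂ x = x +i 0#

  modulus : ℂ → ℝ
  modulus z = √ (re z * re z + im z * im z)

  -- Coefficients, constant term first, of the product of X - α over the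
  -- entries α of the vector.
  fromRoots : ∀ {n} → Vec ℂ n → Vec ℂ (suc n)
  fromRoots []       = realℂ 1# ∷ []
  fromRoots (α ∷ αs) =
    Vec.zipWith _+ℂ_ (realℂ 0# ∷ p) (Vec.map ((-ℂ α) *ℂ_) p ∷ʳ realℂ 0#)
    where p = fromRoots αs

  -- The entries of αs are the complex roots of f, listed with multiplicity.
  RootsOf : ∀ {n} → Monic n → Vec ℂ n → Set
  RootsOf f αs = Pointwise _≈ℂ_
    (Vec.map (λ a → realℂ (fromℤ a)) (coefficients f)) (fromRoots αs)

  -- Moduli are nonnegative, so starting from 0 does not affect the maximum.
  maxModulus : ∀ {n} → Vec ℂ n → ℝ
  maxModulus αs = Vec.foldr′ _⊔_ 0# (Vec.map modulus αs)

  numMaximal : ∀ {n} → Vec ℂ n → ℕ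
  numMaximal αs = Vec.count (λ α → em {modulus α ≈ maxModulus αs}) αs

  -- The vector of roots exists and is unique up to order, so the existential
  -- quantifier only names it.
  ExactlyMaximal : ∀ {n} → ℕ → Monic n → Set
  ExactlyMaximal k f = ∃ λ αs → RootsOf f αs × (numMaximal αs ≡ k)

  D : (n k H : ℕ) → ℕ
  D n k H = List.length
    (List.filter (λ f → em {(height f ℕ.≤ H) × ExactlyMaximal k f}) (box n H))

{-# OPTIONS --safe #-}
module Submission where

open import Defs
open import Algebra.Bundles using (CommutativeRing)
import Algebra.Construct.NaturalChoice.Max as Max
import Algebra.Properties.AbelianGroup as AbelianGroupProperties
import Algebra.Properties.CommutativeSemigroup as CommutativeSemigroupProperties
import Algebra.Properties.CommutativeSemiring.Exp as Exp
import Algebra.Properties.Ring as RingProperties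
import Algebra.Properties.Semiring.Mult as SemiringMult
open import Axiom.ExcludedMiddle using (ExcludedMiddle)
open import Data.Bool.Base as Bool using (true; false; if_then_else_)
open import Data.Empty using (⊥; ⊥-elim)
open import Data.Fin using (#_)
open import Data.Fin.Base using (Fin; zero; suc)
open import Data.Integer.Base as ℤ using (ℤ; +_; -[1+_]; ∣_∣; _⊖_)
import Data.Integer.DivMod as ℤDivMod
import Data.Integer.Properties as ℤₚ
open import Data.List.Base as List using (List; []; _∷_; upTo; cartesianProductWith; length; cartesianProduct)
open import Data.List.Membership.Propositional using (_∈_)
import Data.List.Membership.Propositional.Properties as ∈ₚ
import Data.List.Properties as Listₚ
open import Data.List.Relation.Binary.Subset.Propositional using (_⊆_)
import Data.List.Relation.Unary.All as ListAll
import Data.List.Relation.Unary.AllPairs as AllPairs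
open import Data.List.Relation.Unary.Any using (here; there)
open import Data.List.Relation.Unary.Unique.Propositional using (Unique)
import Data.List.Relation.Unary.Unique.Propositional.Properties as Uniqueₚ
open import Data.Nat.Base as ℕ using (ℕ; zero; suc; z≤n; s≤s)
import Data.Nat.DivMod as DivMod
open import Data.Nat.Induction using (<-wellFounded; Acc; acc)
import Data.Nat.Properties as ℕₚ
import Data.Nat.Solver as ℕSolver
open import Data.Product.Base using (∃; ∃₂; _×_; _,_; proj₁; proj₂)
open import Data.Sum.Base using (_⊎_; inj₁; inj₂)
open import Data.Unit.Base using (⊤; tt)
open import Data.Vec.Base as Vec using (Vec; []; _∷_)
open import Data.Vec.N-ary using (N-ary; _$ⁿ_; curryⁿ; curryⁿ-cong; Eq)
import Data.Vec.Properties as Vecₚ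
open import Data.Vec.Relation.Binary.Pointwise.Inductive as Pointwise using (Pointwise; []; _∷_)
open import Data.Vec.Relation.Unary.All as All using (All; []; _∷_)
open import Level using (0ℓ)
open import Relation.Binary.PropositionalEquality as ≡ using (_≡_; _≢_)
import Relation.Binary.Reasoning.Setoid as SetoidReasoning
open import Relation.Binary.Structures using (IsTotalOrder)
open import Relation.Nullary using (¬_; Dec; yes; no)
open import Relation.Unary using (Pred; Decidable)

-- Conjugation is z ↦ R/z on the circle |z|² = R.  Hence a real cubic X³ + uX² + vX + w with all its roots
-- there satisfies wu = Rv and w² = R³, so v³ = u³w; if u, v, w are integers, either u = v = 0 or w is the
-- cube of the integer v/u.  Quartics are similar, with d a = R c and d² = R⁴.  The main contributions come
-- from X³ + w, from X⁴ + bX² + d with b² ≤ 36|d|, and from (X - k)(X³ + w), where |kw| ≤ H leaves the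
-- harmonic sum Σ H/k.  The latter case needs that the root t of smaller modulus is an integer: it is real,
-- being the only root of its modulus, and its degree over ℚ cannot exceed one, by an argument on the
-- relation v³ = u³w that replaces Galois conjugation by reduction modulo the quartic.

-- Integrality of t is what makes the mixed case countable. Once t is an integer k, the factor has
-- integer u, v, w, the classification of cubics applies to it, and |k||w| = |d| ≤ H leaves O(H/|k|)
-- cubics for each k ≠ 0. With u and v written through t, and w eliminated by d = -tw, the relation
-- v³ = u³w becomes a polynomial equation for t over ℚ. If t had degree four, the remainder of this
-- polynomial modulo the quartic would be zero and the equation would hold at every root. Testing it
-- at the real root -w/R of the cubic factor gives the contradiction, and all of this takes place
-- inside ℝ. In degrees two and three an explicit division of the quartic is used instead. The
-- counting is done in ℕ: ⌊√H⌋³ stands for H^(3/2), the exponent L with 2^L ≤ H < 2^(L+1) stands for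
-- log H, and dyadic blocks stand for the harmonic sum. Families of lower order are covered crudely,
-- by any list of the order of the main term. Passing to the real √ and log at the end costs only
-- constant factors.

-- Multivariate polynomials over ℤ in sparse normal form.

module RingExpressions where

  infixl 6 _:+_ _:-_
  infixl 7 _:*_
  infix  8 :-_
  infix  4 _:=_

  data Expr (n : ℕ) : Set where
    var       : Fin n → Expr n
    con       : ℕ → Expr n
    _:+_ _:*_ : Expr n → Expr n → Expr n
    :-_       : Expr n → Expr n

  _:-_ : ∀ {n} → Expr n → Expr n → Expr n
  e :- e′ = e :+ :- e′

  _:=_ : ∀ {n} → Expr n → Expr n → Expr n × Expr n
  _:=_ = _,_

  Monomial : ℕ → Set
  Monomial = Vec ℕ

  -- A list of terms, sorted by monomial, without zero coefficients.
  Sparse : ℕ → Set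
  Sparse n = List (ℤ × Monomial n)

  -- Only `same` carries evidence: merging two terms is sound because of it, whereas the order
  -- merely decides where a term is placed.
  data Compared {n} (m m′ : Monomial n) : Set where
    before after : Compared m m′
    same         : m ≡ m′ → Compared m m′

  compare : ∀ {n} (m m′ : Monomial n) → Compared m m′
  compare []      []        = same ≡.refl
  compare (e ∷ m) (e′ ∷ m′) with e ℕ.≡ᵇ e′ in eq
  ... | false = if e ℕ.<ᵇ e′ then before else after
  ... | true with compare m m′
  ...   | before = before
  ...   | after  = after
  ...   | same m≡m′ = same (≡.cong₂ _∷_ (ℕₚ.≡ᵇ⇒≡ e e′ (≡.subst Bool.T (≡.sym eq) tt)) m≡m′)

  term : ∀ {n} → ℤ → Monomial n → Sparse n → Sparse n
  term (+ 0) m p = p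
  term c     m p = (c , m) ∷ p

  insert : ∀ {n} → ℤ → Monomial n → Sparse n → Sparse n
  insert c m []             = term c m []
  insert c m ((d , m′) ∷ p) with compare m m′
  ... | before = term c m ((d , m′) ∷ p)
  ... | after  = (d , m′) ∷ insert c m p
  ... | same _ = term (c ℤ.+ d) m p

  add : ∀ {n} → Sparse n → Sparse n → Sparse n
  add []            q = q
  add ((c , m) ∷ p) q = insert c m (add p q)

  -- Adding a fixed exponent vector respects the lexicographic order, and products of nonzero
  -- integers are nonzero. So for `c` nonzero a normal form is sent to a normal form without any
  -- sorting.
  scale : ∀ {n} → ℤ → Monomial n → Sparse n → Sparse n
  scale c m []             = []
  scale c m ((d , m′) ∷ p) = (c ℤ.* d , Vec.zipWith ℕ._+_ m m′) ∷ scale c m p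

  mul : ∀ {n} → Sparse n → Sparse n → Sparse n
  mul []            q = []
  mul ((c , m) ∷ p) q = add (scale c m q) (mul p q)

  unit : ∀ {n} → Monomial n
  unit = Vec.replicate _ 0

  normalise : ∀ {n} → Expr n → Sparse n
  normalise (var i)  = (+ 1 , unit Vec.[ i ]≔ 1) ∷ []
  normalise (con c)  = term (+ c) unit []
  normalise (e :+ e′) = add (normalise e) (normalise e′)
  normalise (e :* e′) = mul (normalise e) (normalise e′)
  normalise (:- e)   = scale (ℤ.- (+ 1)) unit (normalise e)

  IsNil : ∀ {n} → Sparse n → Set
  IsNil []      = ⊤
  IsNil (_ ∷ _) = ⊥

  equation : ∀ n → N-ary n (Expr n) (Expr n × Expr n) → Expr n × Expr n
  equation n f = f $ⁿ Vec.map var (Vec.allFin n)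

-- A solver for commutative rings, and equations certified by membership in an ideal.

module IntegerRingSolver (R : CommutativeRing 0ℓ 0ℓ) where
  open RingExpressions

  private module ℤtoR where
    open CommutativeRing R
    open RingProperties ring using (-0#≈0#; -‿distribˡ-*; -‿involutive)
    open AbelianGroupProperties +-abelianGroup using (⁻¹-∙-comm)
    open SemiringMult semiring using (×-homo-+; ×1-homo-*) renaming (_×_ to _·_)
    open import Relation.Binary.Reasoning.Setoid setoid

    ⟦_⟧ : ℤ → Carrier
    ⟦ + n ⟧      = n · 1#
    ⟦ -[1+ n ] ⟧ = - (suc n · 1#)

    cancel-1 : ∀ x y → x - y ≈ (1# + x) - (1# + y)
    cancel-1 x y = begin
      x - y                      ≈⟨ +-identityˡ _ ⟨
      0# + (x - y)               ≈⟨ +-congʳ (-‿inverseʳ 1#) ⟨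
      (1# - 1#) + (x - y)        ≈⟨ +-assoc _ _ _ ⟩
      1# + (- 1# + (x - y))      ≈⟨ +-congˡ (+-assoc _ _ _) ⟨
      1# + ((- 1# + x) - y)      ≈⟨ +-congˡ (+-congʳ (+-comm _ _)) ⟩
      1# + ((x - 1#) - y)        ≈⟨ +-congˡ (+-assoc _ _ _) ⟩
      1# + (x + (- 1# - y))      ≈⟨ +-assoc _ _ _ ⟨
      (1# + x) + (- 1# - y)      ≈⟨ +-congˡ (⁻¹-∙-comm _ _) ⟩
      (1# + x) - (1# + y)        ∎

    ⊖-homo : ∀ m n → ⟦ m ⊖ n ⟧ ≈ m · 1# - n · 1#
    ⊖-homo zero    zero    = sym (-‿inverseʳ 0#)
    ⊖-homo (suc m) zero    = sym (trans (+-congˡ -0#≈0#) (+-identityʳ _))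
    ⊖-homo zero    (suc n) = sym (+-identityˡ _)
    ⊖-homo (suc m) (suc n) = begin
      ⟦ suc m ⊖ suc n ⟧        ≡⟨ ≡.cong ⟦_⟧ (ℤₚ.[1+m]⊖[1+n]≡m⊖n m n) ⟩
      ⟦ m ⊖ n ⟧                ≈⟨ ⊖-homo m n ⟩
      m · 1# - n · 1#          ≈⟨ cancel-1 _ _ ⟩
      suc m · 1# - suc n · 1#  ∎

    +-homo : ∀ i j → ⟦ i ℤ.+ j ⟧ ≈ ⟦ i ⟧ + ⟦ j ⟧
    +-homo (+ m)      (+ n)      = ×-homo-+ 1# m n
    +-homo (+ m)      (-[1+ n ]) = ⊖-homo m (suc n)
    +-homo (-[1+ m ]) (+ n)      = trans (⊖-homo n (suc m)) (+-comm _ _)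
    +-homo (-[1+ m ]) (-[1+ n ]) = begin
      - (suc (suc (m ℕ.+ n)) · 1#)         ≡⟨ ≡.cong (λ k → - (suc k · 1#)) (ℕₚ.+-suc m n) ⟨
      - ((suc m ℕ.+ suc n) · 1#)           ≈⟨ -‿cong (×-homo-+ 1# (suc m) (suc n)) ⟩
      - (suc m · 1# + suc n · 1#)          ≈⟨ ⁻¹-∙-comm _ _ ⟨
      - (suc m · 1#) - suc n · 1#          ∎

    -‿homo : ∀ i → ⟦ ℤ.- i ⟧ ≈ - ⟦ i ⟧
    -‿homo (+ zero)   = sym -0#≈0#
    -‿homo (+ suc n)  = refl
    -‿homo (-[1+ n ]) = sym (-‿involutive _)

    *-homo : ∀ i j → ⟦ i ℤ.* j ⟧ ≈ ⟦ i ⟧ * ⟦ j ⟧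
    *-homo⁺ : ∀ m j → ⟦ + m ℤ.* j ⟧ ≈ ⟦ + m ⟧ * ⟦ j ⟧
    *-homo⁺ m (+ n)      = begin
      ⟦ + m ℤ.* + n ⟧      ≡⟨ ≡.cong ⟦_⟧ (ℤₚ.pos-* m n) ⟨
      (m ℕ.* n) · 1#       ≈⟨ ×1-homo-* m n ⟩
      m · 1# * (n · 1#)    ∎
    *-homo⁺ m (-[1+ n ]) = begin
      ⟦ + m ℤ.* ℤ.- (+ suc n) ⟧    ≡⟨ ≡.cong ⟦_⟧ (ℤₚ.neg-distribʳ-* (+ m) (+ suc n)) ⟨
      ⟦ ℤ.- (+ m ℤ.* + suc n) ⟧    ≈⟨ -‿homo (+ m ℤ.* + suc n) ⟩
      - ⟦ + m ℤ.* + suc n ⟧        ≈⟨ -‿cong (*-homo⁺ m (+ suc n)) ⟩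
      - (m · 1# * (suc n · 1#))    ≈⟨ -‿distribʳ-* _ _ ⟩
      m · 1# * - (suc n · 1#)      ∎
      where open RingProperties ring using (-‿distribʳ-*)
    *-homo (+ m)      j = *-homo⁺ m j
    *-homo (-[1+ m ]) j = begin
      ⟦ ℤ.- (+ suc m) ℤ.* j ⟧      ≡⟨ ≡.cong ⟦_⟧ (ℤₚ.neg-distribˡ-* (+ suc m) j) ⟨
      ⟦ ℤ.- (+ suc m ℤ.* j) ⟧      ≈⟨ -‿homo (+ suc m ℤ.* j) ⟩
      - ⟦ + suc m ℤ.* j ⟧          ≈⟨ -‿cong (*-homo⁺ (suc m) j) ⟩
      - (suc m · 1# * ⟦ j ⟧)       ≈⟨ -‿distribˡ-* _ _ ⟩
      - (suc m · 1#) * ⟦ j ⟧       ∎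

    -- The constant 1 is read as 1# rather than 1# + 0#, so that it can stand for the unit of the ring.
    literal : ℕ → Carrier
    literal 1 = 1#
    literal n = ⟦ + n ⟧

    literal≈ : ∀ n → literal n ≈ ⟦ + n ⟧
    literal≈ 0             = refl
    literal≈ 1             = sym (+-identityʳ 1#)
    literal≈ (suc (suc n)) = refl

  module _ where
    open CommutativeRing R
    open ℤtoR
    open RingProperties ring using (-‿distribˡ-*)
    open AbelianGroupProperties +-abelianGroup using (x∙y⁻¹≈ε⇒x≈y; x≈y⇒x∙y⁻¹≈ε)
    open Exp commutativeSemiring using (_^_; ^-homo-*)
    open CommutativeSemigroupProperties *-commutativeSemigroup using (interchange)
    open CommutativeSemigroupProperties +-commutativeSemigroup using () renaming (x∙yz≈y∙xz to x+yz≈y+xz)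
    open import Relation.Binary.Reasoning.Setoid setoid

    ⟦_⟧ₑ : ∀ {n} → Expr n → Vec Carrier n → Carrier
    ⟦ var i ⟧ₑ   ρ = Vec.lookup ρ i
    ⟦ con c ⟧ₑ   ρ = literal c
    ⟦ e :+ e′ ⟧ₑ ρ = ⟦ e ⟧ₑ ρ + ⟦ e′ ⟧ₑ ρ
    ⟦ e :* e′ ⟧ₑ ρ = ⟦ e ⟧ₑ ρ * ⟦ e′ ⟧ₑ ρ
    ⟦ :- e ⟧ₑ    ρ = - ⟦ e ⟧ₑ ρ

    private
      ⟦_⟧ₘ : ∀ {n} → Monomial n → Vec Carrier n → Carrier
      ⟦ [] ⟧ₘ    []      = 1#
      ⟦ e ∷ m ⟧ₘ (x ∷ ρ) = x ^ e * ⟦ m ⟧ₘ ρ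

      ⟦_⟧ₛ : ∀ {n} → Sparse n → Vec Carrier n → Carrier
      ⟦ [] ⟧ₛ          ρ = 0#
      ⟦ (c , m) ∷ p ⟧ₛ ρ = ⟦ c ⟧ * ⟦ m ⟧ₘ ρ + ⟦ p ⟧ₛ ρ

      unit-correct : ∀ {n} (ρ : Vec Carrier n) → ⟦ unit ⟧ₘ ρ ≈ 1#
      unit-correct []      = refl
      unit-correct (x ∷ ρ) = trans (*-identityˡ _) (unit-correct ρ)

      var-correct : ∀ {n} (i : Fin n) (ρ : Vec Carrier n) → ⟦ unit Vec.[ i ]≔ 1 ⟧ₘ ρ ≈ Vec.lookup ρ i
      var-correct zero    (x ∷ ρ) = trans (*-cong (*-identityʳ x) (unit-correct ρ)) (*-identityʳ x)
      var-correct (suc i) (x ∷ ρ) = trans (*-identityˡ _) (var-correct i ρ)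

      term-correct : ∀ {n} c (m : Monomial n) p ρ → ⟦ term c m p ⟧ₛ ρ ≈ ⟦ c ⟧ * ⟦ m ⟧ₘ ρ + ⟦ p ⟧ₛ ρ
      term-correct (+ 0)     m p ρ = sym (trans (+-congʳ (zeroˡ _)) (+-identityˡ _))
      term-correct (+ suc _) m p ρ = refl
      term-correct (-[1+ _ ]) m p ρ = refl

      insert-correct : ∀ {n} c (m : Monomial n) p ρ → ⟦ insert c m p ⟧ₛ ρ ≈ ⟦ c ⟧ * ⟦ m ⟧ₘ ρ + ⟦ p ⟧ₛ ρ
      insert-correct c m []             ρ = term-correct c m [] ρ
      insert-correct c m ((d , m′) ∷ p) ρ with compare m m′
      ... | before      = term-correct c m ((d , m′) ∷ p) ρ
      ... | after       = trans (+-congˡ (insert-correct c m p ρ)) (x+yz≈y+xz _ _ _)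
      ... | same ≡.refl = begin
        ⟦ term (c ℤ.+ d) m p ⟧ₛ ρ                            ≈⟨ term-correct (c ℤ.+ d) m p ρ ⟩
        ⟦ c ℤ.+ d ⟧ * ⟦ m ⟧ₘ ρ + ⟦ p ⟧ₛ ρ               ≈⟨ +-congʳ (*-congʳ (+-homo c d)) ⟩
        (⟦ c ⟧ + ⟦ d ⟧) * ⟦ m ⟧ₘ ρ + ⟦ p ⟧ₛ ρ         ≈⟨ +-congʳ (distribʳ _ _ _) ⟩
        ⟦ c ⟧ * ⟦ m ⟧ₘ ρ + ⟦ d ⟧ * ⟦ m ⟧ₘ ρ + ⟦ p ⟧ₛ ρ ≈⟨ +-assoc _ _ _ ⟩
        ⟦ c ⟧ * ⟦ m ⟧ₘ ρ + (⟦ d ⟧ * ⟦ m ⟧ₘ ρ + ⟦ p ⟧ₛ ρ) ∎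

      add-correct : ∀ {n} (p q : Sparse n) ρ → ⟦ add p q ⟧ₛ ρ ≈ ⟦ p ⟧ₛ ρ + ⟦ q ⟧ₛ ρ
      add-correct []            q ρ = sym (+-identityˡ _)
      add-correct ((c , m) ∷ p) q ρ = begin
        ⟦ insert c m (add p q) ⟧ₛ ρ                  ≈⟨ insert-correct c m (add p q) ρ ⟩
        ⟦ c ⟧ * ⟦ m ⟧ₘ ρ + ⟦ add p q ⟧ₛ ρ         ≈⟨ +-congˡ (add-correct p q ρ) ⟩
        ⟦ c ⟧ * ⟦ m ⟧ₘ ρ + (⟦ p ⟧ₛ ρ + ⟦ q ⟧ₛ ρ)   ≈⟨ +-assoc _ _ _ ⟨
        ⟦ c ⟧ * ⟦ m ⟧ₘ ρ + ⟦ p ⟧ₛ ρ + ⟦ q ⟧ₛ ρ     ∎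

      monomial-* : ∀ {n} (m m′ : Monomial n) ρ → ⟦ Vec.zipWith ℕ._+_ m m′ ⟧ₘ ρ ≈ ⟦ m ⟧ₘ ρ * ⟦ m′ ⟧ₘ ρ
      monomial-* []      []        []      = sym (*-identityˡ 1#)
      monomial-* (e ∷ m) (e′ ∷ m′) (x ∷ ρ) =
        trans (*-cong (^-homo-* x e e′) (monomial-* m m′ ρ)) (interchange _ _ _ _)

      scale-correct : ∀ {n} c (m : Monomial n) p ρ → ⟦ scale c m p ⟧ₛ ρ ≈ ⟦ c ⟧ * ⟦ m ⟧ₘ ρ * ⟦ p ⟧ₛ ρ
      scale-correct c m []             ρ = sym (zeroʳ _)
      scale-correct c m ((d , m′) ∷ p) ρ = begin
        ⟦ c ℤ.* d ⟧ * ⟦ Vec.zipWith ℕ._+_ m m′ ⟧ₘ ρ + ⟦ scale c m p ⟧ₛ ρ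
          ≈⟨ +-cong (*-cong (*-homo c d) (monomial-* m m′ ρ)) (scale-correct c m p ρ) ⟩
        ⟦ c ⟧ * ⟦ d ⟧ * (⟦ m ⟧ₘ ρ * ⟦ m′ ⟧ₘ ρ) + ⟦ c ⟧ * ⟦ m ⟧ₘ ρ * ⟦ p ⟧ₛ ρ
          ≈⟨ +-congʳ (interchange _ _ _ _) ⟩
        ⟦ c ⟧ * ⟦ m ⟧ₘ ρ * (⟦ d ⟧ * ⟦ m′ ⟧ₘ ρ) + ⟦ c ⟧ * ⟦ m ⟧ₘ ρ * ⟦ p ⟧ₛ ρ
          ≈⟨ distribˡ _ _ _ ⟨
        ⟦ c ⟧ * ⟦ m ⟧ₘ ρ * (⟦ d ⟧ * ⟦ m′ ⟧ₘ ρ + ⟦ p ⟧ₛ ρ) ∎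

      mul-correct : ∀ {n} (p q : Sparse n) ρ → ⟦ mul p q ⟧ₛ ρ ≈ ⟦ p ⟧ₛ ρ * ⟦ q ⟧ₛ ρ
      mul-correct []            q ρ = sym (zeroˡ _)
      mul-correct ((c , m) ∷ p) q ρ = begin
        ⟦ add (scale c m q) (mul p q) ⟧ₛ ρ                        ≈⟨ add-correct (scale c m q) (mul p q) ρ ⟩
        ⟦ scale c m q ⟧ₛ ρ + ⟦ mul p q ⟧ₛ ρ                       ≈⟨ +-cong (scale-correct c m q ρ)
            (mul-correct p q ρ) ⟩
        ⟦ c ⟧ * ⟦ m ⟧ₘ ρ * ⟦ q ⟧ₛ ρ + ⟦ p ⟧ₛ ρ * ⟦ q ⟧ₛ ρ      ≈⟨ distribʳ _ _ _ ⟨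
        (⟦ c ⟧ * ⟦ m ⟧ₘ ρ + ⟦ p ⟧ₛ ρ) * ⟦ q ⟧ₛ ρ              ∎

      normalise-correct : ∀ {n} (e : Expr n) ρ → ⟦ normalise e ⟧ₛ ρ ≈ ⟦ e ⟧ₑ ρ
      normalise-correct (var i)   ρ = trans (+-identityʳ _)
          (trans (*-congʳ (+-identityʳ 1#)) (trans (*-identityˡ _) (var-correct i ρ)))
      normalise-correct (con c)   ρ = begin
        ⟦ term (+ c) unit [] ⟧ₛ ρ          ≈⟨ term-correct (+ c) unit [] ρ ⟩
        ⟦ + c ⟧ * ⟦ unit ⟧ₘ ρ + 0#         ≈⟨ +-identityʳ _ ⟩
        ⟦ + c ⟧ * ⟦ unit ⟧ₘ ρ              ≈⟨ *-congˡ (unit-correct ρ) ⟩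
        ⟦ + c ⟧ * 1#                      ≈⟨ *-identityʳ _ ⟩
        ⟦ + c ⟧                           ≈⟨ literal≈ c ⟨
        literal c                         ∎
      normalise-correct (e :+ e′) ρ = trans (add-correct (normalise e) _ ρ)
          (+-cong (normalise-correct e ρ) (normalise-correct e′ ρ))
      normalise-correct (e :* e′) ρ = trans (mul-correct (normalise e) _ ρ)
          (*-cong (normalise-correct e ρ) (normalise-correct e′ ρ))
      normalise-correct (:- e)    ρ = begin
        ⟦ scale (ℤ.- (+ 1)) unit (normalise e) ⟧ₛ ρ             ≈⟨ scale-correct (ℤ.- (+ 1)) unit (normalise e) ρ ⟩
        ⟦ ℤ.- (+ 1) ⟧ * ⟦ unit ⟧ₘ ρ * ⟦ normalise e ⟧ₛ ρ   ≈⟨ *-cong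
            (*-cong (-‿cong (+-identityʳ 1#)) (unit-correct ρ)) (normalise-correct e ρ) ⟩
        - 1# * 1# * ⟦ e ⟧ₑ ρ                                    ≈⟨ *-congʳ (*-identityʳ _) ⟩
        - 1# * ⟦ e ⟧ₑ ρ                                         ≈⟨ -‿distribˡ-* _ _ ⟨
        - (1# * ⟦ e ⟧ₑ ρ)                                       ≈⟨ -‿cong (*-identityˡ _) ⟩
        - ⟦ e ⟧ₑ ρ                                              ∎

      nil-correct : ∀ {n} (p : Sparse n) → IsNil p → ∀ ρ → ⟦ p ⟧ₛ ρ ≈ 0#
      nil-correct [] _ ρ = refl

    abstract
      -- When the difference of the two sides normalises to the empty list, the type of the hidden
      -- argument reduces to `⊤` and unification fills it in.
      solve : ∀ n (f : N-ary n (Expr n) (Expr n × Expr n)) →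
        {_ : IsNil (normalise (proj₁ (equation n f) :- proj₂ (equation n f)))} →
        Eq n _≈_ (curryⁿ ⟦ proj₁ (equation n f) ⟧ₑ) (curryⁿ ⟦ proj₂ (equation n f) ⟧ₑ)
      solve n f {isNil} = let (lhs , rhs) = equation n f in curryⁿ-cong _≈_ ⟦ lhs ⟧ₑ ⟦ rhs ⟧ₑ λ ρ →
        x∙y⁻¹≈ε⇒x≈y _ _ (trans (sym (normalise-correct (lhs :- rhs) ρ))
            (nil-correct (normalise (lhs :- rhs)) isNil ρ))

      -- Equations from linear combinations of hypotheses

      combine₁ : ∀ {a b l r} c → l ≈ r → a - b ≈ c * (l - r) → a ≈ b
      combine₁ {a} {b} {l} {r} c l≈r eq = x∙y⁻¹≈ε⇒x≈y a b (begin
        a - b        ≈⟨ eq ⟩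
        c * (l - r)  ≈⟨ *-congˡ (x≈y⇒x∙y⁻¹≈ε l≈r) ⟩
        c * 0#       ≈⟨ zeroʳ c ⟩
        0#           ∎)

      combine₂ : ∀ {a b l₁ r₁ l₂ r₂} c₁ c₂ → l₁ ≈ r₁ → l₂ ≈ r₂ →
        a - b ≈ c₁ * (l₁ - r₁) + c₂ * (l₂ - r₂) → a ≈ b
      combine₂ {a} {b} {l₁} {r₁} {l₂} {r₂} c₁ c₂ eq₁ eq₂ eq = combine₁ c₁ eq₁ (begin
        a - b                                ≈⟨ eq ⟩
        c₁ * (l₁ - r₁) + c₂ * (l₂ - r₂)      ≈⟨ +-congˡ (*-congˡ (x≈y⇒x∙y⁻¹≈ε eq₂)) ⟩
        c₁ * (l₁ - r₁) + c₂ * 0#             ≈⟨ +-congˡ (zeroʳ c₂) ⟩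
        c₁ * (l₁ - r₁) + 0#                  ≈⟨ +-identityʳ _ ⟩
        c₁ * (l₁ - r₁)                       ∎)

      combine₃ : ∀ {a b l₁ r₁ l₂ r₂ l₃ r₃} c₁ c₂ c₃ → l₁ ≈ r₁ → l₂ ≈ r₂ → l₃ ≈ r₃ →
        a - b ≈ c₁ * (l₁ - r₁) + c₂ * (l₂ - r₂) + c₃ * (l₃ - r₃) → a ≈ b
      combine₃ {a} {b} {l₁} {r₁} {l₂} {r₂} {l₃} {r₃} c₁ c₂ c₃ eq₁ eq₂ eq₃ eq = combine₂ c₁ c₂ eq₁ eq₂ (begin
        a - b                                              ≈⟨ eq ⟩
        c₁ * (l₁ - r₁) + c₂ * (l₂ - r₂) + c₃ * (l₃ - r₃)   ≈⟨ +-congˡ (*-congˡ (x≈y⇒x∙y⁻¹≈ε eq₃)) ⟩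
        c₁ * (l₁ - r₁) + c₂ * (l₂ - r₂) + c₃ * 0#          ≈⟨ +-congˡ (zeroʳ c₃) ⟩
        c₁ * (l₁ - r₁) + c₂ * (l₂ - r₂) + 0#               ≈⟨ +-identityʳ _ ⟩
        c₁ * (l₁ - r₁) + c₂ * (l₂ - r₂)                    ∎)

  open ℤtoR public using () renaming
      (⟦_⟧ to fromInteger; +-homo to fromInteger-+; *-homo to fromInteger-*; -‿homo to fromInteger-neg)

-- Counting in lists, the box of polynomials, integer roots and dyadic sums.

module Counting where
  open import Data.Nat.Base using (_+_; _*_; _^_; _∸_; _/_; _≤_; _<_)
  open ℕₚ.≤-Reasoning
  open ≡ using (refl; sym; trans; cong; cong₂; subst)

  -- Lists

  -- The head of `xs` occurs in `ys`; delete that one occurrence. By uniqueness the tail still lies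
  -- in what is left.
  length-mono-⊆ : ∀ {A : Set} {xs ys : List A} → Unique xs → xs ⊆ ys → length xs ≤ length ys
  length-mono-⊆ {xs = List.[]} _ _ = z≤n
  length-mono-⊆ {xs = x List.∷ xs} {ys} unique@(_ AllPairs.∷ uniqueTail) sub
    with as , bs , refl ← ∈ₚ.∈-∃++ (sub (here refl)) = begin
      suc (length xs)            ≤⟨ s≤s (length-mono-⊆ uniqueTail rest) ⟩
      suc (length (as List.++ bs)) ≡⟨ Listₚ.length-++-sucʳ as x bs ⟨
      length (as List.++ List.[ x ] List.++ bs) ∎
    where
    rest : xs ⊆ as List.++ bs
    rest {z} z∈xs with ∈ₚ.∈-++⁻ as (sub (there z∈xs))
    ... | inj₁ z∈as            = ∈ₚ.∈-++⁺ˡ z∈as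
    ... | inj₂ (here refl)     = ⊥-elim (Uniqueₚ.Unique[x∷xs]⇒x∉xs unique z∈xs)
    ... | inj₂ (there z∈bs)    = ∈ₚ.∈-++⁺ʳ as z∈bs

  length-cartesianProductWith : ∀ {A B C : Set} (f : A → B → C) xs ys →
    length (cartesianProductWith f xs ys) ≡ length xs * length ys
  length-cartesianProductWith f List.[]       ys = refl
  length-cartesianProductWith f (x List.∷ xs) ys = begin-equality
    length (List.map (f x) ys List.++ cartesianProductWith f xs ys)
      ≡⟨ Listₚ.length-++ (List.map (f x) ys) ⟩
    length (List.map (f x) ys) + length (cartesianProductWith f xs ys)
      ≡⟨ cong₂ _+_ (Listₚ.length-map (f x) ys) (length-cartesianProductWith f xs ys) ⟩
    length ys + length xs * length ys ∎

  sum< : (ℕ → ℕ) → ℕ → ℕ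
  sum< g zero    = 0
  sum< g (suc n) = sum< g n + g n

  slices : ∀ {A : Set} → (ℕ → List A) → ℕ → List A
  slices F zero    = List.[]
  slices F (suc n) = slices F n List.++ F n

  length-slices : ∀ {A : Set} (F : ℕ → List A) n → length (slices F n) ≡ sum< (λ k → length (F k)) n
  length-slices F zero    = refl
  length-slices F (suc n) = trans (Listₚ.length-++ (slices F n)) (cong (_+ length (F n)) (length-slices F n))

  ∈-slices⁺ : ∀ {A : Set} {F : ℕ → List A} {k n x} → k < n → x ∈ F k → x ∈ slices F n
  ∈-slices⁺ {F = F} {n = suc n} k<1+n x∈Fk with ℕₚ.m≤n⇒m<n∨m≡n (ℕ.s≤s⁻¹ k<1+n)
  ... | inj₁ k<n  = ∈ₚ.∈-++⁺ˡ (∈-slices⁺ k<n x∈Fk)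
  ... | inj₂ refl = ∈ₚ.∈-++⁺ʳ (slices F n) x∈Fk

  ∈-slices⁻ : ∀ {A : Set} (F : ℕ → List A) n {x} → x ∈ slices F n → ∃ λ k → k < n × x ∈ F k
  ∈-slices⁻ F (suc n) x∈ with ∈ₚ.∈-++⁻ (slices F n) x∈
  ... | inj₂ x∈Fn = n , ℕₚ.≤-refl , x∈Fn
  ... | inj₁ x∈s with k , k<n , x∈Fk ← ∈-slices⁻ F n x∈s = k , ℕₚ.m<n⇒m<1+n k<n , x∈Fk

  -- An element reveals through `key` the slice that it belongs to, so different slices are
  -- disjoint.
  slices-unique : ∀ {A : Set} {F : ℕ → List A} (key : A → ℕ) →
    (∀ {k x} → x ∈ F k → key x ≡ k) → (∀ k → Unique (F k)) → ∀ n → Unique (slices F n)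
  slices-unique key keyed uniqueF zero    = AllPairs.[]
  slices-unique {F = F} key keyed uniqueF (suc n) =
    Uniqueₚ.++⁺ (slices-unique key keyed uniqueF n) (uniqueF n) disjoint
    where
    disjoint : ∀ {x} → ¬ (x ∈ slices F n × x ∈ F n)
    disjoint (x∈s , x∈Fn) with k , k<n , x∈Fk ← ∈-slices⁻ F n x∈s =
      ℕₚ.<⇒≢ k<n (trans (sym (keyed x∈Fk)) (keyed x∈Fn))

  module _ {A : Set} {P : Pred A 0ℓ} (P? : Decidable P) where

    length-filter-upper : ∀ {xs ys} → Unique xs → (∀ {x} → x ∈ xs → P x → x ∈ ys) →
      length (List.filter P? xs) ≤ length ys
    length-filter-upper unique cover = length-mono-⊆ (Uniqueₚ.filter⁺ P? unique)
      (λ x∈ → let x∈xs , Px = ∈ₚ.∈-filter⁻ P? x∈ in cover x∈xs Px)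

    length-filter-lower : ∀ {xs ys} → Unique ys → (∀ {y} → y ∈ ys → y ∈ xs × P y) →
      length ys ≤ length (List.filter P? xs)
    length-filter-lower unique good = length-mono-⊆ unique
      (λ y∈ → let y∈xs , Py = good y∈ in ∈ₚ.∈-filter⁺ P? y∈xs Py)

  -- The box of polynomials

  ∈-range⁺ : ∀ {H i} → ∣ i ∣ ≤ H → i ∈ range H
  ∈-range⁺ {H} {+ n} n≤H = subst (_∈ range H)
    (trans (ℤₚ.⊖-≥ (ℕₚ.m≤m+n H n)) (cong +_ (ℕₚ.m+n∸m≡n H n)))
    (∈ₚ.∈-map⁺ (_⊖ H) (∈ₚ.∈-upTo⁺ (s≤s (begin
      H + n        ≤⟨ ℕₚ.+-monoʳ-≤ H n≤H ⟩
      H + H        ≡⟨ cong (λ n → H + n) (ℕₚ.+-identityʳ H) ⟨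
      H + (H + 0)  ∎))))
  ∈-range⁺ {H} {i@(-[1+ n ])} n<H = subst (_∈ range H)
    (trans (ℤₚ.⊖-≤ (ℕₚ.m∸n≤m H (suc n))) (cong (λ k → ℤ.- + k) (ℕₚ.m∸[m∸n]≡n n<H)))
    (∈ₚ.∈-map⁺ (_⊖ H) (∈ₚ.∈-upTo⁺ (s≤s (begin
      H ∸ suc n    ≤⟨ ℕₚ.m∸n≤m H (suc n) ⟩
      H            ≤⟨ ℕₚ.m≤m+n H _ ⟩
      H + (H + 0)  ∎))))

  ∈-range⁻ : ∀ {H i} → i ∈ range H → ∣ i ∣ ≤ H
  ∈-range⁻ {H} i∈ with ∈ₚ.∈-map⁻ (_⊖ H) i∈
  ... | j , j∈ , refl with ℕₚ.≤-total j H
  ...   | inj₁ j≤H = begin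
    ∣ j ⊖ H ∣  ≡⟨ ℤₚ.∣⊖∣-≤ j≤H ⟩
    H ∸ j      ≤⟨ ℕₚ.m∸n≤m H j ⟩
    H          ∎
  ...   | inj₂ H≤j = begin
    ∣ j ⊖ H ∣        ≡⟨ cong ∣_∣ (ℤₚ.⊖-≥ H≤j) ⟩
    j ∸ H            ≤⟨ ℕₚ.∸-monoˡ-≤ H (ℕ.s≤s⁻¹ (∈ₚ.∈-upTo⁻ j∈)) ⟩
    H + (H + 0) ∸ H  ≡⟨ ℕₚ.m+n∸m≡n H (H + 0) ⟩
    H + 0            ≡⟨ ℕₚ.+-identityʳ H ⟩
    H                ∎

  length-range : ∀ H → length (range H) ≡ suc (2 * H)
  length-range H = trans (Listₚ.length-map _ (upTo (suc (2 * H)))) (Listₚ.length-upTo (suc (2 * H)))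

  ⊖-cancelʳ : ∀ {m n} o → m ⊖ o ≡ n ⊖ o → m ≡ n
  ⊖-cancelʳ {m} {n} o eq = ℤₚ.+-injective
      (AbelianGroupProperties.∙-cancelʳ ℤₚ.+-0-abelianGroup (ℤ.- + o) (+ m) (+ n)
    (trans (ℤₚ.m-n≡m⊖n m o) (trans eq (sym (ℤₚ.m-n≡m⊖n n o)))))

  range-unique : ∀ H → Unique (range H)
  range-unique H = Uniqueₚ.map⁺ (⊖-cancelʳ H) (Uniqueₚ.upTo⁺ _)

  box-unique : ∀ n H → Unique (box n H)
  box-unique zero    H = ListAll.[] AllPairs.∷ AllPairs.[]
  box-unique (suc n) H = Uniqueₚ.cartesianProductWith⁺ _∷_ Vecₚ.∷-injective (range-unique H) (box-unique n H)

  Bounded : ∀ {n} → ℕ → Monic n → Set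
  Bounded H = All (λ a → ∣ a ∣ ≤ H)

  ∈-box⁺ : ∀ {n H} {f : Monic n} → Bounded H f → f ∈ box n H
  ∈-box⁺ []            = here refl
  ∈-box⁺ (a≤H ∷ f≤H) = ∈ₚ.∈-cartesianProductWith⁺ _∷_ (∈-range⁺ a≤H) (∈-box⁺ f≤H)

  ∈-box⁻ : ∀ {n H} {f : Monic n} → f ∈ box n H → Bounded H f
  ∈-box⁻ {zero} {f = []} _ = []
  ∈-box⁻ {suc n} {H} f∈ with ∈ₚ.∈-cartesianProductWith⁻ _∷_ (range H) (box n H) f∈
  ... | a , g , a∈ , g∈ , refl = ∈-range⁻ a∈ ∷ ∈-box⁻ g∈

  height≤ : ∀ {n H} {f : Monic n} → 1 ≤ H → Bounded H f → height f ≤ H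
  height≤ 1≤H []            = ℕₚ.⊔-lub 1≤H z≤n
  height≤ 1≤H (a≤H ∷ f≤H) = ℕₚ.⊔-lub a≤H (height≤ 1≤H f≤H)

  -- Square roots, binary logarithms and dyadic sums

  -- A discrete inverse of `g`: for squares it yields the integer square root, for powers of two the
  -- binary logarithm.
  bracket : ∀ (g : ℕ → ℕ) {H} n → g 0 ≤ H → H < g n → ∃ λ m → g m ≤ H × H < g (suc m)
  bracket g zero    g0≤H H<g0 = ⊥-elim (ℕₚ.<⇒≱ H<g0 g0≤H)
  bracket g {H} (suc n) g0≤H H<g with ℕₚ.≤-<-connex (g n) H
  ... | inj₁ gn≤H = n , gn≤H , H<g
  ... | inj₂ H<gn = bracket g n g0≤H H<gn

  abstract

    private
      squareBracket : ∀ H → ∃ λ m → m * m ≤ H × H < suc m * suc m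
      squareBracket H = bracket (λ m → m * m) (suc H) z≤n (ℕₚ.m≤m*n (suc H) (suc H))

    ⌊√_⌋ : ℕ → ℕ
    ⌊√ H ⌋ = proj₁ (squareBracket H)

    ⌊√⌋²≤ : ∀ H → ⌊√ H ⌋ * ⌊√ H ⌋ ≤ H
    ⌊√⌋²≤ H = proj₁ (proj₂ (squareBracket H))

    <[1+⌊√⌋]² : ∀ H → H < suc ⌊√ H ⌋ * suc ⌊√ H ⌋
    <[1+⌊√⌋]² H = proj₂ (proj₂ (squareBracket H))

  square-cancel-< : ∀ {m n} → m * m < n * n → m < n
  square-cancel-< {m} {n} m²<n² with ℕₚ.≤-<-connex n m
  ... | inj₁ n≤m = ⊥-elim (ℕₚ.<⇒≱ m²<n² (ℕₚ.*-mono-≤ n≤m n≤m))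
  ... | inj₂ m<n = m<n

  square-cancel-≤ : ∀ {m n} → m * m ≤ n * n → m ≤ n
  square-cancel-≤ {m} {n} m²≤n² with ℕₚ.≤-<-connex m n
  ... | inj₁ m≤n = m≤n
  ... | inj₂ n<m = ⊥-elim (ℕₚ.<⇒≱ (ℕₚ.*-mono-< n<m n<m) m²≤n²)

  square≤⇒≤⌊√⌋ : ∀ {m} H → m * m ≤ H → m ≤ ⌊√ H ⌋
  square≤⇒≤⌊√⌋ H m²≤H = ℕ.s≤s⁻¹ (square-cancel-< (ℕₚ.≤-<-trans m²≤H (<[1+⌊√⌋]² H)))

  1≤⌊√⌋ : ∀ {H} → 1 ≤ H → 1 ≤ ⌊√ H ⌋
  1≤⌊√⌋ {H} 1≤H = square≤⇒≤⌊√⌋ H 1≤H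

  n<2^n : ∀ n → n < 2 ^ n
  n<2^n zero    = s≤s z≤n
  n<2^n (suc n) = begin-strict
    suc n            ≤⟨ n<2^n n ⟩
    2 ^ n            <⟨ ℕₚ.m<m+n (2 ^ n) (ℕₚ.≤-trans (ℕₚ.m^n>0 2 n) (ℕₚ.m≤m+n _ 0)) ⟩
    2 ^ n + (2 ^ n + 0) ∎

  log₂-bracket : ∀ {H} → 1 ≤ H → ∃ λ L → 2 ^ L ≤ H × H < 2 ^ suc L
  log₂-bracket {H} 1≤H = bracket (2 ^_) H 1≤H (n<2^n H)

  sum<-mono : ∀ {g h : ℕ → ℕ} n → (∀ k → k < n → g k ≤ h k) → sum< g n ≤ sum< h n
  sum<-mono zero    g≤h = z≤n
  sum<-mono (suc n) g≤h = ℕₚ.+-mono-≤ (sum<-mono n (λ k k<n → g≤h k (ℕₚ.m<n⇒m<1+n k<n))) (g≤h n ℕₚ.≤-refl)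

  sum<-monoʳ : ∀ (g : ℕ → ℕ) {m n} → m ≤ n → sum< g m ≤ sum< g n
  sum<-monoʳ g {m} {zero}  z≤n = z≤n
  sum<-monoʳ g {m} {suc n} m≤1+n with ℕₚ.m≤n⇒m<n∨m≡n m≤1+n
  ... | inj₂ refl = ℕₚ.≤-refl
  ... | inj₁ m<1+n = ℕₚ.≤-trans (sum<-monoʳ g (ℕ.s≤s⁻¹ m<1+n)) (ℕₚ.m≤m+n _ _)

  sum<-block-≤ : ∀ (g : ℕ → ℕ) B m n → (∀ k → m ≤ k → k < m + n → g k ≤ B) →
    sum< g (m + n) ≤ sum< g m + n * B
  sum<-block-≤ g B m zero    bound = begin
    sum< g (m + 0)  ≡⟨ cong (sum< g) (ℕₚ.+-identityʳ m) ⟩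
    sum< g m        ≤⟨ ℕₚ.m≤m+n _ _ ⟩
    sum< g m + 0    ∎
  sum<-block-≤ g B m (suc n) bound = begin
    sum< g (m + suc n)             ≡⟨ cong (sum< g) (ℕₚ.+-suc m n) ⟩
    sum< g (m + n) + g (m + n)     ≤⟨ ℕₚ.+-mono-≤
      (sum<-block-≤ g B m n λ k m≤k k<m+n → bound k m≤k (ℕₚ.<-trans k<m+n m+n<m+1+n))
      (bound (m + n) (ℕₚ.m≤m+n m n) m+n<m+1+n) ⟩
    sum< g m + n * B + B           ≡⟨ ℕₚ.+-assoc (sum< g m) (n * B) B ⟩
    sum< g m + (n * B + B)         ≡⟨ cong (λ n → sum< g m + n) (ℕₚ.+-comm (n * B) B) ⟩
    sum< g m + (B + n * B)         ∎
    where m+n<m+1+n = ℕₚ.+-monoʳ-< m (ℕₚ.n<1+n n)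

  sum<-block-≥ : ∀ (g : ℕ → ℕ) B m n → (∀ k → m ≤ k → k < m + n → B ≤ g k) →
    sum< g m + n * B ≤ sum< g (m + n)
  sum<-block-≥ g B m zero    bound = begin
    sum< g m + 0    ≡⟨ ℕₚ.+-identityʳ _ ⟩
    sum< g m        ≡⟨ cong (sum< g) (ℕₚ.+-identityʳ m) ⟨
    sum< g (m + 0)  ∎
  sum<-block-≥ g B m (suc n) bound = begin
    sum< g m + (B + n * B)         ≡⟨ cong (λ n → sum< g m + n) (ℕₚ.+-comm (n * B) B) ⟨
    sum< g m + (n * B + B)         ≡⟨ ℕₚ.+-assoc (sum< g m) (n * B) B ⟨
    sum< g m + n * B + B           ≤⟨ ℕₚ.+-mono-≤
      (sum<-block-≥ g B m n λ k m≤k k<m+n → bound k m≤k (ℕₚ.<-trans k<m+n m+n<m+1+n))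
      (bound (m + n) (ℕₚ.m≤m+n m n) m+n<m+1+n) ⟩
    sum< g (m + n) + g (m + n)     ≡⟨ cong (sum< g) (ℕₚ.+-suc m n) ⟨
    sum< g (m + suc n)             ∎
    where m+n<m+1+n = ℕₚ.+-monoʳ-< m (ℕₚ.n<1+n n)

  2*≡+ : ∀ m → m + m ≡ 2 * m
  2*≡+ m = cong (λ n → m + n) (sym (ℕₚ.+-identityʳ m))

  -- The numbers below 2^j are 0 and the j blocks [2^i, 2^(i+1)). The block i has 2^i terms, each at
  -- most `B i`, and so contributes at most `C`.
  sum<-dyadic-≤ : ∀ (g B : ℕ → ℕ) C →
    (∀ i k → 2 ^ i ≤ k → g k ≤ B i) → (∀ i → 2 ^ i * B i ≤ C) →
    ∀ j → sum< g (2 ^ j) ≤ g 0 + j * C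
  sum<-dyadic-≤ g B C block bound zero = ℕₚ.m≤m+n (g 0) 0
  sum<-dyadic-≤ g B C block bound (suc j) = begin
    sum< g (2 ^ suc j)                  ≡⟨ cong (sum< g) (2*≡+ (2 ^ j)) ⟨
    sum< g (2 ^ j + 2 ^ j)              ≤⟨ sum<-block-≤ g (B j) (2 ^ j) (2 ^ j) (λ k 2^j≤k _ → block j k 2^j≤k) ⟩
    sum< g (2 ^ j) + 2 ^ j * B j        ≤⟨ ℕₚ.+-mono-≤ (sum<-dyadic-≤ g B C block bound j) (bound j) ⟩
    g 0 + j * C + C                     ≡⟨ ℕₚ.+-assoc (g 0) (j * C) C ⟩
    g 0 + (j * C + C)                   ≡⟨ cong (λ n → g 0 + n) (ℕₚ.+-comm (j * C) C) ⟩
    g 0 + (C + j * C)                   ∎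

  -- The same blocks from below: each contributes at least a quarter of `C`, and the factor 4 keeps
  -- the statement within ℕ.
  sum<-dyadic-≥ : ∀ (g B : ℕ → ℕ) C j →
    (∀ i k → i < j → k < 2 ^ suc i → B i ≤ g k) → (∀ i → i < j → C ≤ 4 * (2 ^ i * B i)) →
    4 * g 0 + j * C ≤ 4 * sum< g (2 ^ j)
  sum<-dyadic-≥ g B C zero block bound = ℕₚ.≤-reflexive (ℕₚ.+-identityʳ _)
  sum<-dyadic-≥ g B C (suc j) block bound = begin
    4 * g 0 + (C + j * C)                       ≡⟨ cong (λ n → 4 * g 0 + n) (ℕₚ.+-comm C (j * C)) ⟩
    4 * g 0 + (j * C + C)                       ≡⟨ ℕₚ.+-assoc (4 * g 0) (j * C) C ⟨
    4 * g 0 + j * C + C                         ≤⟨ ℕₚ.+-mono-≤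
      (sum<-dyadic-≥ g B C j (λ i k i<j → block i k (ℕₚ.m<n⇒m<1+n i<j)) (λ i i<j → bound i (ℕₚ.m<n⇒m<1+n i<j)))
      (bound j ℕₚ.≤-refl) ⟩
    4 * sum< g (2 ^ j) + 4 * (2 ^ j * B j)      ≡⟨ ℕₚ.*-distribˡ-+ 4 (sum< g (2 ^ j)) _ ⟨
    4 * (sum< g (2 ^ j) + 2 ^ j * B j)          ≤⟨ ℕₚ.*-monoʳ-≤ 4 (sum<-block-≥ g (B j) (2 ^ j) (2 ^ j)
      (λ k _ k<2^1+j → block j k ℕₚ.≤-refl (subst (k <_) (2*≡+ (2 ^ j)) k<2^1+j))) ⟩
    4 * sum< g (2 ^ j + 2 ^ j)                  ≡⟨ cong (λ n → 4 * sum< g n) (2*≡+ (2 ^ j)) ⟩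
    4 * sum< g (2 ^ suc j)                      ∎

-- Ordered field arithmetic, the embedding of ℤ, and the Archimedean property.

module Reals (em : ExcludedMiddle 0ℓ) (real : CompleteOrderedField) where
  open Classical em real hiding (zero)
  open IsTotalOrder isTotalOrder public using (antisym; total)
    renaming (refl to ≤-refl; trans to ≤-trans; reflexive to ≤-reflexive)
  open AbelianGroupProperties +-abelianGroup public using ()
    renaming (x≈y⇒x∙y⁻¹≈ε to x≈y⇒x-y≈0; x∙y⁻¹≈ε⇒x≈y to x-y≈0⇒x≈y)
  open SemiringMult semiring public using (×1-homo-*)
  open Exp commutativeSemiring public using (^-congˡ; ^-assocʳ; ^-distrib-*)
  open IntegerRingSolver commutativeRing public
    using (fromInteger; fromInteger-+; fromInteger-*; fromInteger-neg; solve; combine₁; combine₂; combine₃)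
  open RingExpressions public using (Expr; con; _:+_; _:*_; _:-_; :-_; _:=_)
  module ≈-Reasoning = SetoidReasoning setoid

  abstract

    -- Order

    ≤-respˡ : ∀ {x y z} → x ≈ y → x ≤ z → y ≤ z
    ≤-respˡ x≈y x≤z = ≤-trans (≤-reflexive (sym x≈y)) x≤z

    ≤-respʳ : ∀ {x y z} → y ≈ z → x ≤ y → x ≤ z
    ≤-respʳ y≈z x≤y = ≤-trans x≤y (≤-reflexive y≈z)

    ≤-resp : ∀ {x y x′ y′} → x ≈ x′ → y ≈ y′ → x ≤ y → x′ ≤ y′
    ≤-resp x≈x′ y≈y′ x≤y = ≤-respˡ x≈x′ (≤-respʳ y≈y′ x≤y)

    +-monoʳ-≤ : ∀ z {x y} → x ≤ y → z + x ≤ z + y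
    +-monoʳ-≤ z x≤y = ≤-resp (+-comm _ _) (+-comm _ _) (+-monoˡ-≤ z x≤y)

    +-mono-≤ : ∀ {x y u v} → x ≤ y → u ≤ v → x + u ≤ y + v
    +-mono-≤ {x} {y} {u} {v} x≤y u≤v = ≤-trans (+-monoˡ-≤ u x≤y) (+-monoʳ-≤ y u≤v)

    +-nonNeg : ∀ {x y} → 0# ≤ x → 0# ≤ y → 0# ≤ x + y
    +-nonNeg 0≤x 0≤y = ≤-respˡ (+-identityˡ 0#) (+-mono-≤ 0≤x 0≤y)

    ≤⇒0≤- : ∀ {x y} → x ≤ y → 0# ≤ y - x
    ≤⇒0≤- {x} x≤y = ≤-respˡ (-‿inverseʳ x) (+-monoˡ-≤ (- x) x≤y)

    -- The order counterpart of `combine₁`: an inequality is certified by a ring identity that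
    -- writes the difference as a visibly nonnegative expression.
    ≤-slack : ∀ {x y e} → 0# ≤ e → y - x ≈ e → x ≤ y
    ≤-slack {x} {y} {e} 0≤e eq = ≤-resp (+-identityˡ x)
      (solve 2 (λ x y → y :- x :+ x := y) x y) (+-monoˡ-≤ x (≤-respʳ (sym eq) 0≤e))

    neg-nonNeg : ∀ {x} → x ≤ 0# → 0# ≤ - x
    neg-nonNeg x≤0 = ≤-respʳ (+-identityˡ _) (≤⇒0≤- x≤0)

    square-nonNeg : ∀ x → 0# ≤ x * x
    square-nonNeg x with total 0# x
    ... | inj₁ 0≤x = *-nonNeg 0≤x 0≤x
    ... | inj₂ x≤0 = ≤-respʳ (solve 1 (λ x → :- x :* :- x := x :* x) x) (*-nonNeg (neg-nonNeg x≤0) (neg-nonNeg x≤0))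

    0≤1 : 0# ≤ 1#
    0≤1 = ≤-respʳ (*-identityˡ 1#) (square-nonNeg 1#)

    *-monoˡ-≤ : ∀ {x y z} → 0# ≤ z → x ≤ y → z * x ≤ z * y
    *-monoˡ-≤ {x} {y} {z} 0≤z x≤y = ≤-slack (*-nonNeg 0≤z (≤⇒0≤- x≤y))
      (solve 3 (λ x y z → z :* y :- z :* x := z :* (y :- x)) x y z)

    *-mono-≤ : ∀ {x y u v} → 0# ≤ u → 0# ≤ y → x ≤ y → u ≤ v → x * u ≤ y * v
    *-mono-≤ {x} {y} {u} {v} 0≤u 0≤y x≤y u≤v = ≤-slack
      (+-nonNeg (*-nonNeg 0≤u (≤⇒0≤- x≤y)) (*-nonNeg 0≤y (≤⇒0≤- u≤v)))
      (solve 4 (λ x y u v → y :* v :- x :* u := u :* (y :- x) :+ y :* (v :- u)) x y u v)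

    ≰⇒> : ∀ {x y} → ¬ (x ≤ y) → y < x
    ≰⇒> {x} {y} x≰y with total x y
    ... | inj₁ x≤y = ⊥-elim (x≰y x≤y)
    ... | inj₂ y≤x = y≤x , λ y≈x → x≰y (≤-reflexive (sym y≈x))

    <⇒≱ : ∀ {x y} → x < y → ¬ (y ≤ x)
    <⇒≱ (x≤y , x≉y) y≤x = x≉y (antisym x≤y y≤x)

    ≤-or-> : ∀ x y → x ≤ y ⊎ y < x
    ≤-or-> x y with em {x ≤ y}
    ... | yes x≤y = inj₁ x≤y
    ... | no  x≰y = inj₂ (≰⇒> x≰y)

    <-≤-trans : ∀ {x y z} → x < y → y ≤ z → x < z
    <-≤-trans (x≤y , x≉y) y≤z = ≰⇒> λ z≤x → x≉y (antisym x≤y (≤-trans y≤z z≤x))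

    ≤-<-trans : ∀ {x y z} → x ≤ y → y < z → x < z
    ≤-<-trans x≤y (y≤z , y≉z) = ≰⇒> λ z≤x → y≉z (antisym y≤z (≤-trans z≤x x≤y))

    <-respˡ : ∀ {x y z} → x ≈ y → x < z → y < z
    <-respˡ x≈y x<z = ≤-<-trans (≤-reflexive (sym x≈y)) x<z

    <-respʳ : ∀ {x y z} → y ≈ z → x < y → x < z
    <-respʳ y≈z x<y = <-≤-trans x<y (≤-reflexive y≈z)

    <⇒≤ : ∀ {x y} → x < y → x ≤ y
    <⇒≤ = proj₁

    0<1 : 0# < 1#
    0<1 = 0≤1 , 0≉1

    <⇒0<- : ∀ {x y} → x < y → 0# < y - x
    <⇒0<- {x} {y} (x≤y , x≉y) = ≤⇒0≤- x≤y , λ 0≈y-x → x≉y (sym (x-y≈0⇒x≈y y x (sym 0≈y-x)))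

    <-slack : ∀ {x y e} → 0# < e → y - x ≈ e → x < y
    <-slack {x} {y} {e} (0≤e , 0≉e) eq = ≤-slack 0≤e eq ,
      λ x≈y → 0≉e (trans (sym (x≈y⇒x-y≈0 (sym x≈y))) eq)

    -- Inverses and zero divisors

    *-cancelˡ-0 : ∀ {x y} → ¬ (x ≈ 0#) → x * y ≈ 0# → y ≈ 0#
    *-cancelˡ-0 {x} {y} x≉0 xy≈0 = combine₂ (- y) (x ⁻¹) (*-inverseʳ x x≉0) xy≈0
      (solve 3 (λ x y i → y :- con 0 := (:- y) :* (x :* i :- con 1) :+ i :* (x :* y :- con 0)) x y (x ⁻¹))

    zero-product : ∀ {x y} → x * y ≈ 0# → x ≈ 0# ⊎ y ≈ 0#
    zero-product {x} xy≈0 with em {x ≈ 0#}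
    ... | yes x≈0 = inj₁ x≈0
    ... | no  x≉0 = inj₂ (*-cancelˡ-0 x≉0 xy≈0)

    *-nonZero : ∀ {x y} → ¬ (x ≈ 0#) → ¬ (y ≈ 0#) → ¬ (x * y ≈ 0#)
    *-nonZero x≉0 y≉0 xy≈0 = y≉0 (*-cancelˡ-0 x≉0 xy≈0)

    *-cancelˡ : ∀ {x y z} → ¬ (x ≈ 0#) → x * y ≈ x * z → y ≈ z
    *-cancelˡ {x} {y} {z} x≉0 xy≈xz = x-y≈0⇒x≈y y z (*-cancelˡ-0 x≉0
      (trans (solve 3 (λ x y z → x :* (y :- z) := x :* y :- x :* z) x y z) (x≈y⇒x-y≈0 xy≈xz)))

    *-cancelˡ-≤ : ∀ {x y z} → 0# < x → x * y ≤ x * z → y ≤ z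
    *-cancelˡ-≤ {x} {y} {z} (0≤x , 0≉x) xy≤xz with ≤-or-> y z
    ... | inj₁ y≤z = y≤z
    ... | inj₂ z<y = ≤-reflexive (*-cancelˡ (λ x≈0 → 0≉x (sym x≈0)) (antisym xy≤xz (*-monoˡ-≤ 0≤x (<⇒≤ z<y))))

    >⇒≉0 : ∀ {x} → 0# < x → ¬ (x ≈ 0#)
    >⇒≉0 (_ , 0≉x) x≈0 = 0≉x (sym x≈0)

    *-pos : ∀ {x y} → 0# < x → 0# < y → 0# < x * y
    *-pos 0<x 0<y = *-nonNeg (<⇒≤ 0<x) (<⇒≤ 0<y) , λ 0≈xy → *-nonZero (>⇒≉0 0<x) (>⇒≉0 0<y) (sym 0≈xy)

    ⁻¹-pos : ∀ {x} → 0# < x → 0# < x ⁻¹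
    ⁻¹-pos {x} 0<x = ≰⇒> λ x⁻¹≤0 → <⇒≱ 0<1 (≤-resp (*-inverseʳ x (>⇒≉0 0<x)) (zeroʳ x) (*-monoˡ-≤ (<⇒≤ 0<x) x⁻¹≤0))

    square-zero : ∀ {x} → x * x ≈ 0# → x ≈ 0#
    square-zero x²≈0 with zero-product x²≈0
    ... | inj₁ x≈0 = x≈0
    ... | inj₂ x≈0 = x≈0

    sum-nonNeg-zeroˡ : ∀ {x y} → 0# ≤ x → 0# ≤ y → x + y ≈ 0# → x ≈ 0#
    sum-nonNeg-zeroˡ {x} {y} 0≤x 0≤y x+y≈0 = antisym (≤-slack 0≤y (combine₁ (- 1#) x+y≈0
      (solve 2 (λ x y → con 0 :- x :- y := :- con 1 :* (x :+ y :- con 0)) x y))) 0≤x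

    square-cancel-≤ : ∀ {x y} → 0# ≤ y → x * x ≤ y * y → x ≤ y
    square-cancel-≤ {x} {y} 0≤y x²≤y² with ≤-or-> x y
    ... | inj₁ x≤y = x≤y
    ... | inj₂ (y≤x , y≉x) = ⊥-elim (>⇒≉0 0<[x-y][x+y] (antisym
      (≤-slack (≤⇒0≤- x²≤y²) (solve 2 (λ x y → con 0 :- (x :- y) :* (x :+ y) := y :* y :- x :* x) x y))
      (<⇒≤ 0<[x-y][x+y])))
      where
      0<[x-y][x+y] : 0# < (x - y) * (x + y)
      0<[x-y][x+y] = *-pos (<⇒0<- (y≤x , y≉x))
        (<-≤-trans (≤-<-trans 0≤y (y≤x , y≉x)) (≤-slack 0≤y (solve 2 (λ x y → x :+ y :- x := y) x y)))

    square-injective : ∀ {x y} → 0# ≤ x → 0# ≤ y → x * x ≈ y * y → x ≈ y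
    square-injective 0≤x 0≤y x²≈y² = antisym (square-cancel-≤ 0≤y (≤-reflexive x²≈y²))
      (square-cancel-≤ 0≤x (≤-reflexive (sym x²≈y²)))

    square-mono-≤ : ∀ {x y} → 0# ≤ x → x ≤ y → x * x ≤ y * y
    square-mono-≤ 0≤x x≤y = *-mono-≤ 0≤x (≤-trans 0≤x x≤y) x≤y x≤y

    -- The embedding of the integers

    fromℕ-nonNeg : ∀ n → 0# ≤ fromℕ n
    fromℕ-nonNeg zero    = ≤-refl
    fromℕ-nonNeg (suc n) = +-nonNeg 0≤1 (fromℕ-nonNeg n)

    fromℕ-* : ∀ m n → fromℕ (m ℕ.* n) ≈ fromℕ m * fromℕ n
    fromℕ-* = ×1-homo-*

    fromℕ-mono-≤ : ∀ {m n} → m ℕ.≤ n → fromℕ m ≤ fromℕ n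
    fromℕ-mono-≤ {n = n} z≤n = fromℕ-nonNeg n
    fromℕ-mono-≤ (s≤s m≤n)   = +-monoʳ-≤ 1# (fromℕ-mono-≤ m≤n)

    fromℕ-pos : ∀ {n} → 0 ℕ.< n → 0# < fromℕ n
    fromℕ-pos {n} 0<n = <-≤-trans (<-respʳ (sym (+-identityʳ 1#)) 0<1) (fromℕ-mono-≤ {1} {n} 0<n)

    fromℕ-cancel-≤ : ∀ {m n} → fromℕ m ≤ fromℕ n → m ℕ.≤ n
    fromℕ-cancel-≤ {m} {n} m≤n with ℕₚ.≤-<-connex m n
    ... | inj₁ m≤n′ = m≤n′
    ... | inj₂ n<m = ⊥-elim (<⇒≱ (<-≤-trans n<1+n (fromℕ-mono-≤ {suc n} {m} n<m)) m≤n)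
      where
      n<1+n : fromℕ n < fromℕ (suc n)
      n<1+n = <-slack 0<1 (solve 1 (λ x → con 1 :+ x :- x := con 1) (fromℕ n))

    fromℤ≡ : ∀ i → fromℤ i ≡ fromInteger i
    fromℤ≡ (+ n)      = ≡.refl
    fromℤ≡ (-[1+ n ]) = ≡.refl

    fromℤ-+ : ∀ i j → fromℤ (i ℤ.+ j) ≈ fromℤ i + fromℤ j
    fromℤ-+ i j rewrite fromℤ≡ (i ℤ.+ j) | fromℤ≡ i | fromℤ≡ j = fromInteger-+ i j

    fromℤ-* : ∀ i j → fromℤ (i ℤ.* j) ≈ fromℤ i * fromℤ j
    fromℤ-* i j rewrite fromℤ≡ (i ℤ.* j) | fromℤ≡ i | fromℤ≡ j = fromInteger-* i j

    fromℤ-neg : ∀ i → fromℤ (ℤ.- i) ≈ - fromℤ i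
    fromℤ-neg i rewrite fromℤ≡ (ℤ.- i) | fromℤ≡ i = fromInteger-neg i

    fromℤ-zero : ∀ {i} → fromℤ i ≈ 0# → i ≡ + 0
    fromℤ-zero {+ zero}   _   = ≡.refl
    fromℤ-zero {+ suc n}  eq  = ⊥-elim (>⇒≉0 (fromℕ-pos {suc n} (s≤s z≤n)) eq)
    fromℤ-zero { -[1+ n ] } eq = ⊥-elim (>⇒≉0 (fromℕ-pos {suc n} (s≤s z≤n)) (combine₁ (- 1#) eq
      (solve 1 (λ x → x :- con 0 := :- con 1 :* ((:- x) :- con 0)) (fromℕ (suc n)))))

    fromℤ-injective : ∀ {i j} → fromℤ i ≈ fromℤ j → i ≡ j
    fromℤ-injective {i} {j} eq = ℤₚ.i-j≡0⇒i≡j i j (fromℤ-zero (begin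
      fromℤ (i ℤ.- j)        ≈⟨ fromℤ-+ i (ℤ.- j) ⟩
      fromℤ i + fromℤ (ℤ.- j) ≈⟨ +-congˡ (fromℤ-neg j) ⟩
      fromℤ i - fromℤ j      ≈⟨ x≈y⇒x-y≈0 eq ⟩
      0#                     ∎))
      where open ≈-Reasoning

    fromℤ-square : ∀ i → fromℤ i * fromℤ i ≈ fromℕ (∣ i ∣ ℕ.* ∣ i ∣)
    fromℤ-square (+ n)      = sym (fromℕ-* n n)
    fromℤ-square (-[1+ n ]) = trans (solve 1 (λ x → :- x :* :- x := x :* x) (fromℕ (suc n)))
        (sym (fromℕ-* (suc n) (suc n)))

  -- If the naturals had an upper bound, they would have a supremum s; from n + 1 ≤ s for all n it
  -- follows that s - 1 is a smaller upper bound.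
  archimedean : ∀ x → ∃ λ n → x ≤ fromℕ n
  archimedean x with em {∃ λ n → x ≤ fromℕ n}
  ... | yes found = found
  ... | no  none  = ⊥-elim (<⇒≱ s-1<s (least (s - 1#) shifted))
    where
    Natural : ℝ → Set
    Natural y = ∃ λ n → y ≈ fromℕ n
    bounded : UpperBound Natural x
    bounded y (n , y≈n) = ≤-respˡ (sym y≈n) (<⇒≤ (≰⇒> λ x≤n → none (n , x≤n)))
    supremum = complete Natural (0# , 0 , refl) (x , bounded)
    s = proj₁ supremum
    least = proj₂ (proj₂ supremum)
    shifted : UpperBound Natural (s - 1#)
    shifted y (n , y≈n) = ≤-slack (≤⇒0≤- (proj₁ (proj₂ supremum) (fromℕ (suc n)) (suc n , refl)))
      (trans (+-congˡ (-‿cong y≈n)) (solve 2 (λ s n → s :- con 1 :- n := s :- (con 1 :+ n)) s (fromℕ n)))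
    s-1<s : s - 1# < s
    s-1<s = <-slack 0<1 (solve 1 (λ s → s :- (s :- con 1) := con 1) s)

-- Existence of square and cube roots by completeness.

module Roots (em : ExcludedMiddle 0ℓ) (real : CompleteOrderedField) where
  open Classical em real hiding (zero)
  open Reals em real

  -- A continuity modulus C at y, valid for increments h ∈ [0,1], is all the intermediate value argument needs.
  record Increasing (φ : ℝ → ℝ) : Set where
    field
      φ-cong   : ∀ {x y} → x ≈ y → φ x ≈ φ y
      φ-0      : φ 0# ≈ 0#
      φ-mono   : ∀ {x y} → 0# ≤ x → x ≤ y → φ x ≤ φ y
      φ-large  : ∀ {x} → 1# ≤ x → x ≤ φ x
      slope    : ℝ → ℝ
      slope>0  : ∀ {y} → 0# ≤ y → 0# < slope y
      φ-right  : ∀ {y h} → 0# ≤ y → 0# ≤ h → h ≤ 1# → φ (y + h) ≤ φ y + slope y * h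
      φ-left   : ∀ {y h} → 0# ≤ h → h ≤ 1# → h ≤ y → φ y - slope y * h ≤ φ (y - h)

  abstract
    common-lower : ∀ {x y} → 0# < x → 0# < y → ∃ λ h → 0# < h × h ≤ x × h ≤ y
    common-lower {x} {y} 0<x 0<y with total x y
    ... | inj₁ x≤y = x , 0<x , ≤-refl , x≤y
    ... | inj₂ y≤x = y , 0<y , y≤x , ≤-refl

    half : ℝ
    half = fromℕ 2 ⁻¹

    2*half : fromℕ 2 * half ≈ 1#
    2*half = *-inverseʳ (fromℕ 2) (>⇒≉0 (fromℕ-pos {2} (s≤s z≤n)))

    half-pos : 0# < half
    half-pos = ⁻¹-pos (fromℕ-pos {2} (s≤s z≤n))

    -- Here h is the minimum of 1 and δ/2c; the halving makes the last inequality strict.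
    small-step : ∀ {c δ} → 0# < c → 0# < δ → ∃ λ h → 0# < h × h ≤ 1# × c * h < δ
    small-step {c} {δ} 0<c 0<δ with common-lower 0<1 (*-pos (*-pos 0<δ half-pos) (⁻¹-pos 0<c))
    ... | h , 0<h , h≤1 , h≤δ/2c = h , 0<h , h≤1 , ≤-<-trans (*-monoˡ-≤ (<⇒≤ 0<c) h≤δ/2c)
      (<-slack (*-pos 0<δ half-pos) (combine₂ (- (δ * half)) δ (*-inverseʳ c (>⇒≉0 0<c)) (sym 2*half)
        (solve 4 (λ d t c i → (d :- c :* (d :* t :* i)) :- d :* t :=
          (:- (d :* t)) :* (c :* i :- con 1) :+ d :* (con 1 :- con 2 :* t)) δ half c (c ⁻¹))))

  module _ {φ : ℝ → ℝ} (increasing : Increasing φ) where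
    open Increasing increasing

    Below : ℝ → ℝ → Set
    Below x y = 0# ≤ y × φ y ≤ x

    below-0 : ∀ {x} → 0# ≤ x → Below x 0#
    below-0 0≤x = ≤-refl , ≤-respˡ (sym φ-0) 0≤x

    below-bounded : ∀ {x} → 0# ≤ x → UpperBound (Below x) (x + 1#)
    below-bounded {x} 0≤x y (0≤y , φy≤x) with ≤-or-> y (x + 1#)
    ... | inj₁ y≤ = y≤
    ... | inj₂ x+1<y = ⊥-elim (<⇒≱ x+1<y (≤-trans (≤-trans (φ-large 1≤y) φy≤x) x≤x+1))
      where
      1≤y : 1# ≤ y
      1≤y = ≤-trans (≤-slack 0≤x (solve 1 (λ x → x :+ con 1 :- con 1 := x) x)) (<⇒≤ x+1<y)
      x≤x+1 : x ≤ x + 1#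
      x≤x+1 = ≤-slack 0≤1 (solve 1 (λ x → x :+ con 1 :- x := con 1) x)

    -- If φ s < x, the continuity modulus leaves room for a step to the right on which φ stays below
    -- x, and then s is no upper bound.
    φ-sup-≥ : ∀ {x s} → 0# ≤ s → UpperBound (Below x) s → x ≤ φ s
    φ-sup-≥ {x} {s} 0≤s upper with ≤-or-> x (φ s)
    ... | inj₁ x≤φs = x≤φs
    ... | inj₂ φs<x with h , 0<h , h≤1 , ch<x-φs ← small-step (slope>0 0≤s) (<⇒0<- φs<x) =
      ⊥-elim (<⇒≱ (<-slack 0<h (solve 2 (λ s h → s :+ h :- s := h) s h))
          (upper (s + h) (+-nonNeg 0≤s (<⇒≤ 0<h) , ≤-trans (φ-right 0≤s (<⇒≤ 0<h) h≤1)
        (≤-slack (≤⇒0≤- (<⇒≤ ch<x-φs)) (solve 3 (λ x f e → x :- (f :+ e) := x :- f :- e) x (φ s) (slope s * h))))))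

    -- If φ s > x, then φ (s - h) > x for some small h > 0, and by monotonicity s - h is a smaller
    -- upper bound. At s ≈ 0 there is no room for such a step, and φ 0 ≈ 0 settles the claim.
    φ-sup-≤ : ∀ {x s} → 0# ≤ x → 0# ≤ s → (∀ b → UpperBound (Below x) b → s ≤ b) → φ s ≤ x
    φ-sup-≤ {x} {s} 0≤x 0≤s least with ≤-or-> (φ s) x | em {s ≈ 0#}
    ... | inj₁ φs≤x | _       = φs≤x
    ... | inj₂ x<φs | yes s≈0 = ≤-respˡ (sym (trans (φ-cong s≈0) φ-0)) 0≤x
    ... | inj₂ x<φs | no  s≉0 = ⊥-elim (<⇒≱ s-h<s (least (s - h) below))
      where
      step = small-step (slope>0 0≤s) (<⇒0<- x<φs)
      lower = common-lower (proj₁ (proj₂ step)) (0≤s , λ 0≈s → s≉0 (sym 0≈s))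
      h = proj₁ lower
      0<h = proj₁ (proj₂ lower)
      h≤h₀ = proj₁ (proj₂ (proj₂ lower))
      h≤s = proj₂ (proj₂ (proj₂ lower))
      s-h<s : s - h < s
      s-h<s = <-slack 0<h (solve 2 (λ s h → s :- (s :- h) := h) s h)
      ch<φs-x : slope s * h < φ s - x
      ch<φs-x = ≤-<-trans (*-monoˡ-≤ (<⇒≤ (slope>0 0≤s)) h≤h₀) (proj₂ (proj₂ (proj₂ step)))
      x<φ[s-h] : x < φ (s - h)
      x<φ[s-h] = <-≤-trans (<-slack (<⇒0<- ch<φs-x)
        (solve 3 (λ x f e → f :- e :- x := f :- x :- e) x (φ s) (slope s * h)))
        (φ-left (<⇒≤ 0<h) (≤-trans h≤h₀ (proj₁ (proj₂ (proj₂ step)))) h≤s)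
      below : UpperBound (Below x) (s - h)
      below y (0≤y , φy≤x) with ≤-or-> y (s - h)
      ... | inj₁ y≤ = y≤
      ... | inj₂ s-h<y = ⊥-elim (<⇒≱ x<φ[s-h] (≤-trans (φ-mono (≤⇒0≤- h≤s) (<⇒≤ s-h<y)) φy≤x))

    abstract
      preimage : ∀ {x} → 0# ≤ x → ∃ λ y → 0# ≤ y × φ y ≈ x
      preimage {x} 0≤x with complete (Below x) (0# , below-0 0≤x) (x + 1# , below-bounded 0≤x)
      ... | s , upper , least = s , 0≤s , antisym (φ-sup-≤ 0≤x 0≤s least) (φ-sup-≥ 0≤s upper)
        where
        0≤s : 0# ≤ s
        0≤s = upper 0# (below-0 0≤x)

  square-increasing : Increasing (λ y → y * y)
  square-increasing = record
    { φ-cong  = λ x≈y → *-cong x≈y x≈y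
    ; φ-0     = zeroˡ 0#
    ; φ-mono  = square-mono-≤
    ; φ-large = λ {x} 1≤x → ≤-slack (*-nonNeg (≤-trans 0≤1 1≤x) (≤⇒0≤- 1≤x))
        (solve 1 (λ x → x :* x :- x := x :* (x :- con 1)) x)
    -- (y + h)² - y² = 2yh + h² is at most (2y + 1)h for h ≤ 1.
    ; slope   = λ y → y + y + 1#
    ; slope>0 = λ {y} 0≤y → <-≤-trans 0<1
        (≤-slack (+-nonNeg 0≤y 0≤y) (solve 1 (λ y → y :+ y :+ con 1 :- con 1 := y :+ y) y))
    ; φ-right = λ {y} {h} 0≤y 0≤h h≤1 → ≤-slack (*-nonNeg 0≤h (≤⇒0≤- h≤1))
        (solve 2 (λ y h → y :* y :+ (y :+ y :+ con 1) :* h :- (y :+ h) :* (y :+ h) := h :* (con 1 :- h)) y h)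
    ; φ-left  = λ {y} {h} 0≤h h≤1 h≤y → ≤-slack (+-nonNeg (*-nonNeg 0≤h 0≤h) 0≤h)
        (solve 2 (λ y h → (y :- h) :* (y :- h) :- (y :* y :- (y :+ y :+ con 1) :* h) := h :* h :+ h) y h)
    }

  cube-increasing : Increasing (λ y → y * y * y)
  cube-increasing = record
    { φ-cong  = λ x≈y → *-cong (*-cong x≈y x≈y) x≈y
    ; φ-0     = zeroʳ _
    ; φ-mono  = λ 0≤x x≤y → *-mono-≤ 0≤x (square-nonNeg _) (square-mono-≤ 0≤x x≤y) x≤y
    ; φ-large = λ {x} 1≤x → let 0≤x-1 = ≤⇒0≤- 1≤x; 0≤x = ≤-trans 0≤1 1≤x in
        ≤-slack (*-nonNeg 0≤x (*-nonNeg 0≤x-1 (+-nonNeg 0≤x 0≤1)))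
        (solve 1 (λ x → x :* x :* x :- x := x :* ((x :- con 1) :* (x :+ con 1))) x)
    ; slope   = slope
    ; slope>0 = λ {y} 0≤y → <-≤-trans 0<1 (≤-slack (+-nonNeg (3y²≥0 y) (3y≥0 0≤y))
        (solve 1 (λ y → con 3 :* (y :* y) :+ con 3 :* y :+ con 1 :- con 1 := con 3 :* (y :* y) :+ con 3 :* y) y))
    ; φ-right = λ {y} {h} 0≤y 0≤h h≤1 → let 0≤1-h = ≤⇒0≤- h≤1 in
        ≤-slack (*-nonNeg 0≤h (+-nonNeg (*-nonNeg (3y≥0 0≤y) 0≤1-h) (*-nonNeg 0≤1-h (+-nonNeg 0≤1 0≤h))))
        (solve 2 (λ y h → y :* y :* y :+ (con 3 :* (y :* y) :+ con 3 :* y :+ con 1) :* h :- (y :+ h) :* (y :+ h)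
            :* (y :+ h)
          := h :* (con 3 :* y :* (con 1 :- h) :+ (con 1 :- h) :* (con 1 :+ h))) y h)
    ; φ-left  = λ {y} {h} 0≤h h≤1 h≤y → let 0≤y = ≤-trans 0≤h h≤y; 0≤1-h = ≤⇒0≤- h≤1 in
        ≤-slack (*-nonNeg 0≤h (+-nonNeg (+-nonNeg (3y≥0 0≤y) (*-nonNeg (3y≥0 0≤y) 0≤h))
            (*-nonNeg 0≤1-h (+-nonNeg 0≤1 0≤h))))
        (solve 2 (λ y h → (y :- h) :* (y :- h) :* (y :- h)
            :- (y :* y :* y :- (con 3 :* (y :* y) :+ con 3 :* y :+ con 1) :* h)
          := h :* (con 3 :* y :+ con 3 :* y :* h :+ (con 1 :- h) :* (con 1 :+ h))) y h)
    }
    where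
    slope : ℝ → ℝ
    -- (y + h)³ - y³ = 3y²h + 3yh² + h³ is at most (3y² + 3y + 1)h for h ≤ 1.
    slope y = fromℕ 3 * (y * y) + fromℕ 3 * y + 1#
    3y²≥0 : ∀ y → 0# ≤ fromℕ 3 * (y * y)
    3y²≥0 y = *-nonNeg (fromℕ-nonNeg 3) (square-nonNeg y)
    3y≥0 : ∀ {y} → 0# ≤ y → 0# ≤ fromℕ 3 * y
    3y≥0 0≤y = *-nonNeg (fromℕ-nonNeg 3) 0≤y

  abstract
    square-root : ∀ {x} → 0# ≤ x → ∃ λ y → 0# ≤ y × y * y ≈ x
    square-root = preimage square-increasing

    cube-root : ∀ {x} → 0# ≤ x → ∃ λ y → 0# ≤ y × y * y * y ≈ x
    cube-root = preimage cube-increasing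

    sup-maximum : ∀ {P m} → P m → UpperBound P m → sup P ≈ m
    sup-maximum {P} {m} Pm bound with em {∃ P × ∃ (UpperBound P)}
    ... | yes (nonEmpty , bounded) with complete P nonEmpty bounded
    ...   | s , upper , least = antisym (least m bound) (upper m Pm)
    sup-maximum {P} {m} Pm bound | no ¬both = ⊥-elim (¬both ((m , Pm) , (m , bound)))

    -- The nonnegative root is itself the maximum of the set whose supremum defines `√`.
    √-unique : ∀ {x y} → 0# ≤ y → y * y ≈ x → √ x ≈ y
    √-unique 0≤y y²≈x = sup-maximum (≤-reflexive y²≈x)
      (λ z z²≤x → square-cancel-≤ 0≤y (≤-respʳ (sym y²≈x) z²≤x))

    √-nonNeg : ∀ {x} → 0# ≤ x → 0# ≤ √ x
    √-nonNeg 0≤x with y , 0≤y , y²≈x ← square-root 0≤x = ≤-respʳ (sym (√-unique 0≤y y²≈x)) 0≤y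

    √-square : ∀ {x} → 0# ≤ x → √ x * √ x ≈ x
    √-square 0≤x with y , 0≤y , y²≈x ← square-root 0≤x =
      trans (*-cong (√-unique 0≤y y²≈x) (√-unique 0≤y y²≈x)) y²≈x

    √-upper : ∀ {x y} → 0# ≤ x → 0# ≤ y → x ≤ y * y → √ x ≤ y
    √-upper 0≤x 0≤y x≤y² = square-cancel-≤ 0≤y (≤-respˡ (sym (√-square 0≤x)) x≤y²)

    √-lower : ∀ {x y} → 0# ≤ x → y * y ≤ x → y ≤ √ x
    √-lower 0≤x y²≤x = square-cancel-≤ (√-nonNeg 0≤x) (≤-respʳ (sym (√-square 0≤x)) y²≤x)

-- Comparison of the natural logarithm with the binary exponent.

module Logarithms (em : ExcludedMiddle 0ℓ) (real : CompleteOrderedField) where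
  open Classical em real hiding (zero)
  open Reals em real
  open Roots em real

  abstract

    -- The inequality is asked for only infinitely often, so that (1 + ℓ/n)ⁿ can be estimated along
    -- the multiples n = Km of a fixed m.
    limit-≥ : ∀ {u l b} → u ⟶ l → (∀ N → ∃ λ n → N ℕ.≤ n × b ≤ u n) → b ≤ l
    limit-≥ {u} {l} {b} u⟶l frequently with ≤-or-> b l
    ... | inj₁ b≤l = b≤l
    ... | inj₂ l<b with N , close ← u⟶l (b - l) (<⇒0<- l<b) with n , N≤n , b≤un ← frequently N =
      ⊥-elim (<⇒≱ (<-respʳ (solve 2 (λ b l → l :+ (b :- l) := b) b l) (proj₂ (close n N≤n))) b≤un)

    limit-≤ : ∀ {u l b} → u ⟶ l → (∀ N → ∃ λ n → N ℕ.≤ n × u n ≤ b) → l ≤ b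
    limit-≤ {u} {l} {b} u⟶l frequently with ≤-or-> l b
    ... | inj₁ l≤b = l≤b
    ... | inj₂ b<l with N , close ← u⟶l (l - b) (<⇒0<- b<l) with n , N≤n , un≤b ← frequently N =
      ⊥-elim (<⇒≱ (<-respˡ (solve 2 (λ b l → l :- (l :- b) := b) b l) (proj₁ (close n N≤n))) un≤b)

    ^-nonNeg : ∀ {x} → 0# ≤ x → ∀ n → 0# ≤ x ^ n
    ^-nonNeg 0≤x zero    = 0≤1
    ^-nonNeg 0≤x (suc n) = *-nonNeg 0≤x (^-nonNeg 0≤x n)

    ^-mono-≤ : ∀ {x y} → 0# ≤ x → x ≤ y → ∀ n → x ^ n ≤ y ^ n
    ^-mono-≤ 0≤x x≤y zero    = ≤-refl
    ^-mono-≤ 0≤x x≤y (suc n) = *-mono-≤ (^-nonNeg 0≤x n) (≤-trans 0≤x x≤y) x≤y (^-mono-≤ 0≤x x≤y n)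

    1^n≈1 : ∀ n → 1# ^ n ≈ 1#
    1^n≈1 zero    = refl
    1^n≈1 (suc n) = trans (*-identityˡ _) (1^n≈1 n)

    bernoulli : ∀ {x} → 0# ≤ 1# + x → ∀ n → 1# + fromℕ n * x ≤ (1# + x) ^ n
    bernoulli {x} 0≤1+x zero    = ≤-reflexive (solve 1 (λ x → con 1 :+ con 0 :* x := con 1) x)
    bernoulli {x} 0≤1+x (suc n) = ≤-trans
      (≤-slack (*-nonNeg (fromℕ-nonNeg n) (square-nonNeg x))
        (solve 2 (λ x n → (con 1 :+ x) :* (con 1 :+ n :* x) :- (con 1 :+ (con 1 :+ n) :* x) := n :* (x :* x)) x
            (fromℕ n)))
      (*-monoˡ-≤ 0≤1+x (bernoulli 0≤1+x n))

    fromℕ-^ : ∀ m n → fromℕ (m ℕ.^ n) ≈ fromℕ m ^ n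
    fromℕ-^ m zero    = +-identityʳ 1#
    fromℕ-^ m (suc n) = trans (fromℕ-* m (m ℕ.^ n)) (*-congˡ (fromℕ-^ m n))

    product-inverse : ∀ k m → fromℕ (suc k) * fromℕ (suc m) * fromℕ (suc k ℕ.* suc m) ⁻¹ ≈ 1#
    product-inverse k m = trans (*-congʳ (sym (fromℕ-* (suc k) (suc m))))
      (*-inverseʳ _ (>⇒≉0 (fromℕ-pos {suc k ℕ.* suc m} (s≤s z≤n))))

    -- Along the exponents K·m, Bernoulli gives (1 + ℓ/(Km))ᴷ ≥ 1 + ℓ/m ≥ 2.
    log≥⇒2^≤ : ∀ {x ℓ} m → IsLog x ℓ → fromℕ (suc m) ≤ ℓ → fromℕ 2 ^ suc m ≤ x
    log≥⇒2^≤ {x} {ℓ} m isLog m≤ℓ = limit-≥ isLog λ k →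
      let K = fromℕ (suc k); M = fromℕ (suc m); i = fromℕ (suc k ℕ.* suc m) ⁻¹
          KMi≈1 = product-inverse k m
          0≤i : 0# ≤ i
          0≤i = <⇒≤ (⁻¹-pos (fromℕ-pos {suc k ℕ.* suc m} (s≤s z≤n)))
          0≤ℓ = ≤-trans (fromℕ-nonNeg (suc m)) m≤ℓ
          0≤1+ℓi = +-nonNeg 0≤1 (*-nonNeg 0≤ℓ 0≤i)
          2≤1+Kℓi : fromℕ 2 ≤ 1# + K * (ℓ * i)
          2≤1+Kℓi = ≤-slack (*-nonNeg (*-nonNeg (fromℕ-nonNeg (suc k)) 0≤i) (≤⇒0≤- m≤ℓ))
            (combine₁ 1# KMi≈1 (solve 4 (λ K M i l →
              (con 1 :+ K :* (l :* i) :- con 2) :- K :* i :* (l :- M) := con 1 :* (K :* M :* i :- con 1)) K M i ℓ))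
      -- The term of index n has exponent n + 1, and the successor of this index computes to
      -- `suc k * suc m`.
      in m ℕ.+ k ℕ.* suc m , ℕₚ.≤-trans (ℕₚ.m≤m*n k (suc m)) (ℕₚ.m≤n+m _ m) ,
         ≤-respʳ (^-assocʳ (1# + ℓ * i) (suc k) (suc m))
           (^-mono-≤ (fromℕ-nonNeg 2) (≤-trans 2≤1+Kℓi (bernoulli 0≤1+ℓi (suc k))) (suc m))

    -- With 3Ks = 1: (1 + s)ᴷ ≤ (1 - s)⁻ᴷ ≤ (1 - Ks)⁻¹ = 3/2.
    power-bound : ∀ k {s} → 0# ≤ s → fromℕ 3 * fromℕ (suc k) * s ≈ 1# → fromℕ 2 * (1# + s) ^ suc k ≤ fromℕ 3
    power-bound k {s} 0≤s 3Ks≈1 = ≤-trans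
      (≤-slack (*-nonNeg (*-nonNeg (fromℕ-nonNeg 3) 0≤P) (≤⇒0≤- (bernoulli 0≤1-s (suc k))))
        (combine₁ (- P) 3Ks≈1 (solve 4
            (λ P Q K s → (con 3 :* (Q :* P) :- con 2 :* P) :- con 3 :* P :* (Q :- (con 1 :+ K :* (:- s)))
          := (:- P) :* (con 3 :* K :* s :- con 1)) P Q K s)))
      (≤-respʳ (*-identityʳ _) (*-monoˡ-≤ (fromℕ-nonNeg 3) QP≤1))
      where
      K P Q : ℝ
      K = fromℕ (suc k)
      P = (1# + s) ^ suc k
      Q = (1# - s) ^ suc k
      0≤1+s : 0# ≤ 1# + s
      0≤1+s = +-nonNeg 0≤1 0≤s
      0≤P : 0# ≤ P
      0≤P = ^-nonNeg 0≤1+s (suc k)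
      0≤1-s : 0# ≤ 1# - s
      0≤1-s = ≤⇒0≤- (≤-slack (*-nonNeg
          (+-nonNeg (+-nonNeg 0≤1 0≤1) (*-nonNeg (fromℕ-nonNeg 3) (fromℕ-nonNeg k))) 0≤s)
        (combine₁ (- 1#) 3Ks≈1 (solve 2 (λ k s → (con 1 :- s) :- (con 1 :+ con 1 :+ con 3 :* k) :* s
          := :- con 1 :* (con 3 :* (con 1 :+ k) :* s :- con 1)) (fromℕ k) s)))
      QP≤1 : Q * P ≤ 1#
      QP≤1 = ≤-resp (^-distrib-* (1# - s) (1# + s) (suc k)) (1^n≈1 (suc k))
        (^-mono-≤ (*-nonNeg 0≤1-s 0≤1+s) (≤-slack (square-nonNeg s)
          (solve 1 (λ s → con 1 :- (con 1 :- s) :* (con 1 :+ s) := s :* s) s)) (suc k))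

    -- With M = m + 1 and ℓ/M ≤ 1/3, each K gives (1 + ℓ/(KM))ᴷ ≤ (1 + 1/(3K))ᴷ ≤ 3/2. Choosing K ≥
    -- -ℓ keeps the base nonnegative when ℓ is negative.
    log≤⇒≤3/2^ : ∀ {x ℓ} m → IsLog x ℓ → fromℕ 3 * ℓ ≤ fromℕ (suc m) → x ≤ (half * fromℕ 3) ^ suc m
    log≤⇒≤3/2^ {x} {ℓ} m isLog 3ℓ≤m with a , -ℓ≤a ← archimedean (- ℓ) = limit-≤ isLog λ N →
      let k = N ℕ.⊔ a; K = fromℕ (suc k); M = fromℕ (suc m); i = fromℕ (suc k ℕ.* suc m) ⁻¹
          KMi≈1 = product-inverse k m
          0<i : 0# < i
          0<i = ⁻¹-pos (fromℕ-pos {suc k ℕ.* suc m} (s≤s z≤n))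
          0<3K : 0# < fromℕ 3 * K
          0<3K = *-pos (fromℕ-pos {3} (s≤s z≤n)) (fromℕ-pos {suc k} (s≤s z≤n))
          s = (fromℕ 3 * K) ⁻¹
          3Ks≈1 = *-inverseʳ _ (>⇒≉0 0<3K)
          -ℓ≤K = ≤-trans -ℓ≤a (fromℕ-mono-≤ {a} {suc k} (ℕₚ.m≤n⇒m≤1+n (ℕₚ.m≤n⊔m N a)))
          0≤K+ℓ : 0# ≤ K + ℓ
          0≤K+ℓ = ≤-respʳ (solve 2 (λ K l → K :- (:- l) := K :+ l) K ℓ) (≤⇒0≤- -ℓ≤K)
          0≤1+ℓi : 0# ≤ 1# + ℓ * i
          0≤1+ℓi = ≤-respʳ (combine₁ 1# KMi≈1 (solve 4 (λ K m i l →
              i :* ((K :+ l) :+ K :* m) :- (con 1 :+ l :* i) := con 1 :* (K :* (con 1 :+ m) :* i :- con 1)) K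
                  (fromℕ m) i ℓ))
            (*-nonNeg (<⇒≤ 0<i) (+-nonNeg 0≤K+ℓ (*-nonNeg (fromℕ-nonNeg (suc k)) (fromℕ-nonNeg m))))
          ℓi≤s : ℓ * i ≤ s
          ℓi≤s = *-cancelˡ-≤ 0<3K (≤-slack (*-nonNeg (*-nonNeg (fromℕ-nonNeg (suc k)) (<⇒≤ 0<i)) (≤⇒0≤- 3ℓ≤m))
            (combine₂ 1# (- 1#) 3Ks≈1 KMi≈1 (solve 5 (λ K M i l s →
              (con 3 :* K :* s :- con 3 :* K :* (l :* i)) :- K :* i :* (M :- con 3 :* l)
              := con 1 :* (con 3 :* K :* s :- con 1) :+ (:- con 1) :* (K :* M :* i :- con 1)) K M i ℓ s)))
          [1+ℓi]^K≤3/2 : (1# + ℓ * i) ^ suc k ≤ half * fromℕ 3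
          [1+ℓi]^K≤3/2 = ≤-respˡ (combine₁ ((1# + ℓ * i) ^ suc k) 2*half
              (solve 2 (λ P h → h :* (con 2 :* P) :- P := P :* (con 2 :* h :- con 1)) ((1# + ℓ * i) ^ suc k) half))
            (*-monoˡ-≤ (<⇒≤ half-pos) (≤-trans
              (*-monoˡ-≤ (fromℕ-nonNeg 2) (^-mono-≤ 0≤1+ℓi (+-monoʳ-≤ 1# ℓi≤s) (suc k)))
              (power-bound k (<⇒≤ (⁻¹-pos 0<3K)) 3Ks≈1)))
      in m ℕ.+ k ℕ.* suc m , ℕₚ.≤-trans (ℕₚ.m≤m⊔n N a) (ℕₚ.≤-trans (ℕₚ.m≤m*n k (suc m)) (ℕₚ.m≤n+m _ m)) ,
         ≤-respˡ (^-assocʳ (1# + ℓ * i) (suc k) (suc m))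
           (^-mono-≤ (^-nonNeg 0≤1+ℓi (suc k)) [1+ℓi]^K≤3/2 (suc m))

    log-upper : ∀ {H L ℓ} → IsLog (fromℕ H) ℓ → H ℕ.< 2 ℕ.^ suc L → ℓ ≤ fromℕ (suc L)
    log-upper {H} {L} {ℓ} isLog H<2^ with ≤-or-> ℓ (fromℕ (suc L))
    ... | inj₁ ℓ≤ = ℓ≤
    ... | inj₂ <ℓ = ⊥-elim (ℕₚ.<⇒≱ H<2^ (fromℕ-cancel-≤
      (≤-respˡ (sym (fromℕ-^ 2 (suc L))) (log≥⇒2^≤ L isLog (<⇒≤ <ℓ)))))

    -- Otherwise 2^L ≤ H ≤ (3/2)^L, hence 4^L ≤ 3^L, which is false for L ≥ 1.
    log-lower : ∀ {H L ℓ} → IsLog (fromℕ H) ℓ → 1 ℕ.≤ L → 2 ℕ.^ L ℕ.≤ H → fromℕ L ≤ fromℕ 3 * ℓ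
    log-lower {H} {suc m} {ℓ} isLog _ 2^≤H with ≤-or-> (fromℕ (suc m)) (fromℕ 3 * ℓ)
    ... | inj₁ ≤3ℓ = ≤3ℓ
    ... | inj₂ 3ℓ< = ⊥-elim (ℕₚ.<⇒≱ (ℕₚ.^-monoˡ-< (suc m) {3} {4} ℕₚ.≤-refl)
        (≡.subst (ℕ._≤ 3 ℕ.^ suc m) (≡.sym (ℕₚ.^-*-assoc 2 2 (suc m)) ) 4^≤3^))
      where
      2^mH≤3^m : fromℕ 2 ^ suc m * fromℕ H ≤ fromℕ 3 ^ suc m
      2^mH≤3^m = ≤-respʳ
        (trans (sym (^-distrib-* (fromℕ 2) (half * fromℕ 3) (suc m)))
          (^-congˡ (suc m) (combine₁ (fromℕ 3) 2*half
              (solve 1 (λ h → con 2 :* (h :* con 3) :- con 3 := con 3 :* (con 2 :* h :- con 1)) half))))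
        (*-monoˡ-≤ (^-nonNeg (fromℕ-nonNeg 2) (suc m)) (log≤⇒≤3/2^ m isLog (<⇒≤ 3ℓ<)))
      2^mH≤3^m′ : 2 ℕ.^ suc m ℕ.* H ℕ.≤ 3 ℕ.^ suc m
      2^mH≤3^m′ = fromℕ-cancel-≤ (≤-resp
        (sym (trans (fromℕ-* (2 ℕ.^ suc m) H) (*-congʳ (fromℕ-^ 2 (suc m))))) (sym (fromℕ-^ 3 (suc m))) 2^mH≤3^m)
      4^≤3^ : 2 ℕ.^ (2 ℕ.* suc m) ℕ.≤ 3 ℕ.^ suc m
      4^≤3^ = ℕₚ.≤-trans (ℕₚ.≤-reflexive
          (≡.trans (≡.cong (2 ℕ.^_) (≡.cong (suc m ℕ.+_) (ℕₚ.+-identityʳ (suc m))))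
              (ℕₚ.^-distribˡ-+-* 2 (suc m) (suc m))))
        (ℕₚ.≤-trans (ℕₚ.*-monoʳ-≤ (2 ℕ.^ suc m) 2^≤H) 2^mH≤3^m′)

-- The ring ℂ, conjugation, and Viète's formulas in degrees three and four.

module Complex (em : ExcludedMiddle 0ℓ) (real : CompleteOrderedField) where
  open Classical em real hiding (zero)
  open Reals em real

  abstract

    ≈ℂ-refl : ∀ {z} → z ≈ℂ z
    ≈ℂ-refl = refl , refl

    ≈ℂ-sym : ∀ {z w} → z ≈ℂ w → w ≈ℂ z
    ≈ℂ-sym (r , i) = sym r , sym i

    ≈ℂ-trans : ∀ {z w v} → z ≈ℂ w → w ≈ℂ v → z ≈ℂ v
    ≈ℂ-trans (r , i) (r′ , i′) = trans r r′ , trans i i′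

    +ℂ-cong : ∀ {z w z′ w′} → z ≈ℂ w → z′ ≈ℂ w′ → (z +ℂ z′) ≈ℂ (w +ℂ w′)
    +ℂ-cong (r , i) (r′ , i′) = +-cong r r′ , +-cong i i′

    *ℂ-cong : ∀ {z w z′ w′} → z ≈ℂ w → z′ ≈ℂ w′ → (z *ℂ z′) ≈ℂ (w *ℂ w′)
    *ℂ-cong (r , i) (r′ , i′) = +-cong (*-cong r r′) (-‿cong (*-cong i i′)) , +-cong (*-cong r i′) (*-cong i r′)

    -ℂ-cong : ∀ {z w} → z ≈ℂ w → (-ℂ z) ≈ℂ (-ℂ w)
    -ℂ-cong (r , i) = -‿cong r , -‿cong i

    *ℂ-assoc : ∀ x y z → ((x *ℂ y) *ℂ z) ≈ℂ (x *ℂ (y *ℂ z))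
    *ℂ-assoc (a +i b) (c +i d) (e +i f) =
      solve 6 (λ a b c d e f → (a :* c :- b :* d) :* e :- (a :* d :+ b :* c) :* f
          := a :* (c :* e :- d :* f) :- b :* (c :* f :+ d :* e)) a b c d e f ,
      solve 6 (λ a b c d e f → (a :* c :- b :* d) :* f :+ (a :* d :+ b :* c) :* e := a :* (c :* f :+ d :* e)
          :+ b :* (c :* e :- d :* f)) a b c d e f

    *ℂ-comm : ∀ x y → (x *ℂ y) ≈ℂ (y *ℂ x)
    *ℂ-comm (a +i b) (c +i d) =
      solve 4 (λ a b c d → a :* c :- b :* d := c :* a :- d :* b) a b c d ,
      solve 4 (λ a b c d → a :* d :+ b :* c := c :* b :+ d :* a) a b c d

    *ℂ-identityˡ : ∀ x → (realℂ 1# *ℂ x) ≈ℂ x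
    *ℂ-identityˡ (a +i b) = solve 2 (λ a b → con 1 :* a :- con 0 :* b := a) a b ,
      solve 2 (λ a b → con 1 :* b :+ con 0 :* a := b) a b

    *ℂ-distribˡ : ∀ x y z → (x *ℂ (y +ℂ z)) ≈ℂ ((x *ℂ y) +ℂ (x *ℂ z))
    *ℂ-distribˡ (a +i b) (c +i d) (e +i f) =
      solve 6 (λ a b c d e f → a :* (c :+ e) :- b :* (d :+ f) := (a :* c :- b :* d) :+ (a :* e :- b :* f)) a
          b c d e f ,
      solve 6 (λ a b c d e f → a :* (d :+ f) :+ b :* (c :+ e) := (a :* d :+ b :* c) :+ (a :* f :+ b :* e))
          a b c d e f

  ℂ-commutativeRing : CommutativeRing 0ℓ 0ℓ
  ℂ-commutativeRing = record
    { Carrier = ℂ ; _≈_ = _≈ℂ_ ; _+_ = _+ℂ_ ; _*_ = _*ℂ_ ; -_ = -ℂ_ ; 0# = realℂ 0# ; 1# = realℂ 1#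
    ; isCommutativeRing = record
      { isRing = record
        { +-isAbelianGroup = record
          { isGroup = record
            { isMonoid = record
              { isSemigroup = record
                { isMagma = record
                  { isEquivalence = record { refl = ≈ℂ-refl ; sym = ≈ℂ-sym ; trans = ≈ℂ-trans }
                  ; ∙-cong = +ℂ-cong }
                ; assoc = λ x y z → +-assoc (re x) (re y) (re z) , +-assoc (im x) (im y) (im z) }
              ; identity = (λ x → +-identityˡ (re x) , +-identityˡ (im x))
                  , (λ x → +-identityʳ (re x) , +-identityʳ (im x)) }
            ; inverse = (λ x → -‿inverseˡ (re x) , -‿inverseˡ (im x))
                , (λ x → -‿inverseʳ (re x) , -‿inverseʳ (im x))
            ; ⁻¹-cong = -ℂ-cong }
          ; comm = λ x y → +-comm (re x) (re y) , +-comm (im x) (im y) }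
        ; *-cong = *ℂ-cong
        ; *-assoc = *ℂ-assoc
        ; *-identity = *ℂ-identityˡ , (λ x → ≈ℂ-trans (*ℂ-comm x (realℂ 1#)) (*ℂ-identityˡ x))
        ; distrib = *ℂ-distribˡ , (λ x y z → ≈ℂ-trans (*ℂ-comm (y +ℂ z) x)
            (≈ℂ-trans (*ℂ-distribˡ x y z) (+ℂ-cong (*ℂ-comm x y) (*ℂ-comm x z)))) }
      ; *-comm = *ℂ-comm } }

  module ℂRing = CommutativeRing ℂ-commutativeRing
  module ℂSolver = IntegerRingSolver ℂ-commutativeRing
  module ≈ℂ-Reasoning = SetoidReasoning ℂRing.setoid

  -- The squared modulus: multiplicative, and polynomial in the real and imaginary parts.
  norm : ℂ → ℝ
  norm z = re z * re z + im z * im z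

  conj : ℂ → ℂ
  conj z = re z +i (- im z)

  abstract

    norm-cong : ∀ {z w} → z ≈ℂ w → norm z ≈ norm w
    norm-cong (r , i) = +-cong (*-cong r r) (*-cong i i)

    norm-nonNeg : ∀ z → 0# ≤ norm z
    norm-nonNeg z = +-nonNeg (square-nonNeg (re z)) (square-nonNeg (im z))

    norm-* : ∀ z w → norm (z *ℂ w) ≈ norm z * norm w
    norm-* (a +i b) (c +i d) = solve 4 (λ a b c d →
      (a :* c :- b :* d) :* (a :* c :- b :* d) :+ (a :* d :+ b :* c) :* (a :* d :+ b :* c)
      := (a :* a :+ b :* b) :* (c :* c :+ d :* d)) a b c d

    norm-neg : ∀ z → norm (-ℂ z) ≈ norm z
    norm-neg (a +i b) = solve 2 (λ a b → (:- a) :* (:- a) :+ (:- b) :* (:- b) := a :* a :+ b :* b) a b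

    norm-conj : ∀ z → norm (conj z) ≈ norm z
    norm-conj (a +i b) = solve 2 (λ a b → a :* a :+ (:- b) :* (:- b) := a :* a :+ b :* b) a b

    norm-realℂ : ∀ x → norm (realℂ x) ≈ x * x
    norm-realℂ x = solve 1 (λ x → x :* x :+ con 0 :* con 0 := x :* x) x

    norm-zero : ∀ {z} → norm z ≈ 0# → z ≈ℂ realℂ 0#
    norm-zero {z} Nz≈0 =
      square-zero (sum-nonNeg-zeroˡ (square-nonNeg (re z)) (square-nonNeg (im z)) Nz≈0) ,
      square-zero (sum-nonNeg-zeroˡ (square-nonNeg (im z)) (square-nonNeg (re z)) (trans (+-comm _ _) Nz≈0))

    ℂ-zero-product : ∀ {z w} → (z *ℂ w) ≈ℂ realℂ 0# → z ≈ℂ realℂ 0# ⊎ w ≈ℂ realℂ 0#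
    ℂ-zero-product {z} {w} zw≈0 with zero-product (trans (sym (norm-* z w))
      (trans (norm-cong zw≈0) (trans (norm-realℂ 0#) (zeroˡ 0#))))
    ... | inj₁ Nz≈0 = inj₁ (norm-zero Nz≈0)
    ... | inj₂ Nw≈0 = inj₂ (norm-zero Nw≈0)

    conj-cong : ∀ {z w} → z ≈ℂ w → conj z ≈ℂ conj w
    conj-cong (r , i) = r , -‿cong i

    conj-+ : ∀ z w → conj (z +ℂ w) ≈ℂ (conj z +ℂ conj w)
    conj-+ z w = refl , solve 2 (λ a b → :- (a :+ b) := (:- a) :+ (:- b)) (im z) (im w)

    conj-* : ∀ z w → conj (z *ℂ w) ≈ℂ (conj z *ℂ conj w)
    conj-* (a +i b) (c +i d) =
      solve 4 (λ a b c d → a :* c :- b :* d := a :* c :- (:- b) :* (:- d)) a b c d ,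
      solve 4 (λ a b c d → :- (a :* d :+ b :* c) := a :* (:- d) :+ (:- b) :* c) a b c d

    conj-realℂ : ∀ x → conj (realℂ x) ≈ℂ realℂ x
    conj-realℂ x = refl , solve 0 (:- con 0 := con 0)

    *-conj : ∀ z → (z *ℂ conj z) ≈ℂ realℂ (norm z)
    *-conj (a +i b) = solve 2 (λ a b → a :* a :- b :* (:- b) := a :* a :+ b :* b) a b ,
      solve 2 (λ a b → a :* (:- b) :+ b :* a := con 0) a b

    realℂ-cong : ∀ {x y} → x ≈ y → realℂ x ≈ℂ realℂ y
    realℂ-cong x≈y = x≈y , refl

    realℂ-+ : ∀ x y → realℂ (x + y) ≈ℂ (realℂ x +ℂ realℂ y)
    realℂ-+ x y = refl , sym (+-identityˡ 0#)

    realℂ-* : ∀ x y → realℂ (x * y) ≈ℂ (realℂ x *ℂ realℂ y)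
    realℂ-* x y = solve 2 (λ x y → x :* y := x :* y :- con 0 :* con 0) x y ,
      solve 2 (λ x y → con 0 := x :* con 0 :+ con 0 :* y) x y

    realℂ-neg : ∀ x → realℂ (- x) ≈ℂ (-ℂ realℂ x)
    realℂ-neg x = refl , solve 0 (con 0 := :- con 0)

  -- Viète's formulas

  open ℂRing public using () renaming (_+_ to infixl 6 _+ᶜ_; _*_ to infixl 7 _*ᶜ_; -_ to infix 8 -ᶜ_)

  record Roots₃ (u v w : ℝ) (α β γ : ℂ) : Set where
    constructor roots₃
    field
      e₁ : realℂ u ≈ℂ (-ᶜ (α +ᶜ β +ᶜ γ))
      e₂ : realℂ v ≈ℂ (α *ᶜ β +ᶜ α *ᶜ γ +ᶜ β *ᶜ γ)
      e₃ : realℂ w ≈ℂ (-ᶜ (α *ᶜ β *ᶜ γ))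

  record Roots₄ (a b c d : ℝ) (α β γ δ : ℂ) : Set where
    constructor roots₄
    field
      e₁ : realℂ a ≈ℂ (-ᶜ (α +ᶜ β +ᶜ γ +ᶜ δ))
      e₂ : realℂ b ≈ℂ (α *ᶜ β +ᶜ α *ᶜ γ +ᶜ α *ᶜ δ +ᶜ β *ᶜ γ +ᶜ β *ᶜ δ +ᶜ γ *ᶜ δ)
      e₃ : realℂ c ≈ℂ (-ᶜ (α *ᶜ β *ᶜ γ +ᶜ α *ᶜ β *ᶜ δ +ᶜ α *ᶜ γ *ᶜ δ +ᶜ β *ᶜ γ *ᶜ δ))
      e₄ : realℂ d ≈ℂ (α *ᶜ β *ᶜ γ *ᶜ δ)

  private
    module S = ℂSolver

    -- A syntactic copy of `fromRoots`. Evaluating one of its entries gives the corresponding entry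
    -- of `fromRoots` definitionally, so the solver can expand it.
    fromRootsₑ : ∀ {m n} → Vec (Expr m) n → Vec (Expr m) (suc n)
    fromRootsₑ []       = con 1 ∷ []
    fromRootsₑ (α ∷ αs) =
      Vec.zipWith _:+_ (con 0 ∷ p) (Vec.map ((:- α) :*_) p Vec.∷ʳ con 0)
      where p = fromRootsₑ αs

    coefficientₑ : ∀ {m n} → Fin (suc n) → Vec (Expr m) n → Expr m
    coefficientₑ i αs = Vec.lookup (fromRootsₑ αs) i

  abstract

    fromRoots₃ : ∀ α β γ → Pointwise _≈ℂ_ (fromRoots (α ∷ β ∷ γ ∷ []))
      (-ᶜ (α *ᶜ β *ᶜ γ) ∷ α *ᶜ β +ᶜ α *ᶜ γ +ᶜ β *ᶜ γ ∷ -ᶜ (α +ᶜ β +ᶜ γ) ∷ realℂ 1# ∷ [])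
    fromRoots₃ α β γ =
      S.solve 3 (λ α β γ → coefficientₑ (# 0) (α ∷ β ∷ γ ∷ []) := :- (α :* β :* γ)) α β γ ∷
      S.solve 3 (λ α β γ → coefficientₑ (# 1) (α ∷ β ∷ γ ∷ []) := α :* β :+ α :* γ :+ β :* γ) α β γ ∷
      S.solve 3 (λ α β γ → coefficientₑ (# 2) (α ∷ β ∷ γ ∷ []) := :- (α :+ β :+ γ)) α β γ ∷
      S.solve 3 (λ α β γ → coefficientₑ (# 3) (α ∷ β ∷ γ ∷ []) := con 1) α β γ ∷ []

    fromRoots₄ : ∀ α β γ δ → Pointwise _≈ℂ_ (fromRoots (α ∷ β ∷ γ ∷ δ ∷ []))
      (α *ᶜ β *ᶜ γ *ᶜ δ ∷ -ᶜ (α *ᶜ β *ᶜ γ +ᶜ α *ᶜ β *ᶜ δ +ᶜ α *ᶜ γ *ᶜ δ +ᶜ β *ᶜ γ *ᶜ δ) ∷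
       α *ᶜ β +ᶜ α *ᶜ γ +ᶜ α *ᶜ δ +ᶜ β *ᶜ γ +ᶜ β *ᶜ δ +ᶜ γ *ᶜ δ ∷ -ᶜ (α +ᶜ β +ᶜ γ +ᶜ δ) ∷ realℂ 1# ∷ [])
    fromRoots₄ α β γ δ =
      S.solve 4 (λ α β γ δ → coefficientₑ (# 0) (α ∷ β ∷ γ ∷ δ ∷ []) := α :* β :* γ :* δ) α β γ δ ∷
      S.solve 4 (λ α β γ δ → coefficientₑ (# 1) (α ∷ β ∷ γ ∷ δ ∷ [])
          := :- (α :* β :* γ :+ α :* β :* δ :+ α :* γ :* δ :+ β :* γ :* δ)) α β γ δ ∷
      S.solve 4 (λ α β γ δ → coefficientₑ (# 2) (α ∷ β ∷ γ ∷ δ ∷ []) := α :* β :+ α :* γ :+ α :* δ :+ β :* γ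
          :+ β :* δ :+ γ :* δ) α β γ δ ∷
      S.solve 4 (λ α β γ δ → coefficientₑ (# 3) (α ∷ β ∷ γ ∷ δ ∷ []) := :- (α :+ β :+ γ :+ δ)) α β γ δ ∷
      S.solve 4 (λ α β γ δ → coefficientₑ (# 4) (α ∷ β ∷ γ ∷ δ ∷ []) := con 1) α β γ δ ∷ []

    roots⇒roots₃ : ∀ {w v u α β γ} → RootsOf (w ∷ v ∷ u ∷ []) (α ∷ β ∷ γ ∷ []) →
      Roots₃ (fromℤ u) (fromℤ v) (fromℤ w) α β γ
    roots⇒roots₃ {α = α} {β} {γ} roots with Pointwise.trans ≈ℂ-trans roots (fromRoots₃ α β γ)
    ... | e₃ ∷ e₂ ∷ e₁ ∷ _ ∷ [] = roots₃ e₁ e₂ e₃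

    roots₃⇒roots : ∀ {w v u α β γ} → Roots₃ (fromℤ u) (fromℤ v) (fromℤ w) α β γ →
      RootsOf (w ∷ v ∷ u ∷ []) (α ∷ β ∷ γ ∷ [])
    roots₃⇒roots {α = α} {β} {γ} (roots₃ e₁ e₂ e₃) = Pointwise.trans ≈ℂ-trans
      (e₃ ∷ e₂ ∷ e₁ ∷ realℂ-cong (+-identityʳ 1#) ∷ []) (Pointwise.sym ≈ℂ-sym (fromRoots₃ α β γ))

    roots⇒roots₄ : ∀ {d c b a α β γ δ} → RootsOf (d ∷ c ∷ b ∷ a ∷ []) (α ∷ β ∷ γ ∷ δ ∷ []) →
      Roots₄ (fromℤ a) (fromℤ b) (fromℤ c) (fromℤ d) α β γ δ
    roots⇒roots₄ {α = α} {β} {γ} {δ} roots with Pointwise.trans ≈ℂ-trans roots (fromRoots₄ α β γ δ)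
    ... | e₄ ∷ e₃ ∷ e₂ ∷ e₁ ∷ _ ∷ [] = roots₄ e₁ e₂ e₃ e₄

    roots₄⇒roots : ∀ {d c b a α β γ δ} → Roots₄ (fromℤ a) (fromℤ b) (fromℤ c) (fromℤ d) α β γ δ →
      RootsOf (d ∷ c ∷ b ∷ a ∷ []) (α ∷ β ∷ γ ∷ δ ∷ [])
    roots₄⇒roots {α = α} {β} {γ} {δ} (roots₄ e₁ e₂ e₃ e₄) = Pointwise.trans ≈ℂ-trans
      (e₄ ∷ e₃ ∷ e₂ ∷ e₁ ∷ realℂ-cong (+-identityʳ 1#) ∷ []) (Pointwise.sym ≈ℂ-sym (fromRoots₄ α β γ δ))

    -- Iterated, this brings any one of the four roots to the front.
    rotate : ∀ {a b c d α β γ δ} → Roots₄ a b c d α β γ δ → Roots₄ a b c d β γ δ α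
    rotate {α = α} {β} {γ} {δ} (roots₄ e₁ e₂ e₃ e₄) = roots₄
      (≈ℂ-trans e₁ (S.solve 4 (λ α β γ δ → :- (α :+ β :+ γ :+ δ) := :- (β :+ γ :+ δ :+ α)) α β γ δ))
      (≈ℂ-trans e₂ (S.solve 4 (λ α β γ δ → α :* β :+ α :* γ :+ α :* δ :+ β :* γ :+ β :* δ :+ γ :* δ
        := β :* γ :+ β :* δ :+ β :* α :+ γ :* δ :+ γ :* α :+ δ :* α) α β γ δ))
      (≈ℂ-trans e₃ (S.solve 4 (λ α β γ δ → :- (α :* β :* γ :+ α :* β :* δ :+ α :* γ :* δ :+ β :* γ :* δ)
        := :- (β :* γ :* δ :+ β :* γ :* α :+ β :* δ :* α :+ γ :* δ :* α)) α β γ δ))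
      (≈ℂ-trans e₄ (S.solve 4 (λ α β γ δ → α :* β :* γ :* δ := β :* γ :* δ :* α) α β γ δ))

    eval₄ : ∀ {a b c d α β γ δ} → Roots₄ a b c d α β γ δ → ∀ x →
      ((x +ᶜ -ᶜ α) *ᶜ ((x +ᶜ -ᶜ β) *ᶜ ((x +ᶜ -ᶜ γ) *ᶜ (x +ᶜ -ᶜ δ)))) ≈ℂ
      (x *ᶜ x *ᶜ x *ᶜ x +ᶜ realℂ a *ᶜ (x *ᶜ x *ᶜ x) +ᶜ realℂ b *ᶜ (x *ᶜ x) +ᶜ realℂ c *ᶜ x +ᶜ realℂ d)
    eval₄ {a} {b} {c} {d} {α} {β} {γ} {δ} (roots₄ e₁ e₂ e₃ e₄) x = ≈ℂ-sym (≈ℂ-trans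
      (+ℂ-cong (+ℂ-cong (+ℂ-cong (+ℂ-cong ≈ℂ-refl (*ℂ-cong e₁ ≈ℂ-refl)) (*ℂ-cong e₂ ≈ℂ-refl))
          (*ℂ-cong e₃ ≈ℂ-refl)) e₄)
      (S.solve 5 (λ α β γ δ x → x :* x :* x :* x :+ (:- (α :+ β :+ γ :+ δ)) :* (x :* x :* x)
          :+ (α :* β :+ α :* γ :+ α :* δ :+ β :* γ :+ β :* δ :+ γ :* δ) :* (x :* x)
          :+ (:- (α :* β :* γ :+ α :* β :* δ :+ α :* γ :* δ :+ β :* γ :* δ)) :* x
          :+ α :* β :* γ :* δ
        := (x :- α) :* ((x :- β) :* ((x :- γ) :* (x :- δ)))) α β γ δ x))

-- Roots of maximal modulus, and polynomials with all roots on a circle.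

module MaximalRoots (em : ExcludedMiddle 0ℓ) (real : CompleteOrderedField) where
  open Classical em real hiding (zero)
  open Reals em real
  open Roots em real
  open Complex em real
  private
    module S = ℂSolver
    module Maximum = Max totalOrder

  abstract

    count-full : ∀ {A : Set} {P : Pred A 0ℓ} (P? : Decidable P) {n} (xs : Vec A n) →
      Vec.count P? xs ≡ n → All P xs
    count-full P? []       _  = []
    count-full P? (x ∷ xs) eq with P? x
    ... | yes Px = Px ∷ count-full P? xs (ℕₚ.suc-injective eq)
    ... | no  _  = ⊥-elim (ℕₚ.<⇒≢ (s≤s (Vecₚ.count≤n P? xs)) eq)

    full-count : ∀ {A : Set} {P : Pred A 0ℓ} (P? : Decidable P) {n} {xs : Vec A n} →
      All P xs → Vec.count P? xs ≡ n
    full-count P? []                      = ≡.refl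
    full-count P? {xs = x ∷ _} (Px ∷ Pxs) with P? x
    ... | yes _  = ≡.cong suc (full-count P? Pxs)
    ... | no ¬Px = ⊥-elim (¬Px Px)

    count-no : ∀ {A : Set} {P : Pred A 0ℓ} (P? : Decidable P) {n x} {xs : Vec A n} →
      ¬ P x → Vec.count P? (x ∷ xs) ≡ Vec.count P? xs
    count-no P? {x = x} ¬Px with P? x
    ... | yes Px = ⊥-elim (¬Px Px)
    ... | no  _  = ≡.refl

    -- The alternatives list the entries cyclically from the missing one, in the order that `rotate`
    -- produces.
    count-one-missing : ∀ {A : Set} {P : Pred A 0ℓ} (P? : Decidable P) {x y z t} →
      Vec.count P? (x ∷ y ∷ z ∷ t ∷ []) ≡ 3 →
      (¬ P x × P y × P z × P t) ⊎ (¬ P y × P z × P t × P x) ⊎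
      (¬ P z × P t × P x × P y) ⊎ (¬ P t × P x × P y × P z)
    count-one-missing P? {x} {y} {z} {t} eq with P? x | P? y | P? z | P? t | eq
    ... | no ¬x | yes y | yes z | yes t | _ = inj₁ (¬x , y , z , t)
    ... | yes x | no ¬y | yes z | yes t | _ = inj₂ (inj₁ (¬y , z , t , x))
    ... | yes x | yes y | no ¬z | yes t | _ = inj₂ (inj₂ (inj₁ (¬z , t , x , y)))
    ... | yes x | yes y | yes z | no ¬t | _ = inj₂ (inj₂ (inj₂ (¬t , x , y , z)))
    ... | yes _ | yes _ | yes _ | yes _ | ()
    ... | no _  | no _  | no _  | no _  | ()
    ... | no _  | no _  | no _  | yes _ | ()
    ... | no _  | no _  | yes _ | no _  | ()
    ... | no _  | no _  | yes _ | yes _ | ()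
    ... | no _  | yes _ | no _  | no _  | ()
    ... | no _  | yes _ | no _  | yes _ | ()
    ... | no _  | yes _ | yes _ | no _  | ()
    ... | yes _ | no _  | no _  | no _  | ()
    ... | yes _ | no _  | no _  | yes _ | ()
    ... | yes _ | no _  | yes _ | no _  | ()
    ... | yes _ | yes _ | no _  | no _  | ()

    modulus-nonNeg : ∀ z → 0# ≤ modulus z
    modulus-nonNeg z = √-nonNeg (norm-nonNeg z)

    modulus-square : ∀ z → modulus z * modulus z ≈ norm z
    modulus-square z = √-square (norm-nonNeg z)

    modulus-unique : ∀ {z r} → 0# ≤ r → norm z ≈ r * r → modulus z ≈ r
    modulus-unique 0≤r Nz≈r² = √-unique 0≤r (sym Nz≈r²)

    modulus≤max : ∀ {n} (αs : Vec ℂ n) → All (λ α → modulus α ≤ maxModulus αs) αs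
    modulus≤max []       = []
    modulus≤max (α ∷ αs) = Maximum.x≤x⊔y _ _ ∷ All.map (λ ≤max → ≤-trans ≤max (Maximum.x≤y⊔x _ _)) (modulus≤max αs)

    max≤ : ∀ {n r} {αs : Vec ℂ n} → 0# ≤ r → All (λ α → modulus α ≤ r) αs → maxModulus αs ≤ r
    max≤ 0≤r []               = 0≤r
    max≤ 0≤r (α≤r ∷ αs≤r) = Maximum.⊔-lub α≤r (max≤ 0≤r αs≤r)

    max-nonNeg : ∀ {n} (αs : Vec ℂ (suc n)) → 0# ≤ maxModulus αs
    max-nonNeg (α ∷ αs) = ≤-trans (modulus-nonNeg α) (All.head (modulus≤max (α ∷ αs)))

    all-maximal : ∀ {n} (αs : Vec ℂ n) → numMaximal αs ≡ n →
      All (λ α → norm α ≈ maxModulus αs * maxModulus αs) αs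
    all-maximal αs eq = All.map (λ {α} α≈max → trans (sym (modulus-square α)) (*-cong α≈max α≈max))
      (count-full (λ α → em {modulus α ≈ maxModulus αs}) αs eq)

    equal-norms-maximal : ∀ {n r} {αs : Vec ℂ (suc n)} → 0# ≤ r → All (λ α → norm α ≈ r * r) αs →
      numMaximal αs ≡ suc n
    equal-norms-maximal {r = r} {αs@(_ ∷ _)} 0≤r norms =
      full-count (λ α → em {modulus α ≈ maxModulus αs}) (All.map (λ mod≈ → trans mod≈ r≈max) moduli)
      where
      moduli : All (λ α → modulus α ≈ r) αs
      moduli = All.map (λ {α} Nα → modulus-unique {α} 0≤r Nα) norms
      r≈max : r ≈ maxModulus αs
      r≈max = antisym (≤-respˡ (All.head moduli) (All.head (modulus≤max αs)))
          (max≤ 0≤r (All.map ≤-reflexive moduli))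

    one-smaller-maximal : ∀ {n r s β} {αs : Vec ℂ (suc n)} → 0# ≤ s → s < r → norm β ≈ s * s →
      All (λ α → norm α ≈ r * r) αs → numMaximal (β ∷ αs) ≡ suc n
    one-smaller-maximal {r = r} {s} {β} {αs@(_ ∷ _)} 0≤s s<r Nβ norms = ≡.trans
      (count-no (λ α → em {modulus α ≈ maxModulus (β ∷ αs)}) {xs = αs}
        (λ β≈max → proj₂ s<r (trans (sym mod-β) (trans β≈max (sym r≈max)))))
      (full-count (λ α → em {modulus α ≈ maxModulus (β ∷ αs)}) (All.map (λ mod≈ → trans mod≈ r≈max) moduli))
      where
      0≤r : 0# ≤ r
      0≤r = ≤-trans 0≤s (<⇒≤ s<r)
      mod-β : modulus β ≈ s
      mod-β = modulus-unique {β} 0≤s Nβ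
      moduli : All (λ α → modulus α ≈ r) αs
      moduli = All.map (λ {α} Nα → modulus-unique {α} 0≤r Nα) norms
      r≈max : r ≈ maxModulus (β ∷ αs)
      r≈max = antisym (≤-respˡ (All.head moduli) (All.head (All.tail (modulus≤max (β ∷ αs)))))
        (max≤ 0≤r (≤-respˡ (sym mod-β) (<⇒≤ s<r) ∷ All.map ≤-reflexive moduli))

    non-maximal : ∀ {n α} {αs : Vec ℂ (suc n)} → modulus α ≤ maxModulus αs → ¬ (modulus α ≈ maxModulus αs) →
      norm α < maxModulus αs * maxModulus αs
    non-maximal {α = α} {αs} α≤max α≉max =
      ≤-respˡ (modulus-square α) (square-mono-≤ (modulus-nonNeg α) α≤max) ,
      λ Nα≈max² → α≉max (modulus-unique {α} (max-nonNeg αs) Nα≈max²)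

  -- Quartics with exactly three roots of maximal modulus √R.
  record OneSmaller (a b c d : ℝ) : Set where
    field
      R       : ℝ
      β α γ δ : ℂ
      roots   : Roots₄ a b c d β α γ δ
      Nβ<R    : norm β < R
      Nα≈R    : norm α ≈ R
      Nγ≈R    : norm γ ≈ R
      Nδ≈R    : norm δ ≈ R

  abstract

    one-smaller : ∀ {a b c d α β γ δ} → Roots₄ a b c d α β γ δ → numMaximal (α ∷ β ∷ γ ∷ δ ∷ []) ≡ 3 →
      OneSmaller a b c d
    one-smaller {a} {b} {c} {d} {α} {β} {γ} {δ} roots eq = build (modulus≤max (α ∷ β ∷ γ ∷ δ ∷ []))
      (count-one-missing (λ z → em {modulus z ≈ M}) eq)
      where
      M : ℝ
      M = maxModulus (α ∷ β ∷ γ ∷ δ ∷ [])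
      make : ∀ {x y z t} → Roots₄ a b c d x y z t → modulus x ≤ M →
        ¬ modulus x ≈ M × modulus y ≈ M × modulus z ≈ M × modulus t ≈ M → OneSmaller a b c d
      make {x} {y} {z} {t} roots x≤M (x≉M , y≈M , z≈M , t≈M) = record
        { R = M * M ; β = x ; α = y ; γ = z ; δ = t ; roots = roots
        ; Nβ<R = non-maximal {αs = α ∷ β ∷ γ ∷ δ ∷ []} x≤M x≉M
        ; Nα≈R = N y≈M ; Nγ≈R = N z≈M ; Nδ≈R = N t≈M }
        where
        N : ∀ {z} → modulus z ≈ M → norm z ≈ M * M
        N {z} z≈M = trans (sym (modulus-square z)) (*-cong z≈M z≈M)
      build : All (λ z → modulus z ≤ M) (α ∷ β ∷ γ ∷ δ ∷ []) →
        (¬ modulus α ≈ M × modulus β ≈ M × modulus γ ≈ M × modulus δ ≈ M) ⊎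
        (¬ modulus β ≈ M × modulus γ ≈ M × modulus δ ≈ M × modulus α ≈ M) ⊎
        (¬ modulus γ ≈ M × modulus δ ≈ M × modulus α ≈ M × modulus β ≈ M) ⊎
        (¬ modulus δ ≈ M × modulus α ≈ M × modulus β ≈ M × modulus γ ≈ M) → OneSmaller a b c d
      build (α≤ ∷ _) (inj₁ ms)                                    = make roots α≤ ms
      build (_ ∷ β≤ ∷ _) (inj₂ (inj₁ ms))                         = make (rotate roots) β≤ ms
      build (_ ∷ _ ∷ γ≤ ∷ _) (inj₂ (inj₂ (inj₁ ms)))              = make (rotate (rotate roots)) γ≤ ms
      build (_ ∷ _ ∷ _ ∷ δ≤ ∷ _) (inj₂ (inj₂ (inj₂ ms)))          = make (rotate (rotate (rotate roots))) δ≤ ms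

  -- Bounds on sums

  Within : ℝ → ℝ → Set
  Within s x = (- s ≤ x) × (x ≤ s)

  abstract

    square≤⇒within : ∀ {s x} → 0# ≤ s → x * x ≤ s * s → Within s x
    square≤⇒within {s} {x} 0≤s x²≤s² =
      ≤-slack (≤⇒0≤- (square-cancel-≤ 0≤s (≤-respˡ (solve 1 (λ x → x :* x := (:- x) :* (:- x)) x) x²≤s²)))
        (solve 2 (λ s x → x :- (:- s) := s :- (:- x)) s x) ,
      square-cancel-≤ 0≤s x²≤s²

    within⇒square≤ : ∀ {s x} → Within s x → x * x ≤ s * s
    within⇒square≤ {s} {x} (-s≤x , x≤s) = ≤-slack (*-nonNeg (≤⇒0≤- -s≤x) (≤⇒0≤- x≤s))
      (solve 2 (λ s x → s :* s :- x :* x := (x :- (:- s)) :* (s :- x)) s x)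

    within-+ : ∀ {s t x y} → Within s x → Within t y → Within (s + t) (x + y)
    within-+ {s} {t} (l , u) (l′ , u′) =
      ≤-respˡ (solve 2 (λ s t → (:- s) :+ (:- t) := :- (s :+ t)) s t) (+-mono-≤ l l′) , +-mono-≤ u u′

    within-resp : ∀ {s t x y} → s ≈ t → x ≈ y → Within s x → Within t y
    within-resp s≈t x≈y (l , u) = ≤-resp (-‿cong s≈t) x≈y l , ≤-resp x≈y s≈t u

    within-neg : ∀ {s x} → Within s x → Within s (- x)
    within-neg {s} {x} (l , u) = ≤-slack (≤⇒0≤- u) (solve 2 (λ s x → (:- x) :- (:- s) := s :- x) s x) ,
      ≤-slack (≤⇒0≤- l) (solve 2 (λ s x → s :- (:- x) := x :- (:- s)) s x)

    -- A real coefficient is, up to sign, the sum of the real parts of products of roots, so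
    -- bounding real parts by moduli replaces the triangle inequality in ℂ.
    within-re : ∀ {s z} → 0# ≤ s → norm z ≈ s * s → Within s (re z)
    within-re {s} {z} 0≤s Nz = square≤⇒within 0≤s (≤-respʳ Nz
      (≤-slack (square-nonNeg (im z)) (solve 2 (λ a b → a :* a :+ b :* b :- a :* a := b :* b) (re z) (im z))))

    norm-product : ∀ {z w s t} → norm z ≈ s * s → norm w ≈ t * t → norm (z *ᶜ w) ≈ (s * t) * (s * t)
    norm-product {z} {w} {s} {t} Nz Nw = trans (norm-* z w) (trans (*-cong Nz Nw)
      (solve 2 (λ s t → (s :* s) :* (t :* t) := (s :* t) :* (s :* t)) s t))

    swap-conj : ∀ {z R} → norm z ≈ R → (z *ᶜ conj z) ≈ℂ realℂ R
    swap-conj {z} Nz = ≈ℂ-trans (*-conj z) (realℂ-cong Nz)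

    conj-real : ∀ {x z} → realℂ x ≈ℂ z → realℂ x ≈ℂ conj z
    conj-real {x} x≈z = ≈ℂ-trans (≈ℂ-sym (conj-realℂ x)) (conj-cong x≈z)

    conj-neg-sum₃ : ∀ α β γ → conj (-ᶜ (α +ᶜ β +ᶜ γ)) ≈ℂ (-ᶜ (conj α +ᶜ conj β +ᶜ conj γ))
    conj-neg-sum₃ α β γ = refl ,
      solve 3 (λ a b c → :- (:- (a :+ b :+ c)) := :- ((:- a) :+ (:- b) :+ (:- c))) (im α) (im β) (im γ)

    conj-neg-sum₄ : ∀ α β γ δ → conj (-ᶜ (α +ᶜ β +ᶜ γ +ᶜ δ)) ≈ℂ (-ᶜ (conj α +ᶜ conj β +ᶜ conj γ +ᶜ conj δ))
    conj-neg-sum₄ α β γ δ = refl ,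
      solve 4 (λ a b c d → :- (:- (a :+ b :+ c :+ d)) := :- ((:- a) :+ (:- b) :+ (:- c) :+ (:- d))) (im α) (im β)
          (im γ) (im δ)

    -- On the circle |z|² = R conjugation is z ↦ R/z, so that e₃ ē₁ = R e₂.
    module _ {u v w R : ℝ} {α β γ : ℂ} (roots : Roots₃ u v w α β γ)
      (Nα : norm α ≈ R) (Nβ : norm β ≈ R) (Nγ : norm γ ≈ R) where
      open Roots₃ roots

      cubic-duality : w * u ≈ R * v
      cubic-duality = proj₁ (begin
        realℂ (w * u)                                        ≈⟨ realℂ-* w u ⟩
        realℂ w *ᶜ realℂ u                                   ≈⟨ *ℂ-cong e₃
            (≈ℂ-trans (conj-real e₁) (conj-neg-sum₃ α β γ)) ⟩
        -ᶜ (α *ᶜ β *ᶜ γ) *ᶜ -ᶜ (conj α +ᶜ conj β +ᶜ conj γ)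
          ≈⟨ S.solve 6 (λ a b c a′ b′ c′ → :- (a :* b :* c) :* (:- (a′ :+ b′ :+ c′))
               := (a :* a′) :* (b :* c) :+ (b :* b′) :* (a :* c) :+ (c :* c′) :* (a :* b)) α β γ (conj α)
                   (conj β) (conj γ) ⟩
        (α *ᶜ conj α) *ᶜ (β *ᶜ γ) +ᶜ (β *ᶜ conj β) *ᶜ (α *ᶜ γ) +ᶜ (γ *ᶜ conj γ) *ᶜ (α *ᶜ β)
          ≈⟨ +ℂ-cong (+ℂ-cong (*ℂ-cong (swap-conj Nα) ≈ℂ-refl) (*ℂ-cong (swap-conj Nβ) ≈ℂ-refl))
              (*ℂ-cong (swap-conj Nγ) ≈ℂ-refl) ⟩
        realℂ R *ᶜ (β *ᶜ γ) +ᶜ realℂ R *ᶜ (α *ᶜ γ) +ᶜ realℂ R *ᶜ (α *ᶜ β)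
          ≈⟨ S.solve 4 (λ r a b c → r :* (b :* c) :+ r :* (a :* c) :+ r :* (a :* b)
              := r :* (a :* b :+ a :* c :+ b :* c)) (realℂ R) α β γ ⟩
        realℂ R *ᶜ (α *ᶜ β +ᶜ α *ᶜ γ +ᶜ β *ᶜ γ)               ≈⟨ *ℂ-cong ≈ℂ-refl e₂ ⟨
        realℂ R *ᶜ realℂ v                                   ≈⟨ realℂ-* R v ⟨
        realℂ (R * v)                                        ∎)
        where open ≈ℂ-Reasoning

      cubic-constant : w * w ≈ R * R * R
      cubic-constant = begin
        w * w                          ≈⟨ norm-realℂ w ⟨
        norm (realℂ w)                 ≈⟨ norm-cong e₃ ⟩
        norm (-ᶜ (α *ᶜ β *ᶜ γ))         ≈⟨ norm-neg (α *ᶜ β *ᶜ γ) ⟩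
        norm (α *ᶜ β *ᶜ γ)              ≈⟨ norm-* (α *ᶜ β) γ ⟩
        norm (α *ᶜ β) * norm γ         ≈⟨ *-cong (norm-* α β) Nγ ⟩
        norm α * norm β * R            ≈⟨ *-congʳ (*-cong Nα Nβ) ⟩
        R * R * R                      ∎
        where open ≈-Reasoning

      -- The symmetric sums have three terms each, of moduli s and s² with s² = R. Squaring
      -- expresses the bounds through R alone.
      cubic-bounds : (u * u ≤ fromℕ 9 * R) × (v * v ≤ fromℕ 9 * (R * R))
      cubic-bounds with s , 0≤s , s²≈R ← square-root (≤-respʳ Nα (norm-nonNeg α)) =
        let Sα = trans Nα (sym s²≈R); Sβ = trans Nβ (sym s²≈R); Sγ = trans Nγ (sym s²≈R)
            0≤s² = *-nonNeg 0≤s 0≤s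
        in
        ≤-respʳ (combine₁ (fromℕ 9) s²≈R
            (solve 2 (λ s R → (s :+ s :+ s) :* (s :+ s :+ s) :- con 9 :* R := con 9 :* (s :* s :- R)) s R))
          (within⇒square≤ (within-resp refl (sym (proj₁ e₁)) (within-neg
            (within-+ (within-+ (within-re 0≤s Sα) (within-re 0≤s Sβ)) (within-re 0≤s Sγ))))) ,
        ≤-respʳ (combine₁ (fromℕ 9 * (s * s + R)) s²≈R
            (solve 2 (λ s R → (s :* s :+ s :* s :+ s :* s) :* (s :* s :+ s :* s :+ s :* s) :- con 9 :* (R :* R)
            := con 9 :* (s :* s :+ R) :* (s :* s :- R)) s R))
          (within⇒square≤ (within-resp refl (sym (proj₁ e₂))
            (within-+ (within-+ (within-re 0≤s² (norm-product Sα Sβ)) (within-re 0≤s² (norm-product Sα Sγ)))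
                (within-re 0≤s² (norm-product Sβ Sγ)))))

    module _ {a b c d R : ℝ} {α β γ δ : ℂ} (roots : Roots₄ a b c d α β γ δ)
      (Nα : norm α ≈ R) (Nβ : norm β ≈ R) (Nγ : norm γ ≈ R) (Nδ : norm δ ≈ R) where
      open Roots₄ roots

      -- As for cubics, conjugation z ↦ R/z turns e₄ ē₁ into R e₃.
      quartic-duality : d * a ≈ R * c
      quartic-duality = proj₁ (begin
        realℂ (d * a)                                        ≈⟨ realℂ-* d a ⟩
        realℂ d *ᶜ realℂ a                                   ≈⟨ *ℂ-cong e₄
            (≈ℂ-trans (conj-real e₁) (conj-neg-sum₄ α β γ δ)) ⟩
        α *ᶜ β *ᶜ γ *ᶜ δ *ᶜ -ᶜ (conj α +ᶜ conj β +ᶜ conj γ +ᶜ conj δ)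
          ≈⟨ S.solve 8 (λ a b c d a′ b′ c′ d′ → (a :* b :* c :* d) :* (:- (a′ :+ b′ :+ c′ :+ d′))
               := :- ((a :* a′) :* (b :* c :* d) :+ (b :* b′) :* (a :* c :* d) :+ (c :* c′) :* (a :* b :* d)
                   :+ (d :* d′) :* (a :* b :* c)))
               α β γ δ (conj α) (conj β) (conj γ) (conj δ) ⟩
        -ᶜ ((α *ᶜ conj α) *ᶜ (β *ᶜ γ *ᶜ δ) +ᶜ (β *ᶜ conj β) *ᶜ (α *ᶜ γ *ᶜ δ) +ᶜ (γ *ᶜ conj γ) *ᶜ (α *ᶜ β *ᶜ δ) +ᶜ
            (δ *ᶜ conj δ) *ᶜ (α *ᶜ β *ᶜ γ))
          ≈⟨ -ℂ-cong (+ℂ-cong (+ℂ-cong (+ℂ-cong (*ℂ-cong (swap-conj Nα) ≈ℂ-refl) (*ℂ-cong (swap-conj Nβ) ≈ℂ-refl))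
              (*ℂ-cong (swap-conj Nγ) ≈ℂ-refl)) (*ℂ-cong (swap-conj Nδ) ≈ℂ-refl)) ⟩
        -ᶜ (realℂ R *ᶜ (β *ᶜ γ *ᶜ δ) +ᶜ realℂ R *ᶜ (α *ᶜ γ *ᶜ δ) +ᶜ realℂ R *ᶜ (α *ᶜ β *ᶜ δ) +ᶜ realℂ R *ᶜ
            (α *ᶜ β *ᶜ γ))
          ≈⟨ S.solve 5 (λ r a b c d → :- (r :* (b :* c :* d) :+ r :* (a :* c :* d) :+ r :* (a :* b :* d)
              :+ r :* (a :* b :* c))
               := r :* (:- (a :* b :* c :+ a :* b :* d :+ a :* c :* d :+ b :* c :* d))) (realℂ R) α β γ δ ⟩
        realℂ R *ᶜ -ᶜ (α *ᶜ β *ᶜ γ +ᶜ α *ᶜ β *ᶜ δ +ᶜ α *ᶜ γ *ᶜ δ +ᶜ β *ᶜ γ *ᶜ δ)               ≈⟨ *ℂ-cong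
            ≈ℂ-refl e₃ ⟨
        realℂ R *ᶜ realℂ c                                   ≈⟨ realℂ-* R c ⟨
        realℂ (R * c)                                        ∎)
        where open ≈ℂ-Reasoning

      quartic-constant : d * d ≈ R * R * R * R
      quartic-constant = begin
        d * d                                    ≈⟨ norm-realℂ d ⟨
        norm (realℂ d)                           ≈⟨ norm-cong e₄ ⟩
        norm (α *ᶜ β *ᶜ γ *ᶜ δ)                   ≈⟨ norm-* (α *ᶜ β *ᶜ γ) δ ⟩
        norm (α *ᶜ β *ᶜ γ) * norm δ              ≈⟨ *-cong (norm-* (α *ᶜ β) γ) Nδ ⟩
        norm (α *ᶜ β) * norm γ * R               ≈⟨ *-congʳ (*-cong (norm-* α β) Nγ) ⟩
        norm α * norm β * R * R                  ≈⟨ *-congʳ (*-congʳ (*-cong Nα Nβ)) ⟩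
        R * R * R * R                            ∎
        where open ≈-Reasoning

      -- The symmetric sums have 4, 6 and 4 terms, of moduli s, s² and s³ with s² = R.
      quartic-bounds : (a * a ≤ fromℕ 16 * R) × (b * b ≤ fromℕ 36 * (R * R)) × (c * c ≤ fromℕ 16 * (R * R * R))
      quartic-bounds with s , 0≤s , s²≈R ← square-root (≤-respʳ Nα (norm-nonNeg α)) =
        let Sα = trans Nα (sym s²≈R); Sβ = trans Nβ (sym s²≈R); Sγ = trans Nγ (sym s²≈R); Sδ = trans Nδ (sym s²≈R)
            0≤s² = *-nonNeg 0≤s 0≤s
            0≤s³ = *-nonNeg 0≤s² 0≤s
            pair = λ {z} {w} (Nz : norm z ≈ s * s) (Nw : norm w ≈ s * s) → within-re 0≤s²
                (norm-product {z} {w} Nz Nw)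
            triple = λ {x} {z} {w} (Nx : norm x ≈ s * s) (Nz : norm z ≈ s * s) (Nw : norm w ≈ s * s) →
              within-re 0≤s³ (norm-product {x *ᶜ z} {w} (norm-product {x} {z} Nx Nz) Nw)
        in
        ≤-respʳ (combine₁ (fromℕ 16) s²≈R
            (solve 2 (λ s R → (s :+ s :+ s :+ s) :* (s :+ s :+ s :+ s) :- con 16 :* R
                := con 16 :* (s :* s :- R)) s R))
          (within⇒square≤ (within-resp refl (sym (proj₁ e₁)) (within-neg
            (within-+ (within-+ (within-+ (within-re 0≤s Sα) (within-re 0≤s Sβ)) (within-re 0≤s Sγ))
                (within-re 0≤s Sδ))))) ,
        ≤-respʳ (combine₁ (fromℕ 36 * (s * s + R)) s²≈R (solve 2 (λ s R → let t = s :* s; σ = t :+ t :+ t :+ t :+ t :+ t in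
            σ :* σ :- con 36 :* (R :* R) := con 36 :* (s :* s :+ R) :* (s :* s :- R)) s R))
          (within⇒square≤ (within-resp refl (sym (proj₁ e₂))
            (within-+ (within-+ (within-+ (within-+ (within-+ (pair Sα Sβ) (pair Sα Sγ)) (pair Sα Sδ)) (pair Sβ Sγ))
                (pair Sβ Sδ)) (pair Sγ Sδ)))) ,
        ≤-respʳ (combine₁ (fromℕ 16 * (s * s * (s * s) + s * s * R + R * R)) s²≈R (solve 2 (λ s R → let t = s :* s :* s; σ = t :+ t :+ t :+ t in
            σ :* σ :- con 16 :* (R :* R :* R)
                := con 16 :* (s :* s :* (s :* s) :+ s :* s :* R :+ R :* R) :* (s :* s :- R)) s R))
          (within⇒square≤ (within-resp refl (sym (proj₁ e₃)) (within-neg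
            (within-+ (within-+ (within-+ (triple Sα Sβ Sγ) (triple Sα Sβ Sδ)) (triple Sα Sγ Sδ))
                (triple Sβ Sγ Sδ)))))

-- The real root of smaller modulus, and integrality of rational roots.

module Rationality (em : ExcludedMiddle 0ℓ) (real : CompleteOrderedField) where
  open Classical em real hiding (zero)
  open Reals em real
  open Complex em real
  open MaximalRoots em real
  private module S = ℂSolver

  IsRoot : (a b c d x : ℝ) → Set
  IsRoot a b c d x = x * x * x * x + a * (x * x * x) + b * (x * x) + c * x + d ≈ 0#

  -- The quartic is (x - t)(x³ + ux² + vx + w), where the cubic has all its roots on the circle |z|² = R.
  record Split (a b c d : ℝ) : Set where
    field
      t R u v w  : ℝ
      -- Synthetic division by x - t; the field `constant` says that the remainder vanishes.
      u≈         : u ≈ a + t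
      v≈         : v ≈ b + t * u
      w≈         : w ≈ c + t * v
      t²<R       : t * t < R
      constant   : d ≈ - (t * w)
      duality    : w * u ≈ R * v
      w²≈R³      : w * w ≈ R * R * R
      u²≤9R      : u * u ≤ fromℕ 9 * R
      v²≤9R²     : v * v ≤ fromℕ 9 * (R * R)
      real-root  : ∀ {y} → IsRoot a b c d y → y ≈ t ⊎ y * y ≈ R

  abstract

    eval-real : ∀ {a b c d x} → (realℂ x *ᶜ realℂ x *ᶜ realℂ x *ᶜ realℂ x +ᶜ realℂ a *ᶜ
        (realℂ x *ᶜ realℂ x *ᶜ realℂ x)
      +ᶜ realℂ b *ᶜ (realℂ x *ᶜ realℂ x) +ᶜ realℂ c *ᶜ realℂ x +ᶜ realℂ d)
      ≈ℂ realℂ (x * x * x * x + a * (x * x * x) + b * (x * x) + c * x + d)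
    eval-real {a} {b} {c} {d} {x} =
      +-congʳ (+-cong (+-cong (+-cong (proj₁ x⁴) (proj₁ (scaled a x³))) (proj₁ (scaled b x²)))
          (proj₁ (scaled c ≈ℂ-refl))) ,
      trans (+-congʳ (+-cong (+-cong (+-cong (proj₂ x⁴) (proj₂ (scaled a x³))) (proj₂ (scaled b x²)))
          (proj₂ (scaled c ≈ℂ-refl))))
        (solve 0 (con 0 :+ con 0 :+ con 0 :+ con 0 :+ con 0 := con 0))
      where
      scaled : ∀ y {z z′} → z ≈ℂ realℂ z′ → (realℂ y *ᶜ z) ≈ℂ realℂ (y * z′)
      scaled y {z} {z′} z≈ = ≈ℂ-trans (*ℂ-cong ≈ℂ-refl z≈) (≈ℂ-sym (realℂ-* y z′))
      times : ∀ {z z′} → z ≈ℂ realℂ z′ → (z *ᶜ realℂ x) ≈ℂ realℂ (z′ * x)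
      times {z} {z′} z≈ = ≈ℂ-trans (*ℂ-cong z≈ ≈ℂ-refl) (≈ℂ-sym (realℂ-* z′ x))
      x² : (realℂ x *ᶜ realℂ x) ≈ℂ realℂ (x * x)
      x² = times ≈ℂ-refl
      x³ : (realℂ x *ᶜ realℂ x *ᶜ realℂ x) ≈ℂ realℂ (x * x * x)
      x³ = times x²
      x⁴ : (realℂ x *ᶜ realℂ x *ᶜ realℂ x *ᶜ realℂ x) ≈ℂ realℂ (x * x * x * x)
      x⁴ = times x³

    difference-zero : ∀ {z w} → (z +ᶜ -ᶜ w) ≈ℂ realℂ 0# → z ≈ℂ w
    difference-zero {z} {w} z-w≈0 = S.combine₁ (realℂ 1#) z-w≈0
      (S.solve 2 (λ z w → z :- w := con 1 :* (z :- w :- con 0)) z w)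

    root-cases : ∀ {x α β γ δ} →
      ((x +ᶜ -ᶜ α) *ᶜ ((x +ᶜ -ᶜ β) *ᶜ ((x +ᶜ -ᶜ γ) *ᶜ (x +ᶜ -ᶜ δ)))) ≈ℂ realℂ 0# →
      x ≈ℂ α ⊎ x ≈ℂ β ⊎ x ≈ℂ γ ⊎ x ≈ℂ δ
    root-cases {x} {α} {β} {γ} {δ} eq with ℂ-zero-product {x +ᶜ -ᶜ α} eq
    ... | inj₁ x≈α = inj₁ (difference-zero x≈α)
    ... | inj₂ eq with ℂ-zero-product {x +ᶜ -ᶜ β} eq
    ...   | inj₁ x≈β = inj₂ (inj₁ (difference-zero x≈β))
    ...   | inj₂ eq with ℂ-zero-product {x +ᶜ -ᶜ γ} eq
    ...     | inj₁ x≈γ = inj₂ (inj₂ (inj₁ (difference-zero x≈γ)))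
    ...     | inj₂ x≈δ = inj₂ (inj₂ (inj₂ (difference-zero x≈δ)))

    conj-eval : ∀ {a b c d} x →
      (conj x *ᶜ conj x *ᶜ conj x *ᶜ conj x +ᶜ realℂ a *ᶜ (conj x *ᶜ conj x *ᶜ conj x) +ᶜ realℂ b *ᶜ
          (conj x *ᶜ conj x) +ᶜ realℂ c *ᶜ conj x +ᶜ realℂ d)
      ≈ℂ conj (x *ᶜ x *ᶜ x *ᶜ x +ᶜ realℂ a *ᶜ (x *ᶜ x *ᶜ x) +ᶜ realℂ b *ᶜ (x *ᶜ x) +ᶜ realℂ c *ᶜ x +ᶜ realℂ d)
    conj-eval {a} {b} {c} {d} x = ≈ℂ-sym
        (sum (sum (sum (sum x⁴ (scaled a x³)) (scaled b x²)) (scaled c ≈ℂ-refl)) (conj-realℂ d))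
      where
      sum : ∀ {z w z′ w′} → conj z ≈ℂ z′ → conj w ≈ℂ w′ → conj (z +ᶜ w) ≈ℂ (z′ +ᶜ w′)
      sum {z} {w} z≈ w≈ = ≈ℂ-trans (conj-+ z w) (+ℂ-cong z≈ w≈)
      product : ∀ {z w z′ w′} → conj z ≈ℂ z′ → conj w ≈ℂ w′ → conj (z *ᶜ w) ≈ℂ (z′ *ᶜ w′)
      product {z} {w} z≈ w≈ = ≈ℂ-trans (conj-* z w) (*ℂ-cong z≈ w≈)
      scaled : ∀ y {w w′} → conj w ≈ℂ w′ → conj (realℂ y *ᶜ w) ≈ℂ (realℂ y *ᶜ w′)
      scaled y = product (conj-realℂ y)
      x² : conj (x *ᶜ x) ≈ℂ (conj x *ᶜ conj x)
      x² = product {x} {x} ≈ℂ-refl ≈ℂ-refl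
      x³ : conj (x *ᶜ x *ᶜ x) ≈ℂ (conj x *ᶜ conj x *ᶜ conj x)
      x³ = product {x *ᶜ x} {x} x² ≈ℂ-refl
      x⁴ : conj (x *ᶜ x *ᶜ x *ᶜ x) ≈ℂ (conj x *ᶜ conj x *ᶜ conj x *ᶜ conj x)
      x⁴ = product {x *ᶜ x *ᶜ x} {x} x³ ≈ℂ-refl

    -- The conjugate of the root of smaller modulus is a root of the same modulus, hence the same root.
    smaller-root-real : ∀ {a b c d} (f : OneSmaller a b c d) → OneSmaller.β f ≈ℂ realℂ (re (OneSmaller.β f))
    smaller-root-real {a} {b} {c} {d} f = byCases (root-cases {conj β} {β} {α} {γ} {δ}
        (≈ℂ-trans (eval₄ roots (conj β)) (≈ℂ-trans (conj-eval β) (≈ℂ-trans (conj-cong f[β]≈0) (conj-realℂ 0#)))))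
      where
      open OneSmaller f
      f[β]≈0 : (β *ᶜ β *ᶜ β *ᶜ β +ᶜ realℂ a *ᶜ (β *ᶜ β *ᶜ β) +ᶜ realℂ b *ᶜ (β *ᶜ β) +ᶜ realℂ c *ᶜ β +ᶜ realℂ d)
          ≈ℂ realℂ 0#
      f[β]≈0 = ≈ℂ-trans (≈ℂ-sym (eval₄ roots β))
        (S.solve 4 (λ β α γ δ → (β :- β) :* ((β :- α) :* ((β :- γ) :* (β :- δ))) := con 0) β α γ δ)
      absurd : ∀ {z} → norm z ≈ R → ¬ (conj β ≈ℂ z)
      absurd {z} Nz conjβ≈z = proj₂ Nβ<R (trans (sym (norm-conj β)) (trans (norm-cong conjβ≈z) Nz))
      byCases : conj β ≈ℂ β ⊎ conj β ≈ℂ α ⊎ conj β ≈ℂ γ ⊎ conj β ≈ℂ δ → β ≈ℂ realℂ (re β)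
      byCases (inj₁ (_ , -im≈im)) = refl , *-cancelˡ-0 {fromℕ 2} (>⇒≉0 (fromℕ-pos {2} (s≤s z≤n)))
        (combine₁ (- 1#) -im≈im (solve 1 (λ y → con 2 :* y :- con 0 := :- con 1 :* ((:- y) :- y)) (im β)))
      byCases (inj₂ (inj₁ eq))        = ⊥-elim (absurd {α} Nα≈R eq)
      byCases (inj₂ (inj₂ (inj₁ eq))) = ⊥-elim (absurd {γ} Nγ≈R eq)
      byCases (inj₂ (inj₂ (inj₂ eq))) = ⊥-elim (absurd {δ} Nδ≈R eq)

  module _ {a b c d} (f : OneSmaller a b c d) where
    open OneSmaller f
    private
      t u v w : ℝ
      t = re β
      u = a + t
      v = b + t * u
      w = c + t * v
      T U V W : ℂ
      T = realℂ t
      U = realℂ u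
      V = realℂ v
      W = realℂ w

    abstract
      private
        β≈T : β ≈ℂ T
        β≈T = smaller-root-real f

        U≈ : U ≈ℂ (-ᶜ (α +ᶜ γ +ᶜ δ))
        U≈ = ≈ℂ-trans (realℂ-+ a t) (≈ℂ-trans (+ℂ-cong (Roots₄.e₁ roots) (≈ℂ-sym β≈T))
          (S.solve 4 (λ β α γ δ → :- (β :+ α :+ γ :+ δ) :+ β := :- (α :+ γ :+ δ)) β α γ δ))

        V≈ : V ≈ℂ (α *ᶜ γ +ᶜ α *ᶜ δ +ᶜ γ *ᶜ δ)
        V≈ = ≈ℂ-trans (realℂ-+ b (t * u)) (≈ℂ-trans (+ℂ-cong (Roots₄.e₂ roots)
            (≈ℂ-trans (realℂ-* t u) (*ℂ-cong (≈ℂ-sym β≈T) U≈)))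
          (S.solve 4 (λ β α γ δ → β :* α :+ β :* γ :+ β :* δ :+ α :* γ :+ α :* δ :+ γ :* δ
              :+ β :* (:- (α :+ γ :+ δ))
            := α :* γ :+ α :* δ :+ γ :* δ) β α γ δ))

        W≈ : W ≈ℂ (-ᶜ (α *ᶜ γ *ᶜ δ))
        W≈ = ≈ℂ-trans (realℂ-+ c (t * v)) (≈ℂ-trans (+ℂ-cong (Roots₄.e₃ roots)
            (≈ℂ-trans (realℂ-* t v) (*ℂ-cong (≈ℂ-sym β≈T) V≈)))
          (S.solve 4 (λ β α γ δ → :- (β :* α :* γ :+ β :* α :* δ :+ β :* γ :* δ :+ α :* γ :* δ)
              :+ β :* (α :* γ :+ α :* δ :+ γ :* δ)
            := :- (α :* γ :* δ)) β α γ δ))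

        cubic : Roots₃ u v w α γ δ
        cubic = roots₃ U≈ V≈ W≈

        t²≈Nβ : norm β ≈ t * t
        t²≈Nβ = trans (norm-cong β≈T) (norm-realℂ t)

        constant′ : d ≈ - (t * w)
        constant′ = proj₁ (≈ℂ-trans (Roots₄.e₄ roots) (≈ℂ-trans
          (S.solve 4 (λ β α γ δ → β :* α :* γ :* δ := :- (β :* (:- (α :* γ :* δ)))) β α γ δ)
          (≈ℂ-trans (-ℂ-cong (≈ℂ-trans (*ℂ-cong β≈T (≈ℂ-sym W≈)) (≈ℂ-sym (realℂ-* t w))))
              (≈ℂ-sym (realℂ-neg (t * w))))))

        real-root′ : ∀ {y} → IsRoot a b c d y → y ≈ t ⊎ y * y ≈ R
        real-root′ {y} root = byCases (root-cases {realℂ y} {β} {α} {γ} {δ}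
            (≈ℂ-trans (eval₄ roots (realℂ y)) (≈ℂ-trans eval-real (realℂ-cong root))))
          where
          on-circle : ∀ {z} → norm z ≈ R → realℂ y ≈ℂ z → y ≈ t ⊎ y * y ≈ R
          on-circle Nz y≈z = inj₂ (trans (sym (norm-realℂ y)) (trans (norm-cong y≈z) Nz))
          byCases : realℂ y ≈ℂ β ⊎ realℂ y ≈ℂ α ⊎ realℂ y ≈ℂ γ ⊎ realℂ y ≈ℂ δ → y ≈ t ⊎ y * y ≈ R
          byCases (inj₁ eq)               = inj₁ (proj₁ eq)
          byCases (inj₂ (inj₁ eq))        = on-circle {α} Nα≈R eq
          byCases (inj₂ (inj₂ (inj₁ eq))) = on-circle {γ} Nγ≈R eq
          byCases (inj₂ (inj₂ (inj₂ eq))) = on-circle {δ} Nδ≈R eq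

      split : Split a b c d
      split = record
        { t = t ; R = R ; u = u ; v = v ; w = w ; u≈ = refl ; v≈ = refl ; w≈ = refl ; t²<R = <-respˡ t²≈Nβ Nβ<R ;
            constant = constant′
        ; duality = cubic-duality cubic Nα≈R Nγ≈R Nδ≈R
        ; w²≈R³ = cubic-constant cubic Nα≈R Nγ≈R Nδ≈R
        ; u²≤9R = proj₁ (cubic-bounds cubic Nα≈R Nγ≈R Nδ≈R)
        ; v²≤9R² = proj₂ (cubic-bounds cubic Nα≈R Nγ≈R Nδ≈R)
        ; real-root = real-root′ }

  -- Rational numbers

  Rational : ℝ → Set
  Rational x = ∃₂ λ n p → fromℕ (suc n) * x ≈ fromℤ p

  abstract

    rational-cong : ∀ {x y} → x ≈ y → Rational x → Rational y
    rational-cong x≈y (n , p , eq) = n , p , trans (*-congˡ (sym x≈y)) eq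

    rational-ℤ : ∀ i → Rational (fromℤ i)
    rational-ℤ i = 0 , i , solve 1 (λ x → (con 1 :+ con 0) :* x := x) (fromℤ i)

    rational-1 : Rational 1#
    rational-1 = rational-cong (+-identityʳ 1#) (rational-ℤ (+ 1))

    rational-neg : ∀ {x} → Rational x → Rational (- x)
    rational-neg {x} (n , p , eq) = n , ℤ.- p , trans
      (combine₁ (- 1#) eq (solve 3 (λ n x p → n :* (:- x) :- (:- p) := :- con 1 :* (n :* x :- p)) (fromℕ (suc n)) x
          (fromℤ p)))
      (sym (fromℤ-neg p))

    rational-+ : ∀ {x y} → Rational x → Rational y → Rational (x + y)
    rational-+ {x} {y} (n , p , eq) (m , q , eq′) = m ℕ.+ n ℕ.* suc m , + suc m ℤ.* p ℤ.+ + suc n ℤ.* q , (begin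
      fromℕ (suc n ℕ.* suc m) * (x + y)             ≈⟨ *-congʳ (fromℕ-* (suc n) (suc m)) ⟩
      fromℕ (suc n) * fromℕ (suc m) * (x + y)       ≈⟨ combine₂ (fromℕ (suc m)) (fromℕ (suc n)) eq eq′
        (solve 6 (λ n m x y p q → n :* m :* (x :+ y) :- (m :* p :+ n :* q) := m :* (n :* x :- p)
            :+ n :* (m :* y :- q))
          (fromℕ (suc n)) (fromℕ (suc m)) x y (fromℤ p) (fromℤ q)) ⟩
      fromℕ (suc m) * fromℤ p + fromℕ (suc n) * fromℤ q ≈⟨ +-cong (fromℤ-* (+ suc m) p) (fromℤ-* (+ suc n) q) ⟨
      fromℤ (+ suc m ℤ.* p) + fromℤ (+ suc n ℤ.* q)  ≈⟨ fromℤ-+ (+ suc m ℤ.* p) (+ suc n ℤ.* q) ⟨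
      fromℤ (+ suc m ℤ.* p ℤ.+ + suc n ℤ.* q)        ∎)
      where open ≈-Reasoning

    rational-* : ∀ {x y} → Rational x → Rational y → Rational (x * y)
    rational-* {x} {y} (n , p , eq) (m , q , eq′) = m ℕ.+ n ℕ.* suc m , p ℤ.* q , (begin
      fromℕ (suc n ℕ.* suc m) * (x * y)             ≈⟨ *-congʳ (fromℕ-* (suc n) (suc m)) ⟩
      fromℕ (suc n) * fromℕ (suc m) * (x * y)       ≈⟨ solve 4 (λ n m x y → n :* m :* (x :* y)
          := (n :* x) :* (m :* y)) (fromℕ (suc n)) (fromℕ (suc m)) x y ⟩
      (fromℕ (suc n) * x) * (fromℕ (suc m) * y)     ≈⟨ *-cong eq eq′ ⟩
      fromℤ p * fromℤ q                             ≈⟨ fromℤ-* p q ⟨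
      fromℤ (p ℤ.* q)                               ∎)
      where open ≈-Reasoning

    -- The quotient -y/x, in the form in which linear equations x z + y = 0 present it.
    rational-solution : ∀ {x y z} → Rational x → Rational y → ¬ (x ≈ 0#) → x * z + y ≈ 0# → Rational z
    rational-solution {x} {y} {z} (n , + zero , eq) (m , q , eq′) x≉0 _ =
      ⊥-elim (x≉0 (*-cancelˡ-0 (>⇒≉0 (fromℕ-pos {suc n} (s≤s z≤n))) eq))
    rational-solution {x} {y} {z} (n , + suc k , eq) (m , q , eq′) x≉0 lin = m ℕ.+ k ℕ.* suc m
        , ℤ.- (+ suc n ℤ.* q) , (begin
      fromℕ (suc k ℕ.* suc m) * z              ≈⟨ *-congʳ (fromℕ-* (suc k) (suc m)) ⟩
      fromℕ (suc k) * fromℕ (suc m) * z        ≈⟨ combine₃ (- (fromℕ (suc m) * z)) (- fromℕ (suc n))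
          (fromℕ (suc n) * fromℕ (suc m)) eq eq′ lin
        (solve 7 (λ n m k x y z q → k :* m :* z :- (:- (n :* q)) := (:- (m :* z)) :* (n :* x :- k)
            :+ (:- n) :* (m :* y :- q) :+ n :* m :* (x :* z :+ y :- con 0))
          (fromℕ (suc n)) (fromℕ (suc m)) (fromℕ (suc k)) x y z (fromℤ q)) ⟩
      - (fromℕ (suc n) * fromℤ q)              ≈⟨ -‿cong (fromℤ-* (+ suc n) q) ⟨
      - fromℤ (+ suc n ℤ.* q)                  ≈⟨ fromℤ-neg (+ suc n ℤ.* q) ⟨
      fromℤ (ℤ.- (+ suc n ℤ.* q))              ∎)
      where open ≈-Reasoning
    rational-solution {x} {y} {z} (n , -[1+ k ] , eq) (m , q , eq′) x≉0 lin = m ℕ.+ k ℕ.* suc m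
        , + suc n ℤ.* q , (begin
      fromℕ (suc k ℕ.* suc m) * z              ≈⟨ *-congʳ (fromℕ-* (suc k) (suc m)) ⟩
      fromℕ (suc k) * fromℕ (suc m) * z        ≈⟨ combine₃ (fromℕ (suc m) * z) (fromℕ (suc n))
          (- (fromℕ (suc n) * fromℕ (suc m))) eq eq′ lin
        (solve 7 (λ n m k x y z q → k :* m :* z :- n :* q := (m :* z) :* (n :* x :- (:- k)) :+ n :* (m :* y :- q)
            :+ (:- (n :* m)) :* (x :* z :+ y :- con 0))
          (fromℕ (suc n)) (fromℕ (suc m)) (fromℕ (suc k)) x y z (fromℤ q)) ⟩
      fromℕ (suc n) * fromℤ q                  ≈⟨ fromℤ-* (+ suc n) q ⟨
      fromℤ (+ suc n ℤ.* q)                    ∎)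
      where open ≈-Reasoning

    -- Dedekind's descent: if N x, N x², N x³ are integers, so are M x, M x², M x³ for M = N x mod N < N.
    integral-descent : ∀ {x} (A B C D : ℤ) → IsRoot (fromℤ A) (fromℤ B) (fromℤ C) (fromℤ D) x →
      ∀ n → Acc ℕ._<_ (suc n) → ∀ P Q S → fromℕ (suc n) * x ≈ fromℤ P → fromℕ (suc n) * (x * x) ≈ fromℤ Q →
      fromℕ (suc n) * (x * x * x) ≈ fromℤ S → ∃ λ k → x ≈ fromℤ k
    integral-descent {x} A B C D root n (acc smaller) P Q S eqP eqQ eqS =
      next (P ℤDivMod.%ℕ suc n) ≡.refl
      where
      F : ℤ
      F = P ℤDivMod./ℕ suc n
      divided : ∀ {M} → P ℤDivMod.%ℕ suc n ≡ M → fromℤ P ≈ fromℕ M + fromℤ F * fromℕ (suc n)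
      divided {M} M≡ = begin
        fromℤ P                                       ≡⟨ ≡.cong fromℤ (ℤDivMod.a≡a%ℕn+[a/ℕn]*n P (suc n)) ⟩
        fromℤ (+ (P ℤDivMod.%ℕ suc n) ℤ.+ F ℤ.* + suc n)      ≡⟨ ≡.cong (λ m → fromℤ (+ m ℤ.+ F ℤ.* + suc n)) M≡ ⟩
        fromℤ (+ M ℤ.+ F ℤ.* + suc n)                     ≈⟨ fromℤ-+ (+ M) (F ℤ.* + suc n) ⟩
        fromℕ M + fromℤ (F ℤ.* + suc n)                   ≈⟨ +-congˡ (fromℤ-* F (+ suc n)) ⟩
        fromℕ M + fromℤ F * fromℕ (suc n)                   ∎
        where open ≈-Reasoning
      difference : ∀ I J {y} → y ≈ fromℤ I - fromℤ F * fromℤ J → y ≈ fromℤ (I ℤ.- F ℤ.* J)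
      difference I J eq = trans eq (sym (trans (fromℤ-+ I (ℤ.- (F ℤ.* J)))
        (+-congˡ (trans (fromℤ-neg (F ℤ.* J)) (-‿cong (fromℤ-* F J))))))
      -- N x⁴ is an integer as well, because the quartic equation expresses it by N x³, N x², N x
      -- and N.
      E : ℤ
      E = ℤ.- (A ℤ.* S ℤ.+ B ℤ.* Q ℤ.+ C ℤ.* P ℤ.+ D ℤ.* + suc n)
      Nx⁴≈E : fromℕ (suc n) * (x * x * x * x) ≈ fromℤ E
      Nx⁴≈E = trans (combine₃ (- fromℤ A) (- fromℤ B) (- fromℤ C) eqS eqQ eqP
          (combine₁ (fromℕ (suc n)) root (solve 9 (λ N x a b c d s q p →
              (N :* (x :* x :* x :* x) :- (:- (a :* s :+ b :* q :+ c :* p :+ d :* N)))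
              :- ((:- a) :* (N :* (x :* x :* x) :- s) :+ (:- b) :* (N :* (x :* x) :- q) :+ (:- c) :* (N :* x :- p))
              := N :* (x :* x :* x :* x :+ a :* (x :* x :* x) :+ b :* (x :* x) :+ c :* x :+ d :- con 0))
            (fromℕ (suc n)) x (fromℤ A) (fromℤ B) (fromℤ C) (fromℤ D) (fromℤ S) (fromℤ Q) (fromℤ P))))
        (sym (trans (fromℤ-neg (A ℤ.* S ℤ.+ B ℤ.* Q ℤ.+ C ℤ.* P ℤ.+ D ℤ.* + suc n))
            (-‿cong (trans (fromℤ-+ (A ℤ.* S ℤ.+ B ℤ.* Q ℤ.+ C ℤ.* P) (D ℤ.* + suc n)) (+-cong
          (trans (fromℤ-+ (A ℤ.* S ℤ.+ B ℤ.* Q) (C ℤ.* P))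
              (+-cong (trans (fromℤ-+ (A ℤ.* S) (B ℤ.* Q)) (+-cong (fromℤ-* A S) (fromℤ-* B Q))) (fromℤ-* C P)))
          (fromℤ-* D (+ suc n)))))))
      next : ∀ M → P ℤDivMod.%ℕ suc n ≡ M → ∃ λ k → x ≈ fromℤ k
      next zero    M≡ = F , *-cancelˡ (>⇒≉0 (fromℕ-pos {suc n} (s≤s z≤n)))
        (trans eqP (trans (divided M≡) (trans (+-identityˡ _) (*-comm _ _))))
      next (suc m) M≡ = integral-descent A B C D root m
          (smaller (≡.subst (ℕ._< suc n) M≡ (ℤDivMod.n%ℕd<d P (suc n))))
        (Q ℤ.- F ℤ.* P) (S ℤ.- F ℤ.* Q) (E ℤ.- F ℤ.* S)
        (step Q P eqQ eqP)
        (step S Q (trans (*-congˡ (sym (*-assoc x x x))) eqS) eqQ)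
        (step E S (trans (*-congˡ (solve 1 (λ x → x :* (x :* x :* x) := x :* x :* x :* x) x)) Nx⁴≈E) eqS)
        where
        -- From N x = M + F N follows M y = N x y - F N y, which is applied to y = x, x², x³.
        step : ∀ I J {y} → fromℕ (suc n) * (x * y) ≈ fromℤ I → fromℕ (suc n) * y ≈ fromℤ J
            → fromℕ (suc m) * y ≈ fromℤ (I ℤ.- F ℤ.* J)
        step I J {y} eqI eqJ = difference I J (combine₃ (- y) 1# (- fromℤ F) (trans eqP (divided M≡)) eqI eqJ
          (solve 7 (λ M N F x y i j → M :* y :- (i :- F :* j) := (:- y) :* (N :* x :- (M :+ F :* N))
              :+ con 1 :* (N :* (x :* y) :- i) :+ (:- F) :* (N :* y :- j))
            (fromℕ (suc m)) (fromℕ (suc n)) (fromℤ F) x y (fromℤ I) (fromℤ J)))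

    rational-root-integral : ∀ {x} (A B C D : ℤ) → IsRoot (fromℤ A) (fromℤ B) (fromℤ C) (fromℤ D) x → Rational x →
      ∃ λ k → x ≈ fromℤ k
    rational-root-integral {x} A B C D root (n , p , eq) =
      -- The successor of this number is (n + 1)³, a common denominator of x, x² and x³.
      integral-descent A B C D root (n ℕ.+ (n ℕ.+ n ℕ.* suc n) ℕ.* suc n) (<-wellFounded _)
        (+ suc n ℤ.* + suc n ℤ.* p) (+ suc n ℤ.* (p ℤ.* p)) (p ℤ.* p ℤ.* p)
        (trans (*-congʳ N³) (trans (combine₁ (N * N) eq
            (solve 3 (λ N x p → N :* N :* N :* x :- N :* N :* p := N :* N :* (N :* x :- p)) N x (fromℤ p)))
          (sym (trans (fromℤ-* (+ suc n ℤ.* + suc n) p) (*-congʳ (fromℤ-* (+ suc n) (+ suc n)))))))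
        (trans (*-congʳ N³) (trans (combine₁ (N * (N * x + fromℤ p)) eq
            (solve 3 (λ N x p → N :* N :* N :* (x :* x) :- N :* (p :* p) := N :* (N :* x :+ p) :* (N :* x :- p)) N x
                (fromℤ p)))
          (sym (trans (fromℤ-* (+ suc n) (p ℤ.* p)) (*-congˡ (fromℤ-* p p))))))
        (trans (*-congʳ N³) (trans (solve 2 (λ N x → N :* N :* N :* (x :* x :* x)
            := (N :* x) :* (N :* x) :* (N :* x)) N x)
          (trans (*-cong (*-cong eq eq) eq) (sym (trans (fromℤ-* (p ℤ.* p) p) (*-congʳ (fromℤ-* p p)))))))
      where
      N : ℝ
      N = fromℕ (suc n)
      N³ : fromℕ (suc n ℕ.* suc n ℕ.* suc n) ≈ N * N * N
      N³ = trans (fromℕ-* (suc n ℕ.* suc n) (suc n)) (*-congʳ (fromℕ-* (suc n) (suc n)))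

-- Reduction modulo the quartic, and the relation Φ at the two real roots t and γ.

module SmallerRoot (em : ExcludedMiddle 0ℓ) (real : CompleteOrderedField) where
  open Classical em real hiding (zero)
  open Reals em real
  open Rationality em real

  abstract

    -- R³v³ = (wu)³ = w² · w u³ = R³ · w u³, and R³ cancels.
    cube-relation : ∀ {u v w R} → ¬ (R ≈ 0#) → w * u ≈ R * v → w * w ≈ R * R * R → v * v * v ≈ w * (u * u * u)
    cube-relation {u} {v} {w} {R} R≉0 duality w²≈R³ = *-cancelˡ (*-nonZero (*-nonZero R≉0 R≉0) R≉0)
      (combine₂ (- (w * u * (w * u) + w * u * (R * v) + R * v * (R * v))) (w * (u * u * u)) duality w²≈R³
      (solve 4 (λ u v w R → R :* R :* R :* (v :* v :* v) :- R :* R :* R :* (w :* (u :* u :* u))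
        := (:- (w :* u :* (w :* u) :+ w :* u :* (R :* v) :+ R :* v :* (R :* v))) :* (w :* u :- R :* v)
          :+ w :* (u :* u :* u) :* (w :* w :- R :* R :* R)) u v w R))

  module _ {a b c d : ℝ} where

    -- φ is given on the real roots of the quartic by a cubic with rational coefficients.
    record Reduced (φ : ℝ → ℝ) : Set where
      constructor reduced
      field
        {r₃ r₂ r₁ r₀} : ℝ
        ρ₃ : Rational r₃
        ρ₂ : Rational r₂
        ρ₁ : Rational r₁
        ρ₀ : Rational r₀
        agrees : ∀ {x} → IsRoot a b c d x → φ x ≈ r₃ * (x * x * x) + r₂ * (x * x) + r₁ * x + r₀

    abstract

      rational-0 : Rational 0#
      rational-0 = rational-ℤ (+ 0)

      rational-- : ∀ {x y} → Rational x → Rational y → Rational (x - y)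
      rational-- x y = rational-+ x (rational-neg y)

      reduced-constant : ∀ {r} → Rational r → Reduced (λ _ → r)
      reduced-constant {r} ρ = reduced rational-0 rational-0 rational-0 ρ λ {x} _ →
        solve 2 (λ r x → r := con 0 :* (x :* x :* x) :+ con 0 :* (x :* x) :+ con 0 :* x :+ r) r x

      reduced-+ : ∀ {φ ψ} → Reduced φ → Reduced ψ → Reduced (λ x → φ x + ψ x)
      reduced-+ (reduced {r₃} {r₂} {r₁} {r₀} ρ₃ ρ₂ ρ₁ ρ₀ eq) (reduced {s₃} {s₂} {s₁} {s₀} σ₃ σ₂ σ₁ σ₀ eq′) =
        reduced (rational-+ ρ₃ σ₃) (rational-+ ρ₂ σ₂) (rational-+ ρ₁ σ₁) (rational-+ ρ₀ σ₀) λ {x} root →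
          trans (+-cong (eq root) (eq′ root)) (solve 9 (λ r₃ r₂ r₁ r₀ s₃ s₂ s₁ s₀ x →
            (r₃ :* (x :* x :* x) :+ r₂ :* (x :* x) :+ r₁ :* x :+ r₀)
                :+ (s₃ :* (x :* x :* x) :+ s₂ :* (x :* x) :+ s₁ :* x :+ s₀)
            := (r₃ :+ s₃) :* (x :* x :* x) :+ (r₂ :+ s₂) :* (x :* x) :+ (r₁ :+ s₁) :* x :+ (r₀ :+ s₀)) r₃ r₂ r₁ r₀
                s₃ s₂ s₁ s₀ x)

      reduced-scale : ∀ {φ r} → Rational r → Reduced φ → Reduced (λ x → r * φ x)
      reduced-scale {r = r} ρ (reduced {r₃} {r₂} {r₁} {r₀} ρ₃ ρ₂ ρ₁ ρ₀ eq) =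
        reduced (rational-* ρ ρ₃) (rational-* ρ ρ₂) (rational-* ρ ρ₁) (rational-* ρ ρ₀) λ {x} root →
          trans (*-congˡ (eq root)) (solve 6 (λ r r₃ r₂ r₁ r₀ x →
            r :* (r₃ :* (x :* x :* x) :+ r₂ :* (x :* x) :+ r₁ :* x :+ r₀)
            := (r :* r₃) :* (x :* x :* x) :+ (r :* r₂) :* (x :* x) :+ (r :* r₁) :* x :+ (r :* r₀)) r r₃ r₂ r₁ r₀ x)

      reduced-cong : ∀ {φ ψ} → (∀ {x} → IsRoot a b c d x → φ x ≈ ψ x) → Reduced φ → Reduced ψ
      reduced-cong φ≈ψ (reduced ρ₃ ρ₂ ρ₁ ρ₀ eq) = reduced ρ₃ ρ₂ ρ₁ ρ₀ λ root → trans (sym (φ≈ψ root)) (eq root)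

      module _ (ρa : Rational a) (ρb : Rational b) (ρc : Rational c) (ρd : Rational d) where

        -- Multiplication by x creates the term r₃x⁴, which the quartic equation replaces by lower
        -- powers.
        reduced-shift : ∀ {φ} → Reduced φ → Reduced (λ x → x * φ x)
        reduced-shift (reduced {r₃} {r₂} {r₁} {r₀} ρ₃ ρ₂ ρ₁ ρ₀ eq) =
          reduced (rational-- ρ₂ (rational-* ρ₃ ρa)) (rational-- ρ₁ (rational-* ρ₃ ρb))
            (rational-- ρ₀ (rational-* ρ₃ ρc)) (rational-neg (rational-* ρ₃ ρd)) λ {x} root →
            trans (*-congˡ (eq root)) (combine₁ r₃ root (solve 9 (λ a b c d r₃ r₂ r₁ r₀ x →
              x :* (r₃ :* (x :* x :* x) :+ r₂ :* (x :* x) :+ r₁ :* x :+ r₀)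
              :- ((r₂ :- r₃ :* a) :* (x :* x :* x) :+ (r₁ :- r₃ :* b) :* (x :* x) :+ (r₀ :- r₃ :* c) :* x
                  :+ (:- (r₃ :* d)))
              := r₃ :* (x :* x :* x :* x :+ a :* (x :* x :* x) :+ b :* (x :* x) :+ c :* x :+ d :- con 0)) a b c d r₃
                  r₂ r₁ r₀ x))

        reduced-identity : Reduced (λ x → x)
        reduced-identity = reduced-cong (λ _ → *-identityʳ _) (reduced-shift (reduced-constant rational-1))

        -- Expanding the first factor in powers of x leaves only repeated multiplication of ψ by x.
        reduced-* : ∀ {φ ψ} → Reduced φ → Reduced ψ → Reduced (λ x → φ x * ψ x)
        reduced-* {φ} {ψ} (reduced {r₃} {r₂} {r₁} {r₀} ρ₃ ρ₂ ρ₁ ρ₀ eq) Rψ = reduced-cong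
          (λ {x} root → trans
            (solve 6 (λ r₃ r₂ r₁ r₀ x y → r₃ :* (x :* (x :* (x :* y))) :+ r₂ :* (x :* (x :* y))
                :+ r₁ :* (x :* y) :+ r₀ :* y
              := (r₃ :* (x :* x :* x) :+ r₂ :* (x :* x) :+ r₁ :* x :+ r₀) :* y) r₃ r₂ r₁ r₀ x (ψ x))
            (*-congʳ (sym (eq root))))
          (reduced-+ (reduced-+ (reduced-+ (reduced-scale ρ₃ xxxψ) (reduced-scale ρ₂ xxψ)) (reduced-scale ρ₁ xψ))
              (reduced-scale ρ₀ Rψ))
          where
          xψ : Reduced (λ x → x * ψ x)
          xψ = reduced-shift Rψ
          xxψ : Reduced (λ x → x * (x * ψ x))
          xxψ = reduced-shift xψ
          xxxψ : Reduced (λ x → x * (x * (x * ψ x)))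
          xxxψ = reduced-shift xxψ

    -- If x is a root and f = (X - x)(X³ + uX² + vX + w), then Φ x = x (v³ - w u³), which vanishes when the
    -- roots of the cubic lie on a circle.
    Φ : ℝ → ℝ
    Φ x = x * (v * v * v) + d * (u * u * u)
      where
      u v : ℝ
      u = x + a
      v = x * u + b

    abstract

      Φ-reduced : Rational a → Rational b → Rational c → Rational d → Reduced Φ
      Φ-reduced ρa ρb ρc ρd = reduced-+ (id ⋆ (v ⋆ v ⋆ v)) (reduced-scale ρd (u ⋆ u ⋆ u))
        where
        infixl 7 _⋆_
        _⋆_ : ∀ {φ ψ} → Reduced φ → Reduced ψ → Reduced (λ x → φ x * ψ x)
        _⋆_ = reduced-* ρa ρb ρc ρd
        id : Reduced (λ x → x)
        id = reduced-identity ρa ρb ρc ρd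
        u : Reduced (λ x → x + a)
        u = reduced-+ id (reduced-constant ρa)
        v : Reduced (λ x → x * (x + a) + b)
        v = reduced-+ (id ⋆ u) (reduced-constant ρb)

    -- The three remaining roots lie on |z|² = R, and -w/R is the real one among them.
    module CircleRoots (f : Split a b c d) where
      open Split f

      f[_] : ℝ → ℝ
      f[ x ] = x * x * x * x + a * (x * x * x) + b * (x * x) + c * x + d

      -- The three roots on the circle have product -w, and a pair of conjugate roots has product R.
      γ : ℝ
      γ = - (w * R ⁻¹)

      abstract

        0<R : 0# < R
        0<R = ≤-<-trans (square-nonNeg t) t²<R

        R≉0 : ¬ (R ≈ 0#)
        R≉0 = >⇒≉0 0<R

        w≉0 : ¬ (w ≈ 0#)
        w≉0 w≈0 = *-nonZero (*-nonZero R≉0 R≉0) R≉0 (trans (sym w²≈R³) (trans (*-congʳ w≈0) (zeroˡ w)))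

        factor : ∀ x → f[ x ] ≈ (x - t) * (x * x * x + u * (x * x) + v * x + w)
        factor x = trans (+-congˡ constant) (combine₃ (- (x * x * x)) (- (x * x)) (- x) u≈ v≈ w≈
          (solve 8 (λ a b c t u v w x → (x :* x :* x :* x :+ a :* (x :* x :* x) :+ b :* (x :* x) :+ c :* x
              :+ (:- (t :* w)))
            :- (x :- t) :* (x :* x :* x :+ u :* (x :* x) :+ v :* x :+ w)
            := (:- (x :* x :* x)) :* (u :- (a :+ t)) :+ (:- (x :* x)) :* (v :- (b :+ t :* u))
                :+ (:- x) :* (w :- (c :+ t :* v))) a b c t u v w x))

        root-t : f[ t ] ≈ 0#
        root-t = trans (factor t) (trans (*-congʳ (-‿inverseʳ t)) (zeroˡ _))

        v³≈wu³ : v * v * v ≈ w * (u * u * u)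
        v³≈wu³ = cube-relation R≉0 duality w²≈R³

        -- The duality multiplied by w, with w² = R³. This is the condition for γ to be a root of
        -- the cubic factor.
        vw≈R²u : v * w ≈ R * R * u
        vw≈R²u = *-cancelˡ R≉0 (combine₂ (- w) u duality w²≈R³ (solve 4 (λ u v w R →
          R :* (v :* w) :- R :* (R :* R :* u) := (:- w) :* (w :* u :- R :* v)
              :+ u :* (w :* w :- R :* R :* R)) u v w R))

        Rγ≈-w : R * γ ≈ - w
        Rγ≈-w = combine₁ (- w) (*-inverseʳ R R≉0) (solve 3 (λ R w i →
          R :* (:- (w :* i)) :- (:- w) := (:- w) :* (R :* i :- con 1)) R w (R ⁻¹))

        γ²≈R : γ * γ ≈ R
        γ²≈R = *-cancelˡ (*-nonZero R≉0 R≉0) (combine₂ (R * γ - w) 1# Rγ≈-w w²≈R³ (solve 3 (λ R w g →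
          R :* R :* (g :* g) :- R :* R :* R := (R :* g :- w) :* (R :* g :- (:- w))
              :+ con 1 :* (w :* w :- R :* R :* R)) R w γ))

        γ≉0 : ¬ (γ ≈ 0#)
        γ≉0 γ≈0 = R≉0 (trans (sym γ²≈R) (trans (*-congʳ γ≈0) (zeroˡ γ)))

        root-γ : f[ γ ] ≈ 0#
        root-γ = trans (factor γ) (trans (*-congˡ cubic≈0) (zeroʳ _))
          where
          cubic≈0 : γ * γ * γ + u * (γ * γ) + v * γ + w ≈ 0#
          cubic≈0 = *-cancelˡ-0 R≉0 (combine₃ (R * (γ + u)) (R + v) (- 1#) γ²≈R Rγ≈-w vw≈R²u (solve 5 (λ u v w R g →
            R :* (g :* g :* g :+ u :* (g :* g) :+ v :* g :+ w) :- con 0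
            := R :* (g :+ u) :* (g :* g :- R) :+ (R :+ v) :* (R :* g :- (:- w))
                :+ (:- con 1) :* (v :* w :- R :* R :* u)) u v w R γ))

        Φ[t]≈0 : Φ t ≈ 0#
        Φ[t]≈0 = trans (+-cong (*-congˡ (*-cong (*-cong v′ v′) v′)) (*-cong constant (*-cong (*-cong u′ u′) u′)))
          (combine₁ t v³≈wu³ (solve 4 (λ t u v w → (t :* (v :* v :* v) :+ (:- (t :* w)) :* (u :* u :* u)) :- con 0
            := t :* (v :* v :* v :- w :* (u :* u :* u))) t u v w))
          where
          u′ : t + a ≈ u
          u′ = trans (+-comm t a) (sym u≈)
          v′ : t * (t + a) + b ≈ v
          v′ = trans (+-comm _ b) (trans (+-congˡ (*-congˡ u′)) (sym v≈))

        -- Φ γ ≈ 0 would make -v′/u′ a root whose modulus lies strictly between |t| and √R.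
        Φ[γ]≉0 : ¬ (t ≈ 0#) → ¬ (Φ γ ≈ 0#)
        Φ[γ]≉0 t≉0 Φγ≈0 = byCases (em {u′ ≈ 0#})
          where
          u′ v′ w′ : ℝ
          u′ = γ + a
          v′ = γ * u′ + b
          w′ = γ * v′ + c
          d≈-γw′ : d ≈ - (γ * w′)
          d≈-γw′ = combine₁ 1# root-γ (solve 5 (λ a b c d g → d :- (:- (g :* (g :* (g :* (g :+ a) :+ b) :+ c)))
            := con 1 :* (g :* g :* g :* g :+ a :* (g :* g :* g) :+ b :* (g :* g) :+ c :* g
                :+ d :- con 0)) a b c d γ)
          factor′ : ∀ x → f[ x ] ≈ (x - γ) * (x * x * x + u′ * (x * x) + v′ * x + w′)
          factor′ x = combine₁ 1# d≈-γw′ (solve 6 (λ a b c d g x → let u = g :+ a; v = g :* u :+ b; w = g :* v :+ c in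
            (x :* x :* x :* x :+ a :* (x :* x :* x) :+ b :* (x :* x) :+ c :* x :+ d) :- (x :- g) :* (x :* x :* x
                :+ u :* (x :* x) :+ v :* x :+ w)
            := con 1 :* (d :- (:- (g :* w)))) a b c d γ x)
          t²≉R : ¬ (t * t ≈ R)
          t²≉R = proj₂ t²<R
          -- The product of the roots other than γ has modulus |w′| = |t|R, which exceeds |t|³
          -- because 0 < t² < R.
          t³≉-w′ : ¬ (t * t * t ≈ - w′)
          t³≉-w′ t³≈-w′ = t²≉R (square-injective (square-nonNeg t) (<⇒≤ 0<R) (*-cancelˡ R≉0
            (combine₃ (- (t * t * (t * t))) (- (w - γ * (t * t))) 1# γ²≈R w≈-γt² w²≈R³ (solve 4 (λ t w R g →
              R :* (t :* t :* (t :* t)) :- R :* (R :* R) := (:- (t :* t :* (t :* t))) :* (g :* g :- R)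
                :+ (:- (w :- g :* (t :* t))) :* (w :- (:- (g :* (t :* t)))) :+ con 1 :* (w :* w :- R :* R :* R))
                    t w R γ))))
            where
            w≈-γt² : w ≈ - (γ * (t * t))
            w≈-γt² = *-cancelˡ t≉0 (combine₃ 1# (- 1#) γ constant d≈-γw′ t³≈-w′ (solve 5 (λ t w d g w′ →
              t :* w :- t :* (:- (g :* (t :* t))) := con 1 :* (d :- (:- (t :* w)))
                  :+ (:- con 1) :* (d :- (:- (g :* w′)))
                :+ g :* (t :* t :* t :- (:- w′))) t w d γ w′))
          byCases : Dec (u′ ≈ 0#) → ⊥
          -- Φ γ ≈ 0 then forces v′ ≈ 0 too, so the quartic is (x - γ)(x³ + w′) and t is a root of
          -- the second factor.
          byCases (yes u′≈0) = t³≉-w′ (combine₃ 1# (- (t * t)) (- t) cubic≈0 u′≈0 v′≈0 (solve 4 (λ t u v w →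
              t :* t :* t :- (:- w) := con 1 :* (t :* t :* t :+ u :* (t :* t) :+ v :* t :+ w :- con 0)
                  :+ (:- (t :* t)) :* (u :- con 0) :+ (:- t) :* (v :- con 0)) t u′ v′ w′))
            where
            γv′³≈0 : γ * (v′ * v′ * v′) ≈ 0#
            γv′³≈0 = combine₂ 1# (- (d * (u′ * u′))) Φγ≈0 u′≈0 (solve 4 (λ g d u v →
              g :* (v :* v :* v) :- con 0 := con 1 :* (g :* (v :* v :* v) :+ d :* (u :* u :* u) :- con 0)
                  :+ (:- (d :* (u :* u))) :* (u :- con 0)) γ d u′ v′)
            v′≈0 : v′ ≈ 0#
            v′≈0 with em {v′ ≈ 0#}
            ... | yes v′≈0 = v′≈0
            ... | no  v′≉0 = ⊥-elim (*-nonZero γ≉0 (*-nonZero (*-nonZero v′≉0 v′≉0) v′≉0) γv′³≈0)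
            t-γ≉0 : ¬ (t - γ ≈ 0#)
            t-γ≉0 t-γ≈0 = t²≉R (combine₂ (t + γ) 1# t-γ≈0 γ²≈R (solve 3 (λ t g R →
              t :* t :- R := (t :+ g) :* (t :- g :- con 0) :+ con 1 :* (g :* g :- R)) t γ R))
            cubic≈0 : t * t * t + u′ * (t * t) + v′ * t + w′ ≈ 0#
            cubic≈0 = *-cancelˡ-0 t-γ≉0 (trans (sym (factor′ t)) root-t)
          byCases (no u′≉0) = byRoot (real-root root-y)
            where
            y : ℝ
            y = - (v′ * u′ ⁻¹)
            yu′≈-v′ : y * u′ ≈ - v′
            yu′≈-v′ = combine₁ (- v′) (*-inverseʳ u′ u′≉0) (solve 3 (λ u v i →
              (:- (v :* i)) :* u :- (:- v) := (:- v) :* (u :* i :- con 1)) u′ v′ (u′ ⁻¹))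
            y³≈-w′ : y * y * y ≈ - w′
            y³≈-w′ = *-cancelˡ (*-nonZero γ≉0 (*-nonZero (*-nonZero u′≉0 u′≉0) u′≉0))
              (combine₃ (γ * (y * u′ * (y * u′) - y * u′ * v′ + v′ * v′)) (- 1#) (u′ * u′ * u′) yu′≈-v′ Φγ≈0 d≈-γw′
                  (solve 6 (λ y u v w g d →
                g :* (u :* u :* u) :* (y :* y :* y) :- g :* (u :* u :* u) :* (:- w)
                := g :* (y :* u :* (y :* u) :- y :* u :* v :+ v :* v) :* (y :* u :- (:- v))
                  :+ (:- con 1) :* (g :* (v :* v :* v) :+ d :* (u :* u :* u) :- con 0)
                      :+ u :* u :* u :* (d :- (:- (g :* w)))) y u′ v′ w′ γ d))
            -- The cubic groups as (y³ + w′) + y(yu′ + v′), and both brackets vanish.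
            root-y : f[ y ] ≈ 0#
            root-y = trans (factor′ y) (combine₂ (y - γ) ((y - γ) * y) y³≈-w′ yu′≈-v′ (solve 5 (λ y g u v w →
              (y :- g) :* (y :* y :* y :+ u :* (y :* y) :+ v :* y :+ w) :- con 0
              := (y :- g) :* (y :* y :* y :- (:- w)) :+ (y :- g) :* y :* (y :* u :- (:- v))) y γ u′ v′ w′))
            byRoot : y ≈ t ⊎ y * y ≈ R → ⊥
            byRoot (inj₁ y≈t)  = t³≉-w′ (trans (sym (*-cong (*-cong y≈t y≈t) y≈t)) y³≈-w′)
            -- On the circle d = γy³ would give d² = R⁴, whereas d = -tw gives d² = R³t².
            byRoot (inj₂ y²≈R) = t²≉R (*-cancelˡ (*-nonZero (*-nonZero R≉0 R≉0) R≉0)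
              (trans (sym d²≈R³t²) d²≈R⁴))
              where
              d≈γy³ : d ≈ γ * (y * y * y)
              d≈γy³ = combine₂ 1# (- γ) d≈-γw′ y³≈-w′ (solve 4 (λ y g w d →
                d :- g :* (y :* y :* y) := con 1 :* (d :- (:- (g :* w)))
                    :+ (:- g) :* (y :* y :* y :- (:- w))) y γ w′ d)
              d²≈R⁴ : d * d ≈ R * R * R * R
              d²≈R⁴ = trans (*-cong d≈γy³ d≈γy³)
                  (trans (solve 2 (λ y g → g :* (y :* y :* y) :* (g :* (y :* y :* y))
                      := (y :* y) :* (y :* y) :* (y :* y) :* (g :* g)) y γ)
                (*-cong (*-cong (*-cong y²≈R y²≈R) y²≈R) γ²≈R))
              d²≈R³t² : d * d ≈ R * R * R * (t * t)
              d²≈R³t² = trans (*-cong constant constant) (combine₁ (t * t) w²≈R³ (solve 3 (λ t w R →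
                (:- (t :* w)) :* (:- (t :* w)) :- R :* R :* R :* (t :* t)
                    := t :* t :* (w :* w :- R :* R :* R)) t w R))

-- The root t of smaller modulus is rational, hence an integer.

module RationalRoot (em : ExcludedMiddle 0ℓ) (real : CompleteOrderedField) where
  open Classical em real hiding (zero)
  open Reals em real
  open Rationality em real
  open SmallerRoot em real

  Quadratic Cubic : ℝ → Set
  Quadratic t = ∃₂ λ p q → Rational p × Rational q × t * t ≈ p * t + q
  Cubic t = ∃ λ p → ∃₂ λ q r → Rational p × Rational q × Rational r × t * t * t ≈ p * (t * t) + q * t + r

  abstract

    rational-⁻¹ : ∀ {x} → Rational x → ¬ (x ≈ 0#) → Rational (x ⁻¹)
    rational-⁻¹ {x} ρ x≉0 = rational-solution ρ (rational-neg rational-1) x≉0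
      (x≈y⇒x-y≈0 (*-inverseʳ x x≉0))

    -- Here and in the next two lemmas a nonzero leading coefficient could be divided out, and t
    -- would satisfy one of the excluded monic relations. The result is linear independence of
    -- powers of t over ℚ.
    linear-relation : ∀ {t r₁ r₀} → ¬ Rational t → Rational r₁ → Rational r₀ → r₁ * t + r₀ ≈ 0# → r₁ ≈ 0# × r₀ ≈ 0#
    linear-relation {t} {r₁} {r₀} irr ρ₁ ρ₀ eq with em {r₁ ≈ 0#}
    ... | no  r₁≉0 = ⊥-elim (irr (rational-solution ρ₁ ρ₀ r₁≉0 eq))
    ... | yes r₁≈0 = r₁≈0 , combine₂ 1# (- t) eq r₁≈0 (solve 3 (λ t r₁ r₀ →
      r₀ :- con 0 := con 1 :* (r₁ :* t :+ r₀ :- con 0) :+ (:- t) :* (r₁ :- con 0)) t r₁ r₀)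

    quadratic-relation : ∀ {t r₂ r₁ r₀} → ¬ Rational t → ¬ Quadratic t → Rational r₂ → Rational r₁ → Rational r₀ →
      r₂ * (t * t) + r₁ * t + r₀ ≈ 0# → r₂ ≈ 0# × r₁ ≈ 0# × r₀ ≈ 0#
    quadratic-relation {t} {r₂} {r₁} {r₀} irr ¬quad ρ₂ ρ₁ ρ₀ eq with em {r₂ ≈ 0#}
    ... | yes r₂≈0 = r₂≈0 , linear-relation irr ρ₁ ρ₀ (combine₂ 1# (- (t * t)) eq r₂≈0 (solve 4 (λ t r₂ r₁ r₀ →
      r₁ :* t :+ r₀ :- con 0 := con 1 :* (r₂ :* (t :* t) :+ r₁ :* t :+ r₀ :- con 0)
          :+ (:- (t :* t)) :* (r₂ :- con 0)) t r₂ r₁ r₀))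
    ... | no  r₂≉0 = ⊥-elim (¬quad (- (r₁ * r₂ ⁻¹) , - (r₀ * r₂ ⁻¹) ,
      rational-neg (rational-* ρ₁ (rational-⁻¹ ρ₂ r₂≉0)) , rational-neg (rational-* ρ₀ (rational-⁻¹ ρ₂ r₂≉0)) ,
      combine₂ (r₂ ⁻¹) (- (t * t)) eq (*-inverseʳ r₂ r₂≉0) (solve 5 (λ t r₂ r₁ r₀ i →
        t :* t :- ((:- (r₁ :* i)) :* t :+ (:- (r₀ :* i)))
        := i :* (r₂ :* (t :* t) :+ r₁ :* t :+ r₀ :- con 0) :+ (:- (t :* t)) :* (r₂ :* i :- con 1)) t r₂ r₁
            r₀ (r₂ ⁻¹))))

    cubic-relation : ∀ {t r₃ r₂ r₁ r₀} → ¬ Rational t → ¬ Quadratic t → ¬ Cubic t →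
      Rational r₃ → Rational r₂ → Rational r₁ → Rational r₀ →
      r₃ * (t * t * t) + r₂ * (t * t) + r₁ * t + r₀ ≈ 0# → r₃ ≈ 0# × r₂ ≈ 0# × r₁ ≈ 0# × r₀ ≈ 0#
    cubic-relation {t} {r₃} {r₂} {r₁} {r₀} irr ¬quad ¬cubic ρ₃ ρ₂ ρ₁ ρ₀ eq with em {r₃ ≈ 0#}
    ... | yes r₃≈0 = r₃≈0 , quadratic-relation irr ¬quad ρ₂ ρ₁ ρ₀
        (combine₂ 1# (- (t * t * t)) eq r₃≈0 (solve 5 (λ t r₃ r₂ r₁ r₀ →
      r₂ :* (t :* t) :+ r₁ :* t :+ r₀ :- con 0
      := con 1 :* (r₃ :* (t :* t :* t) :+ r₂ :* (t :* t) :+ r₁ :* t :+ r₀ :- con 0)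
          :+ (:- (t :* t :* t)) :* (r₃ :- con 0)) t r₃ r₂ r₁ r₀))
    ... | no  r₃≉0 = let ρi = rational-⁻¹ ρ₃ r₃≉0 in ⊥-elim
        (¬cubic (- (r₂ * r₃ ⁻¹) , - (r₁ * r₃ ⁻¹) , - (r₀ * r₃ ⁻¹) ,
      rational-neg (rational-* ρ₂ ρi) , rational-neg (rational-* ρ₁ ρi) , rational-neg (rational-* ρ₀ ρi) ,
      combine₂ (r₃ ⁻¹) (- (t * t * t)) eq (*-inverseʳ r₃ r₃≉0) (solve 6 (λ t r₃ r₂ r₁ r₀ i →
        t :* t :* t :- ((:- (r₂ :* i)) :* (t :* t) :+ (:- (r₁ :* i)) :* t :+ (:- (r₀ :* i)))
        := i :* (r₃ :* (t :* t :* t) :+ r₂ :* (t :* t) :+ r₁ :* t :+ r₀ :- con 0)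
            :+ (:- (t :* t :* t)) :* (r₃ :* i :- con 1)) t r₃ r₂ r₁ r₀ (r₃ ⁻¹))))

    -- A rational root of the quartic is t or lies on the circle, and in the latter case R³ = w², w and t are
    -- rational in turn.  If t is cubic over ℚ, the complementary linear factor provides such a root; if t is
    -- quadratic, its conjugate t′ lies on the circle and makes R rational; and if 1, t, t², t³ are independent,
    -- Φ vanishes not only at t but identically on the roots, which is impossible at γ.
    module _ {a b c d : ℝ} (ρa : Rational a) (ρb : Rational b) (ρc : Rational c) (ρd : Rational d)
        (f : Split a b c d) where
      open Split f
      open CircleRoots f

      rational-w⇒rational-t : Rational w → Rational t
      rational-w⇒rational-t ρw = rational-solution ρw ρd w≉0 (combine₁ 1# constant
        (solve 3 (λ t w d → w :* t :+ d :- con 0 := con 1 :* (d :- (:- (t :* w)))) t w d))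

      -- w² = R³ = y⁶ makes w = ±y³ rational, and t = -d/w with it.
      rational-on-circle : ∀ {y} → Rational y → y * y ≈ R → Rational t
      rational-on-circle {y} ρy y²≈R = rational-w⇒rational-t (byCases (zero-product
          (combine₂ 1# (- (R * R + R * (y * y) + y * y * (y * y))) w²≈R³ y²≈R (solve 3 (λ y w R →
            (w :- y :* y :* y) :* (w :+ y :* y :* y) :- con 0
            := con 1 :* (w :* w :- R :* R :* R)
                :+ (:- (R :* R :+ R :* (y :* y) :+ y :* y :* (y :* y))) :* (y :* y :- R)) y w R))))
        where
        ρy³ : Rational (y * y * y)
        ρy³ = rational-* (rational-* ρy ρy) ρy
        byCases : w - y * y * y ≈ 0# ⊎ w + y * y * y ≈ 0# → Rational w
        byCases (inj₁ eq) = rational-cong (sym (x-y≈0⇒x≈y w _ eq)) ρy³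
        byCases (inj₂ eq) = rational-cong (combine₁ (- 1#) eq (solve 2 (λ w z →
          (:- z) :- w := (:- con 1) :* (w :+ z :- con 0)) w (y * y * y))) (rational-neg ρy³)

      rational-root⇒rational : ∀ {y} → Rational y → IsRoot a b c d y → Rational t
      rational-root⇒rational ρy root with real-root root
      ... | inj₁ y≈t  = rational-cong y≈t ρy
      ... | inj₂ y²≈R = rational-on-circle ρy y²≈R

      quadratic⇒rational : ¬ Rational t → Quadratic t → Rational t
      quadratic⇒rational irr (p , q , ρp , ρq , t²≈pt+q) = byRoot (real-root root-t′)
        where
        -- Division of the quartic by X² - pX - q gives X² + h₁X + h₀ with remainder r₁X + r₀; t′ is
        -- the conjugate of t.
        h₁ h₀ r₁ r₀ t′ : ℝ
        h₁ = a + p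
        h₀ = b + q + p * h₁
        r₁ = c + p * h₀ + q * h₁
        r₀ = d + q * h₀
        t′ = p - t
        ρh₁ : Rational h₁
        ρh₁ = rational-+ ρa ρp
        ρh₀ : Rational h₀
        ρh₀ = rational-+ (rational-+ ρb ρq) (rational-* ρp ρh₁)
        remainder : r₁ ≈ 0# × r₀ ≈ 0#
        remainder = linear-relation irr (rational-+ (rational-+ ρc (rational-* ρp ρh₀)) (rational-* ρq ρh₁))
          (rational-+ ρd (rational-* ρq ρh₀))
              (combine₂ 1# (- (t * t + h₁ * t + h₀)) root-t t²≈pt+q (solve 7 (λ a b c d p q t →
            let h₁ = a :+ p; h₀ = b :+ q :+ p :* h₁; r₁ = c :+ p :* h₀ :+ q :* h₁; r₀ = d :+ q :* h₀ in
            r₁ :* t :+ r₀ :- con 0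
            := con 1 :* (t :* t :* t :* t :+ a :* (t :* t :* t) :+ b :* (t :* t) :+ c :* t :+ d :- con 0)
              :+ (:- (t :* t :+ h₁ :* t :+ h₀)) :* (t :* t :- (p :* t :+ q))) a b c d p q t))
        root-t′ : IsRoot a b c d t′
        root-t′ = combine₃ (t′ * t′ + h₁ * t′ + h₀) t′ 1# t²≈pt+q (proj₁ remainder) (proj₂ remainder)
            (solve 7 (λ a b c d p q t →
            let h₁ = a :+ p; h₀ = b :+ q :+ p :* h₁; r₁ = c :+ p :* h₀ :+ q :* h₁; r₀ = d :+ q :* h₀; t′ = p :- t in
            (t′ :* t′ :* t′ :* t′ :+ a :* (t′ :* t′ :* t′) :+ b :* (t′ :* t′) :+ c :* t′ :+ d) :- con 0
            := (t′ :* t′ :+ h₁ :* t′ :+ h₀) :* (t :* t :- (p :* t :+ q)) :+ t′ :* (r₁ :- con 0)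
                :+ con 1 :* (r₀ :- con 0)) a b c d p q t)
        t≉0 : ¬ (t ≈ 0#)
        t≉0 t≈0 = irr (rational-cong (sym t≈0) (rational-ℤ (+ 0)))
        -- Compare d = -qh₀ with d = -tw, where q = -tt′, and cancel t.
        t′h₀≈-w : t′ * h₀ ≈ - w
        t′h₀≈-w = *-cancelˡ t≉0 (combine₃ (- h₀) (- 1#) 1# t²≈pt+q (proj₂ remainder) constant
            (solve 6 (λ d p q t w h₀ →
          t :* ((p :- t) :* h₀) :- t :* (:- w) := (:- h₀) :* (t :* t :- (p :* t :+ q))
              :+ (:- con 1) :* (d :+ q :* h₀ :- con 0)
            :+ con 1 :* (d :- (:- (t :* w)))) d p q t w h₀))
        byRoot : t′ ≈ t ⊎ t′ * t′ ≈ R → Rational t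
        byRoot (inj₁ t′≈t) = rational-solution (rational-ℤ (+ 2)) (rational-neg ρp) (>⇒≉0 (fromℕ-pos {2} (s≤s z≤n)))
          (combine₁ (- 1#) t′≈t (solve 2 (λ p t → con 2 :* t :+ (:- p) :- con 0
              := (:- con 1) :* (p :- t :- t)) p t))
        byRoot (inj₂ t′²≈R) = byCases (em {p ≈ 0#})
          where
          -- Since w = -t′h₀ and t′² = R, the relation w² = R³ becomes Rh₀² = R³. Hence R = ±h₀ is
          -- rational.
          h₀²≈R² : h₀ * h₀ ≈ R * R
          h₀²≈R² = *-cancelˡ R≉0 (combine₃ (- (h₀ * h₀)) (t′ * h₀ - w) 1# t′²≈R t′h₀≈-w w²≈R³
              (solve 4 (λ t′ h₀ w R →
            R :* (h₀ :* h₀) :- R :* (R :* R) := (:- (h₀ :* h₀)) :* (t′ :* t′ :- R)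
                :+ (t′ :* h₀ :- w) :* (t′ :* h₀ :- (:- w)) :+ con 1 :* (w :* w :- R :* R :* R)) t′ h₀ w R))
          ρR : Rational R
          ρR with zero-product {h₀ - R} {h₀ + R} (combine₁ 1# h₀²≈R² (solve 2 (λ h R →
            (h :- R) :* (h :+ R) :- con 0 := con 1 :* (h :* h :- R :* R)) h₀ R))
          ... | inj₁ eq = rational-cong (x-y≈0⇒x≈y h₀ R eq) ρh₀
          ... | inj₂ eq = rational-cong (combine₁ (- 1#) eq
              (solve 2 (λ h R → (:- h) :- R := (:- con 1) :* (h :+ R :- con 0)) h₀ R)) (rational-neg ρh₀)
          byCases : Dec (p ≈ 0#) → Rational t
          -- For p = 0 the conjugate is -t, which would put t on the circle.
          byCases (yes p≈0) = ⊥-elim (proj₂ t²<R (combine₂ 1# (- (p - (t + t))) t′²≈R p≈0 (solve 3 (λ p t R →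
            t :* t :- R := con 1 :* ((p :- t) :* (p :- t) :- R) :+ (:- (p :- (t :+ t))) :* (p :- con 0)) p t R)))
          -- R = t′² = pt′ + q is a linear equation for t′ with rational coefficients.
          byCases (no p≉0) = rational-cong (solve 2 (λ p t → p :- (p :- t) := t) p t)
            (rational-+ ρp (rational-neg (rational-solution {z = t′} ρp (rational-+ ρq (rational-neg ρR)) p≉0
              (combine₂ 1# (- 1#) t′²≈R t²≈pt+q (solve 4 (λ p q t R →
                p :* (p :- t) :+ (q :- R) :- con 0 := con 1 :* ((p :- t) :* (p :- t) :- R)
                    :+ (:- con 1) :* (t :* t :- (p :* t :+ q))) p q t R)))))

      cubic⇒rational : ¬ Rational t → ¬ Quadratic t → Cubic t → Rational t
      cubic⇒rational irr ¬quad (p , q , r , ρp , ρq , ρr , t³≈) = rational-root⇒rational ρs root-s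
        where
        -- Division of the quartic by X³ - pX² - qX - r gives X - s with remainder k₂X² + k₁X + k₀.
        s k₂ k₁ k₀ : ℝ
        s = - (a + p)
        k₂ = b + q - s * p
        k₁ = c + r - s * q
        k₀ = d - s * r
        ρs : Rational s
        ρs = rational-neg (rational-+ ρa ρp)
        remainder : k₂ ≈ 0# × k₁ ≈ 0# × k₀ ≈ 0#
        remainder = quadratic-relation irr ¬quad
          (rational-+ (rational-+ ρb ρq) (rational-neg (rational-* ρs ρp)))
          (rational-+ (rational-+ ρc ρr) (rational-neg (rational-* ρs ρq)))
          (rational-+ ρd (rational-neg (rational-* ρs ρr)))
          (combine₂ 1# (- (t - s)) root-t t³≈ (solve 8 (λ a b c d p q r t →
            let s = :- (a :+ p) in
            (b :+ q :- s :* p) :* (t :* t) :+ (c :+ r :- s :* q) :* t :+ (d :- s :* r) :- con 0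
            := con 1 :* (t :* t :* t :* t :+ a :* (t :* t :* t) :+ b :* (t :* t) :+ c :* t :+ d :- con 0)
              :+ (:- (t :- s)) :* (t :* t :* t :- (p :* (t :* t) :+ q :* t :+ r))) a b c d p q r t))
        root-s : IsRoot a b c d s
        root-s = combine₃ (s * s) s 1# (proj₁ remainder) (proj₁ (proj₂ remainder)) (proj₂ (proj₂ remainder))
            (solve 7 (λ a b c d p q r →
            let s = :- (a :+ p) in
            (s :* s :* s :* s :+ a :* (s :* s :* s) :+ b :* (s :* s) :+ c :* s :+ d) :- con 0
            := s :* s :* (b :+ q :- s :* p :- con 0) :+ s :* (c :+ r :- s :* q :- con 0)
                :+ con 1 :* (d :- s :* r :- con 0)) a b c d p q r)

      independent⇒⊥ : ¬ Rational t → ¬ Quadratic t → ¬ Cubic t → ⊥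
      independent⇒⊥ irr ¬quad ¬cubic with reduced {r₃} {r₂} {r₁} {r₀} ρ₃ ρ₂ ρ₁ ρ₀ agrees ← Φ-reduced ρa ρb ρc ρd
        with r₃≈0 , r₂≈0 , r₁≈0 , r₀≈0 ← cubic-relation {t} irr ¬quad ¬cubic ρ₃ ρ₂ ρ₁ ρ₀
            (trans (sym (agrees root-t)) Φ[t]≈0) =
        Φ[γ]≉0 (λ t≈0 → irr (rational-cong (sym t≈0) (rational-ℤ (+ 0))))
          (trans (agrees root-γ) (trans (+-cong (+-cong (+-cong (*-congʳ r₃≈0) (*-congʳ r₂≈0)) (*-congʳ r₁≈0)) r₀≈0)
            (solve 1 (λ x → con 0 :* (x :* x :* x) :+ con 0 :* (x :* x) :+ con 0 :* x :+ con 0 := con 0) γ)))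

      t-rational : Rational t
      t-rational with em {Rational t} | em {Quadratic t} | em {Cubic t}
      ... | yes rational | _        | _        = rational
      ... | no irr       | yes quad | _        = quadratic⇒rational irr quad
      ... | no irr       | no ¬quad | yes cub  = cubic⇒rational irr ¬quad cub
      ... | no irr       | no ¬quad | no ¬cub  = ⊥-elim (independent⇒⊥ irr ¬quad ¬cub)

    smaller-root-integral : ∀ A B C E (f : Split (fromℤ A) (fromℤ B) (fromℤ C) (fromℤ E)) →
      ∃ λ k → Split.t f ≈ fromℤ k
    smaller-root-integral A B C E f = rational-root-integral A B C E (CircleRoots.root-t f)
      (t-rational (rational-ℤ A) (rational-ℤ B) (rational-ℤ C) (rational-ℤ E) f)

-- Explicit lists that contain the polynomials to be counted, and their lengths.

module Covers where
  open import Data.Nat.Base using (_+_; _*_; _^_; _∸_; _/_; _≤_; _<_)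
  open Counting
  open ℕₚ.≤-Reasoning
  open ℕSolver.+-*-Solver using (solve; con; _:+_; _:*_; _:=_)

  -- A superset of the integer cubics with constant term in [-N, N] whose roots have equal moduli.
  cover₃ : ℕ → List (Monic 3)
  cover₃ N = List.map (λ w → w ∷ + 0 ∷ + 0 ∷ []) (range N) List.++
    -- Here w = m³, v = um and |u| ≤ 3|m|. The range |m| ≤ √N, coarser than the cube root, already
    -- keeps this part at O(N).
    cartesianProductWith (λ m u → m ℤ.* m ℤ.* m ∷ u ℤ.* m ∷ u ∷ []) (range ⌊√ N ⌋) (range (3 * ⌊√ N ⌋))

  -- The same for quartics in the box of size H.
  cover₄₄ : ℕ → List (Monic 4)
  -- The case a = c = 0, with b² ≤ 36|d| ≤ 36H.
  cover₄₄ H = cartesianProductWith (λ d b → d ∷ + 0 ∷ b ∷ + 0 ∷ []) (range H) (range (6 * suc ⌊√ H ⌋)) List.++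
    -- For a ≠ 0 the constant term is ±m², and c = am; both signs stay within O(H^(3/2)) when |a| ≤
    -- 4|m| and |b| ≤ 6|m|.
    (cartesianProductWith (λ m (a , b) → m ℤ.* m ∷ a ℤ.* m ∷ b ∷ a ∷ []) (range ⌊√ H ⌋) pairs List.++
     cartesianProductWith (λ m (a , b) → ℤ.- (m ℤ.* m) ∷ a ℤ.* m ∷ b ∷ a ∷ []) (range ⌊√ H ⌋) pairs)
    where
    pairs : List (ℤ × ℤ)
    pairs = cartesianProduct (range (4 * ⌊√ H ⌋)) (range (6 * ⌊√ H ⌋))

  -- The coefficients of (X - k)(X³ + uX² + vX + w).
  multiply : ℤ → Monic 3 → Monic 4
  multiply k (w ∷ v ∷ u ∷ []) = ℤ.- (k ℤ.* w) ∷ w ℤ.- k ℤ.* v ∷ v ℤ.- k ℤ.* u ∷ u ℤ.- k ∷ []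

  -- A bound for |w| when (X - k)(X³ + ... + w) has height at most H and |k| = n.
  budget : ℕ → ℕ → ℕ
  -- For k = 0 the constant term says nothing about w, but the coefficient of X equals w.
  budget H zero    = H
  budget H (suc n) = H / suc n

  slice : ℕ → ℕ → List (Monic 4)
  slice H n = List.map (multiply (+ n)) (cover₃ (budget H n)) List.++
    List.map (multiply (ℤ.- + n)) (cover₃ (budget H n))

  cover₄₃ : ℕ → List (Monic 4)
  cover₄₃ H = slices (slice H) (suc H)

  abstract

    1+2n≤3n : ∀ {n} → 1 ≤ n → suc (2 * n) ≤ 3 * n
    1+2n≤3n {n} 1≤n = ℕₚ.+-monoˡ-≤ (2 * n) 1≤n

    length-cover₃ : ∀ {N} → 1 ≤ N → length (cover₃ N) ≤ 24 * N
    length-cover₃ {N} 1≤N = begin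
      length (cover₃ N)
        ≡⟨ Listₚ.length-++ (List.map (λ w → w ∷ + 0 ∷ + 0 ∷ []) (range N)) ⟩
      length (List.map (λ w → w ∷ + 0 ∷ + 0 ∷ []) (range N)) + length
          (cartesianProductWith _ (range S) (range (3 * S)))
        ≡⟨ ≡.cong₂ _+_ (≡.trans (Listₚ.length-map _ (range N)) (length-range N))
             (≡.trans (length-cartesianProductWith _ (range S) (range (3 * S)))
                 (≡.cong₂ _*_ (length-range S) (length-range (3 * S)))) ⟩
      suc (2 * N) + suc (2 * S) * suc (2 * (3 * S))
        ≤⟨ ℕₚ.+-mono-≤ (1+2n≤3n 1≤N) (ℕₚ.*-mono-≤ (1+2n≤3n 1≤S) (ℕₚ.+-monoˡ-≤ (2 * (3 * S)) 1≤S)) ⟩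
      3 * N + 3 * S * (S + 2 * (3 * S))
        ≡⟨ solve 2 (λ N S → con 3 :* N :+ con 3 :* S :* (S :+ con 2 :* (con 3 :* S)) := con 3 :* N
            :+ con 21 :* (S :* S)) ≡.refl N S ⟩
      3 * N + 21 * (S * S)
        ≤⟨ ℕₚ.+-monoʳ-≤ (3 * N) (ℕₚ.*-monoʳ-≤ 21 (⌊√⌋²≤ N)) ⟩
      3 * N + 21 * N
        ≡⟨ ℕₚ.*-distribʳ-+ N 3 21 ⟨
      24 * N ∎
      where
      S : ℕ
      S = ⌊√ N ⌋
      1≤S : 1 ≤ S
      1≤S = 1≤⌊√⌋ 1≤N

    H≤4⌊√H⌋² : ∀ {H} → 1 ≤ H → H ≤ 4 * (⌊√ H ⌋ * ⌊√ H ⌋)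
    H≤4⌊√H⌋² {H} 1≤H = begin
      H                            ≤⟨ ℕₚ.<⇒≤ (<[1+⌊√⌋]² H) ⟩
      suc S * suc S                ≤⟨ ℕₚ.*-mono-≤ 1+S≤2S 1+S≤2S ⟩
      (S + S) * (S + S)            ≡⟨ solve 1 (λ S → (S :+ S) :* (S :+ S) := con 4 :* (S :* S)) ≡.refl S ⟩
      4 * (S * S)                  ∎
      where
      S : ℕ
      S = ⌊√ H ⌋
      1+S≤2S : suc S ≤ S + S
      1+S≤2S = ℕₚ.+-monoˡ-≤ S (1≤⌊√⌋ 1≤H)

    length-cover₄₄ : ∀ {H} → 1 ≤ H → length (cover₄₄ H) ≤ 927 * (⌊√ H ⌋ * ⌊√ H ⌋ * ⌊√ H ⌋)
    length-cover₄₄ {H} 1≤H = begin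
      length (cover₄₄ H)
        ≡⟨ ≡.trans (Listₚ.length-++ (cartesianProductWith (λ d b → d ∷ + 0 ∷ b ∷ + 0 ∷ []) (range H)
            (range (6 * suc S))))
             (≡.cong₂ _+_ (≡.trans (length-cartesianProductWith _ (range H) (range (6 * suc S)))
                 (≡.cong₂ _*_ (length-range H) (length-range (6 * suc S))))
               (≡.trans (Listₚ.length-++ (cartesianProductWith (λ m (a , b) → m ℤ.* m ∷ a ℤ.* m ∷ b ∷ a ∷ [])
                   (range S) (cartesianProduct (range (4 * S)) (range (6 * S)))))
                 (≡.cong₂ _+_ (product _) (product _)))) ⟩
      suc (2 * H) * suc (2 * (6 * suc S)) + (T + T)
        ≤⟨ ℕₚ.+-mono-≤ (ℕₚ.*-mono-≤ 1+2H≤9S² 13+12S≤25S) (ℕₚ.+-mono-≤ T≤351S³ T≤351S³) ⟩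
      9 * (S * S) * (25 * S) + (351 * (S * S * S) + 351 * (S * S * S))
        ≡⟨ solve 1 (λ S → con 9 :* (S :* S) :* (con 25 :* S)
            :+ (con 351 :* (S :* S :* S) :+ con 351 :* (S :* S :* S)) := con 927 :* (S :* S :* S)) ≡.refl S ⟩
      927 * (S * S * S) ∎
      where
      S T : ℕ
      S = ⌊√ H ⌋
      T = suc (2 * S) * (suc (2 * (4 * S)) * suc (2 * (6 * S)))
      product : ∀ (F : ℤ → ℤ × ℤ → Monic 4) →
        length (cartesianProductWith F (range S) (cartesianProduct (range (4 * S)) (range (6 * S)))) ≡ T
      product F = ≡.trans (length-cartesianProductWith F (range S)
          (cartesianProduct (range (4 * S)) (range (6 * S)))) (≡.cong₂ _*_ (length-range S)
        (≡.trans (length-cartesianProductWith _,_ (range (4 * S)) (range (6 * S)))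
            (≡.cong₂ _*_ (length-range (4 * S)) (length-range (6 * S)))))
      1≤S : 1 ≤ S
      1≤S = 1≤⌊√⌋ 1≤H
      1+2H≤9S² : suc (2 * H) ≤ 9 * (S * S)
      1+2H≤9S² = begin
        suc (2 * H)                        ≤⟨ ℕₚ.+-mono-≤ (ℕₚ.*-mono-≤ 1≤S 1≤S) (ℕₚ.*-monoʳ-≤ 2 (H≤4⌊√H⌋² 1≤H)) ⟩
        S * S + 2 * (4 * (S * S))          ≡⟨ solve 1 (λ x → x :+ con 2 :* (con 4 :* x) := con 9 :* x)
            ≡.refl (S * S) ⟩
        9 * (S * S)                        ∎
      13+12S≤25S : suc (2 * (6 * suc S)) ≤ 25 * S
      13+12S≤25S = begin
        suc (2 * (6 * suc S))              ≡⟨ solve 1 (λ S → con 1 :+ con 2 :* (con 6 :* (con 1 :+ S))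
            := con 13 :* con 1 :+ con 12 :* S) ≡.refl S ⟩
        13 * 1 + 12 * S                    ≤⟨ ℕₚ.+-monoˡ-≤ (12 * S) (ℕₚ.*-monoʳ-≤ 13 1≤S) ⟩
        13 * S + 12 * S                    ≡⟨ ℕₚ.*-distribʳ-+ S 13 12 ⟨
        25 * S                             ∎
      T≤351S³ : T ≤ 351 * (S * S * S)
      T≤351S³ = begin
        T                                                        ≤⟨ ℕₚ.*-mono-≤ (1+2n≤3n 1≤S)
            (ℕₚ.*-mono-≤ (ℕₚ.+-monoˡ-≤ (2 * (4 * S)) 1≤S) (ℕₚ.+-monoˡ-≤ (2 * (6 * S)) 1≤S)) ⟩
        3 * S * ((S + 2 * (4 * S)) * (S + 2 * (6 * S)))          ≡⟨ solve 1
            (λ S → con 3 :* S :* ((S :+ con 2 :* (con 4 :* S)) :* (S :+ con 2 :* (con 6 :* S)))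
                := con 351 :* (S :* S :* S)) ≡.refl S ⟩
        351 * (S * S * S)                                        ∎

    budget≥1 : ∀ {H n} → 1 ≤ H → n ≤ H → 1 ≤ budget H n
    budget≥1 {n = zero}  1≤H _   = 1≤H
    budget≥1 {n = suc n} 1≤H n≤H = DivMod.m≥n⇒m/n>0 n≤H

    length-slice : ∀ {H n} → 1 ≤ H → n ≤ H → length (slice H n) ≤ 48 * budget H n
    length-slice {H} {n} 1≤H n≤H = begin
      length (slice H n)
        ≡⟨ Listₚ.length-++ (List.map (multiply (+ n)) (cover₃ N)) ⟩
      length (List.map (multiply (+ n)) (cover₃ N)) + length (List.map (multiply (ℤ.- + n)) (cover₃ N))
        ≡⟨ ≡.cong₂ _+_ (Listₚ.length-map _ (cover₃ N)) (Listₚ.length-map _ (cover₃ N)) ⟩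
      length (cover₃ N) + length (cover₃ N)
        ≤⟨ ℕₚ.+-mono-≤ (length-cover₃ (budget≥1 1≤H n≤H)) (length-cover₃ (budget≥1 1≤H n≤H)) ⟩
      24 * N + 24 * N
        ≡⟨ ℕₚ.*-distribʳ-+ N 24 24 ⟨
      48 * N ∎
      where
      N : ℕ
      N = budget H n

    budget-dyadic : ∀ H i k → 2 ^ i ≤ k → budget H k ≤ (H / 2 ^ i) {{ℕₚ.m^n≢0 2 i}}
    budget-dyadic H i zero    2^i≤0 = ⊥-elim (ℕₚ.<⇒≱ (ℕₚ.m^n>0 2 i) 2^i≤0)
    budget-dyadic H i (suc k) 2^i≤k = DivMod./-monoʳ-≤ H {{_}} {{ℕₚ.m^n≢0 2 i}} 2^i≤k

    -- The harmonic sum: n = 0 and each of the L + 1 dyadic blocks contribute at most 48H, and L + 2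
    -- ≤ 3L.
    length-cover₄₃ : ∀ {H L} → 1 ≤ L → 1 ≤ H → H < 2 ^ suc L → length (cover₄₃ H) ≤ 144 * (H * L)
    length-cover₄₃ {H} {L} 1≤L 1≤H H<2^ = begin
      length (cover₄₃ H)                                 ≡⟨ length-slices (slice H) (suc H) ⟩
      sum< (λ n → length (slice H n)) (suc H)            ≤⟨ sum<-mono (suc H)
          (λ n n<1+H → length-slice 1≤H (ℕ.s≤s⁻¹ n<1+H)) ⟩
      sum< (λ n → 48 * budget H n) (suc H)               ≤⟨ sum<-monoʳ (λ n → 48 * budget H n) H<2^ ⟩
      sum< (λ n → 48 * budget H n) (2 ^ suc L)           ≤⟨ sum<-dyadic-≤ (λ n → 48 * budget H n) block (48 * H)
                                                              (λ i k 2^i≤k → ℕₚ.*-monoʳ-≤ 48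
                                                                  (budget-dyadic H i k 2^i≤k)) block≤ (suc L) ⟩
      48 * H + suc L * (48 * H)                          ≡⟨ solve 2 (λ H L → con 48 :* H
          :+ (con 1 :+ L) :* (con 48 :* H) := con 48 :* (H :* L) :+ con 96 :* (H :* con 1)) ≡.refl H L ⟩
      48 * (H * L) + 96 * (H * 1)                        ≤⟨ ℕₚ.+-monoʳ-≤ (48 * (H * L))
          (ℕₚ.*-monoʳ-≤ 96 (ℕₚ.*-monoʳ-≤ H 1≤L)) ⟩
      48 * (H * L) + 96 * (H * L)                        ≡⟨ ℕₚ.*-distribʳ-+ (H * L) 48 96 ⟨
      144 * (H * L)                                      ∎
      where
      block : ℕ → ℕ
      block i = 48 * (H / 2 ^ i) {{ℕₚ.m^n≢0 2 i}}
      block≤ : ∀ i → 2 ^ i * block i ≤ 48 * H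
      block≤ i = begin
        2 ^ i * (48 * (H / 2 ^ i) {{ℕₚ.m^n≢0 2 i}})     ≡⟨ solve 2 (λ x y → x :* (con 48 :* y)
            := con 48 :* (y :* x)) ≡.refl (2 ^ i) ((H / 2 ^ i) {{ℕₚ.m^n≢0 2 i}}) ⟩
        48 * ((H / 2 ^ i) {{ℕₚ.m^n≢0 2 i}} * 2 ^ i)     ≤⟨ ℕₚ.*-monoʳ-≤ 48
            (DivMod.m/n*n≤m H (2 ^ i) {{ℕₚ.m^n≢0 2 i}}) ⟩
        48 * H                                          ∎

-- Every counted polynomial lies in its cover.

module UpperBounds (em : ExcludedMiddle 0ℓ) (real : CompleteOrderedField) where
  open Classical em real hiding (zero)
  open Reals em real
  open Complex em real
  open MaximalRoots em real
  open Rationality em real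
  open SmallerRoot em real
  open RationalRoot em real
  open Counting using (Bounded; ∈-range⁺; ∈-box⁻; box-unique; ⌊√_⌋; <[1+⌊√⌋]²; square≤⇒≤⌊√⌋; ∈-slices⁺;
      length-filter-upper)
    renaming (square-cancel-≤ to ℕ-square-cancel-≤; square-cancel-< to ℕ-square-cancel-<)
  open Covers

  private
    module Z = IntegerRingSolver ℤₚ.+-*-commutativeRing
    module N = ℕSolver.+-*-Solver

  abstract

    square≤0 : ∀ {x y} → x * x ≤ y → y ≈ 0# → x ≈ 0#
    square≤0 {x} x²≤y y≈0 = square-zero (antisym (≤-respʳ y≈0 x²≤y) (square-nonNeg x))

    fromℤ-square-≤ : ∀ {i n} k → fromℤ i * fromℤ i ≤ fromℕ k * fromℕ n → ∣ i ∣ ℕ.* ∣ i ∣ ℕ.≤ k ℕ.* n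
    fromℤ-square-≤ {i} {n} k i²≤kn = fromℕ-cancel-≤ (≤-resp (fromℤ-square i) (sym (fromℕ-* k n)) i²≤kn)

    square≤⇒∣∣≤ : ∀ {i j} k → fromℤ i * fromℤ i ≤ fromℕ (k ℕ.* k) * (fromℤ j * fromℤ j) → ∣ i ∣ ℕ.≤ k ℕ.* ∣ j ∣
    square≤⇒∣∣≤ {i} {j} k i²≤k²j² = ℕ-square-cancel-≤ (ℕₚ.≤-trans
      (fromℤ-square-≤ {i} {∣ j ∣ ℕ.* ∣ j ∣} (k ℕ.* k) (≤-respʳ (*-congˡ (fromℤ-square j)) i²≤k²j²))
      (ℕₚ.≤-reflexive (N.solve 2 (λ k j → k N.:* k N.:* (j N.:* j) N.:= k N.:* j N.:* (k N.:* j)) ≡.refl k ∣ j ∣)))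

    square≤square*self : ∀ {m} → m ≢ 0 → m ℕ.* m ℕ.≤ m ℕ.* m ℕ.* m
    square≤square*self {zero}  m≢0 = ⊥-elim (m≢0 ≡.refl)
    square≤square*self {suc m} _   = ℕₚ.m≤m*n (suc m ℕ.* suc m) (suc m)

    ∣i∣≡∣j∣⇒i≡±j : ∀ i j → ∣ i ∣ ≡ ∣ j ∣ → i ≡ j ⊎ i ≡ ℤ.- j
    ∣i∣≡∣j∣⇒i≡±j (+ m)      (+ n)      ≡.refl = inj₁ ≡.refl
    ∣i∣≡∣j∣⇒i≡±j (+ m)      (-[1+ n ]) ≡.refl = inj₂ ≡.refl
    ∣i∣≡∣j∣⇒i≡±j (-[1+ m ]) (+ n)      ≡.refl = inj₂ ≡.refl
    ∣i∣≡∣j∣⇒i≡±j (-[1+ m ]) (-[1+ n ]) ≡.refl = inj₁ ≡.refl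

    nonzero-ℤ : ∀ {i} → i ≢ + 0 → ¬ (fromℤ i ≈ 0#)
    nonzero-ℤ i≢0 i≈0 = i≢0 (fromℤ-zero i≈0)

    -- For u ≠ 0 the rational number v/u is a cube root of w, hence an integer m.
    cubic∈cover : ∀ {N u v w R} → fromℤ w * fromℤ u ≈ R * fromℤ v → fromℤ w * fromℤ w ≈ R * R * R →
      fromℤ u * fromℤ u ≤ fromℕ 9 * R → fromℤ v * fromℤ v ≤ fromℕ 9 * (R * R) → ∣ w ∣ ℕ.≤ N →
      (w ∷ v ∷ u ∷ []) ∈ cover₃ N
    cubic∈cover {N} {u} {v} {w} {R} duality w²≈R³ u²≤9R v²≤9R² w≤N = byCases (u ℤₚ.≟ + 0)
      where
      U V W : ℝ
      U = fromℤ u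
      V = fromℤ v
      W = fromℤ w
      R≈0⇒ : ∀ {k} → R ≈ 0# → k * R ≈ 0#
      R≈0⇒ R≈0 = trans (*-congˡ R≈0) (zeroʳ _)
      byCases : Dec (u ≡ + 0) → (w ∷ v ∷ u ∷ []) ∈ cover₃ N
      -- The duality leaves Rv = 0, and if R = 0 the bound on v² gives v = 0.
      byCases (yes u≡0) = ≡.subst₂ (λ u v → (w ∷ v ∷ u ∷ []) ∈ cover₃ N) (≡.sym u≡0) (≡.sym v≡0)
        (∈ₚ.∈-++⁺ˡ (∈ₚ.∈-map⁺ (λ w → w ∷ + 0 ∷ + 0 ∷ []) (∈-range⁺ w≤N)))
        where
        RV≈0 : R * V ≈ 0#
        RV≈0 = trans (sym duality) (trans (*-congˡ (reflexive (≡.cong fromℤ u≡0))) (zeroʳ W))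
        V≈0 : R ≈ 0# ⊎ V ≈ 0# → V ≈ 0#
        V≈0 (inj₁ R≈0) = square≤0 v²≤9R² (trans (*-congˡ (R≈0⇒ R≈0)) (zeroʳ _))
        V≈0 (inj₂ V≈0) = V≈0
        v≡0 : v ≡ + 0
        v≡0 = fromℤ-zero (V≈0 (zero-product RV≈0))
      -- A root of X³ - w is a root of the quartic X⁴ - wX, so integrality of rational roots applies
      -- to v/u.
      byCases (no u≢0) = finish (rational-root-integral (+ 0) (+ 0) (ℤ.- w) (+ 0) root rational)
        where
        U≉0 : ¬ (U ≈ 0#)
        U≉0 = nonzero-ℤ u≢0
        R≉0 : ¬ (R ≈ 0#)
        R≉0 R≈0 = U≉0 (square≤0 u²≤9R (R≈0⇒ R≈0))
        x : ℝ
        x = V * U ⁻¹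
        xU≈V : U * x ≈ V
        xU≈V = combine₁ V (*-inverseʳ U U≉0)
            (solve 3 (λ u v i → u :* (v :* i) :- v := v :* (u :* i :- con 1)) U V (U ⁻¹))
        x³≈W : x * x * x ≈ W
        x³≈W = *-cancelˡ (*-nonZero (*-nonZero U≉0 U≉0) U≉0)
            (combine₂ (U * x * (U * x) + U * x * V + V * V) 1# xU≈V (cube-relation R≉0 duality w²≈R³)
          (solve 4 (λ u v w x → u :* u :* u :* (x :* x :* x) :- u :* u :* u :* w
            := (u :* x :* (u :* x) :+ u :* x :* v :+ v :* v) :* (u :* x :- v)
                :+ con 1 :* (v :* v :* v :- w :* (u :* u :* u))) U V W x))
        root : IsRoot (fromℤ (+ 0)) (fromℤ (+ 0)) (fromℤ (ℤ.- w)) (fromℤ (+ 0)) x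
        root = trans (+-congʳ (+-congˡ (*-congʳ (fromℤ-neg w)))) (combine₁ x x³≈W (solve 2 (λ x w →
          x :* x :* x :* x :+ con 0 :* (x :* x :* x) :+ con 0 :* (x :* x) :+ (:- w) :* x :+ con 0 :- con 0
          := x :* (x :* x :* x :- w)) x W))
        rational : Rational x
        rational = rational-solution (rational-ℤ u) (rational-neg (rational-ℤ v)) U≉0 (x≈y⇒x-y≈0 xU≈V)
        finish : (∃ λ m → x ≈ fromℤ m) → (w ∷ v ∷ u ∷ []) ∈ cover₃ N
        finish (m , x≈m) = ≡.subst₂ (λ w v → (w ∷ v ∷ u ∷ []) ∈ cover₃ N) m³≡w um≡v
          (∈ₚ.∈-++⁺ʳ (List.map (λ w → w ∷ + 0 ∷ + 0 ∷ []) (range N))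
            (∈ₚ.∈-cartesianProductWith⁺ _ (∈-range⁺ ∣m∣≤) (∈-range⁺ (ℕₚ.≤-trans ∣u∣≤3∣m∣ (ℕₚ.*-monoʳ-≤ 3 ∣m∣≤)))))
          where
          M : ℝ
          M = fromℤ m
          M³≈W : M * M * M ≈ W
          M³≈W = trans (sym (*-cong (*-cong x≈m x≈m) x≈m)) x³≈W
          UM≈V : U * M ≈ V
          UM≈V = trans (*-congˡ (sym x≈m)) xU≈V
          m³≡w : m ℤ.* m ℤ.* m ≡ w
          m³≡w = fromℤ-injective (trans (fromℤ-* (m ℤ.* m) m) (trans (*-congʳ (fromℤ-* m m)) M³≈W))
          um≡v : u ℤ.* m ≡ v
          um≡v = fromℤ-injective (trans (fromℤ-* u m) UM≈V)
          M≉0 : ¬ (M ≈ 0#)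
          M≉0 M≈0 = *-nonZero (*-nonZero R≉0 R≉0) R≉0
            (trans (sym w²≈R³) (trans (*-congʳ (trans (sym M³≈W) (trans (*-congˡ M≈0) (zeroʳ _)))) (zeroˡ W)))
          -- Substituting w = m³ and v = um into wu = Rv and cancelling um.
          R≈M² : R ≈ M * M
          R≈M² = *-cancelˡ (*-nonZero U≉0 M≉0) (combine₃ R (- U) (- 1#) UM≈V M³≈W duality (solve 5 (λ u v w m R →
            u :* m :* R :- u :* m :* (m :* m) := R :* (u :* m :- v) :+ (:- u) :* (m :* m :* m :- w)
                :+ (:- con 1) :* (w :* u :- R :* v)) U V W M R))
          ∣u∣≤3∣m∣ : ∣ u ∣ ℕ.≤ 3 ℕ.* ∣ m ∣
          ∣u∣≤3∣m∣ = square≤⇒∣∣≤ {u} {m} 3 (≤-respʳ (*-congˡ R≈M²) u²≤9R)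
          ∣m∣≢0 : ∣ m ∣ ≢ 0
          ∣m∣≢0 eq = M≉0 (reflexive (≡.cong fromℤ (ℤₚ.∣i∣≡0⇒i≡0 {m} eq)))
          ∣m∣≤ : ∣ m ∣ ℕ.≤ ⌊√ N ⌋
          ∣m∣≤ = square≤⇒≤⌊√⌋ N (ℕₚ.≤-trans (square≤square*self ∣m∣≢0) (ℕₚ.≤-trans (ℕₚ.≤-reflexive ∣m∣³≡∣w∣) w≤N))
            where
            ∣m∣³≡∣w∣ : ∣ m ∣ ℕ.* ∣ m ∣ ℕ.* ∣ m ∣ ≡ ∣ w ∣
            ∣m∣³≡∣w∣ = ≡.trans (≡.cong (ℕ._* ∣ m ∣) (≡.sym (ℤₚ.abs-* m m)))
                (≡.trans (≡.sym (ℤₚ.abs-* (m ℤ.* m) m)) (≡.cong ∣_∣ m³≡w))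

    D₃₃-upper : ∀ H → D 3 3 H ℕ.≤ length (cover₃ H)
    D₃₃-upper H = length-filter-upper (λ f → em {(height f ℕ.≤ H) × ExactlyMaximal 3 f}) (box-unique 3 H) covered
      where
      covered : ∀ {f} → f ∈ box 3 H → (height f ℕ.≤ H) × ExactlyMaximal 3 f → f ∈ cover₃ H
      covered {w ∷ v ∷ u ∷ []} f∈ (_ , αs@(α ∷ β ∷ γ ∷ []) , roots , maximal)
        with Nα ∷ Nβ ∷ Nγ ∷ [] ← all-maximal αs maximal | w≤H ∷ _ ← ∈-box⁻ {f = w ∷ v ∷ u ∷ []} f∈ =
        let r = roots⇒roots₃ {w} {v} {u} roots in
        cubic∈cover (cubic-duality r Nα Nβ Nγ) (cubic-constant r Nα Nβ Nγ)
          (proj₁ (cubic-bounds r Nα Nβ Nγ)) (proj₂ (cubic-bounds r Nα Nβ Nγ)) w≤H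

    -- For a ≠ 0 the rational number c/a is a square root of |d|, hence an integer m.
    quartic∈cover : ∀ {H a b c d R} → 0# ≤ R → fromℤ d * fromℤ a ≈ R * fromℤ c → fromℤ d * fromℤ d ≈ R * R * R * R →
      fromℤ a * fromℤ a ≤ fromℕ 16 * R → fromℤ b * fromℤ b ≤ fromℕ 36 * (R * R)
          → fromℤ c * fromℤ c ≤ fromℕ 16 * (R * R * R) →
      ∣ d ∣ ℕ.≤ H → (d ∷ c ∷ b ∷ a ∷ []) ∈ cover₄₄ H
    quartic∈cover {H} {a} {b} {c} {d} {R} 0≤R duality d²≈R⁴ a²≤16R b²≤36R² c²≤16R³ d≤H = byCases (a ℤₚ.≟ + 0)
      where
      A B C E : ℝ
      A = fromℤ a
      B = fromℤ b
      C = fromℤ c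
      E = fromℤ d
      R²≈∣d∣ : R * R ≈ fromℕ ∣ d ∣
      R²≈∣d∣ = square-injective (square-nonNeg R) (fromℕ-nonNeg ∣ d ∣)
        (trans (sym (*-assoc (R * R) R R)) (trans (sym d²≈R⁴) (trans (fromℤ-square d) (fromℕ-* ∣ d ∣ ∣ d ∣))))
      byCases : Dec (a ≡ + 0) → (d ∷ c ∷ b ∷ a ∷ []) ∈ cover₄₄ H
      byCases (yes a≡0) = ≡.subst₂ (λ a c → (d ∷ c ∷ b ∷ a ∷ []) ∈ cover₄₄ H) (≡.sym a≡0) (≡.sym c≡0)
        (∈ₚ.∈-++⁺ˡ (∈ₚ.∈-cartesianProductWith⁺ _ (∈-range⁺ d≤H) (∈-range⁺ (ℕₚ.<⇒≤ ∣b∣<))))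
        where
        RC≈0 : R * C ≈ 0#
        RC≈0 = trans (sym duality) (trans (*-congˡ (reflexive (≡.cong fromℤ a≡0))) (zeroʳ E))
        C≈0 : R ≈ 0# ⊎ C ≈ 0# → C ≈ 0#
        C≈0 (inj₁ R≈0) = square≤0 c²≤16R³ (trans (*-congˡ (trans (*-congˡ R≈0) (zeroʳ _))) (zeroʳ _))
        C≈0 (inj₂ C≈0) = C≈0
        c≡0 : c ≡ + 0
        c≡0 = fromℤ-zero (C≈0 (zero-product RC≈0))
        ∣b∣< : ∣ b ∣ ℕ.< 6 ℕ.* suc ⌊√ H ⌋
        ∣b∣< = ℕ-square-cancel-< (ℕₚ.≤-<-trans
          (ℕₚ.≤-trans (fromℤ-square-≤ {b} {∣ d ∣} 36 (≤-respʳ (*-congˡ R²≈∣d∣) b²≤36R²)) (ℕₚ.*-monoʳ-≤ 36 d≤H))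
          (ℕₚ.<-≤-trans (ℕₚ.*-monoʳ-< 36 (<[1+⌊√⌋]² H))
            (ℕₚ.≤-reflexive (N.solve 1 (λ s → N.con 36 N.:* (s N.:* s) N.:= N.con 6 N.:* s N.:* (N.con 6 N.:* s))
                ≡.refl (suc ⌊√ H ⌋)))))
      -- The quotient x = c/a satisfies x² = R² = |d| and so is a root of X⁴ - |d|X².
      byCases (no a≢0) = finish (rational-root-integral (+ 0) (ℤ.- + ∣ d ∣) (+ 0) (+ 0) root rational)
        where
        A≉0 : ¬ (A ≈ 0#)
        A≉0 = nonzero-ℤ a≢0
        R≉0 : ¬ (R ≈ 0#)
        R≉0 R≈0 = A≉0 (square≤0 a²≤16R (trans (*-congˡ R≈0) (zeroʳ _)))
        x : ℝ
        x = C * A ⁻¹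
        Ax≈C : A * x ≈ C
        Ax≈C = combine₁ C (*-inverseʳ A A≉0)
            (solve 3 (λ u v i → u :* (v :* i) :- v := v :* (u :* i :- con 1)) A C (A ⁻¹))
        E≈Rx : E ≈ R * x
        E≈Rx = *-cancelˡ A≉0 (combine₂ 1# (- R) duality Ax≈C (solve 5 (λ a c d R x →
          a :* d :- a :* (R :* x) := con 1 :* (d :* a :- R :* c) :+ (:- R) :* (a :* x :- c)) A C E R x))
        x²≈R² : x * x ≈ R * R
        x²≈R² = *-cancelˡ (*-nonZero R≉0 R≉0) (combine₂ 1# (- (E + R * x)) d²≈R⁴ E≈Rx (solve 3 (λ d R x →
          R :* R :* (x :* x) :- R :* R :* (R :* R) := con 1 :* (d :* d :- R :* R :* R :* R)
              :+ (:- (d :+ R :* x)) :* (d :- R :* x)) E R x))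
        root : IsRoot (fromℤ (+ 0)) (fromℤ (ℤ.- + ∣ d ∣)) (fromℤ (+ 0)) (fromℤ (+ 0)) x
        root = trans (+-congʳ (+-congʳ (+-congˡ (*-congʳ (fromℤ-neg (+ ∣ d ∣))))))
            (combine₁ (x * x) (trans x²≈R² R²≈∣d∣) (solve 2 (λ x d →
          x :* x :* x :* x :+ con 0 :* (x :* x :* x) :+ (:- d) :* (x :* x) :+ con 0 :* x :+ con 0 :- con 0
          := x :* x :* (x :* x :- d)) x (fromℕ ∣ d ∣)))
        rational : Rational x
        rational = rational-solution (rational-ℤ a) (rational-neg (rational-ℤ c)) A≉0 (x≈y⇒x-y≈0 Ax≈C)
        finish : (∃ λ m → x ≈ fromℤ m) → (d ∷ c ∷ b ∷ a ∷ []) ∈ cover₄₄ H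
        finish (m , x≈m) = ≡.subst (λ c → (d ∷ c ∷ b ∷ a ∷ []) ∈ cover₄₄ H) am≡c
            (signed (∣i∣≡∣j∣⇒i≡±j d (m ℤ.* m) ∣d∣≡∣m²∣))
          where
          M : ℝ
          M = fromℤ m
          am≡c : a ℤ.* m ≡ c
          am≡c = fromℤ-injective (trans (fromℤ-* a m) (trans (*-congˡ (sym x≈m)) Ax≈C))
          M²≈R² : M * M ≈ R * R
          M²≈R² = trans (sym (*-cong x≈m x≈m)) x²≈R²
          ∣m∣²≡∣d∣ : ∣ m ∣ ℕ.* ∣ m ∣ ≡ ∣ d ∣
          ∣m∣²≡∣d∣ = ℤₚ.+-injective (fromℤ-injective {+ (∣ m ∣ ℕ.* ∣ m ∣)} {+ ∣ d ∣}
              (trans (sym (fromℤ-square m)) (trans M²≈R² R²≈∣d∣)))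
          ∣d∣≡∣m²∣ : ∣ d ∣ ≡ ∣ m ℤ.* m ∣
          ∣d∣≡∣m²∣ = ≡.trans (≡.sym ∣m∣²≡∣d∣) (≡.sym (ℤₚ.abs-* m m))
          R≈∣m∣ : R ≈ fromℕ ∣ m ∣
          R≈∣m∣ = square-injective 0≤R (fromℕ-nonNeg ∣ m ∣)
              (trans (sym M²≈R²) (trans (fromℤ-square m) (fromℕ-* ∣ m ∣ ∣ m ∣)))
          ∣m∣≤∣m∣² : ∣ m ∣ ℕ.≤ ∣ m ∣ ℕ.* ∣ m ∣
          ∣m∣≤∣m∣² with ∣ m ∣
          ... | zero  = z≤n
          ... | suc n = ℕₚ.m≤m*n (suc n) (suc n)
          -- The bound a² ≤ 16R = 16|m| is weakened to 16m².
          ∣a∣≤4∣m∣ : ∣ a ∣ ℕ.≤ 4 ℕ.* ∣ m ∣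
          ∣a∣≤4∣m∣ = ℕ-square-cancel-≤ (ℕₚ.≤-trans (fromℤ-square-≤ {a} {∣ m ∣} 16 (≤-respʳ (*-congˡ R≈∣m∣) a²≤16R))
            (ℕₚ.≤-trans (ℕₚ.*-monoʳ-≤ 16 ∣m∣≤∣m∣²)
              (ℕₚ.≤-reflexive (N.solve 1 (λ s → N.con 16 N.:* (s N.:* s) N.:= N.con 4 N.:* s N.:* (N.con 4 N.:* s))
                  ≡.refl ∣ m ∣))))
          ∣b∣≤6∣m∣ : ∣ b ∣ ℕ.≤ 6 ℕ.* ∣ m ∣
          ∣b∣≤6∣m∣ = square≤⇒∣∣≤ {b} {m} 6 (≤-respʳ (*-congˡ (sym M²≈R²)) b²≤36R²)
          ∣m∣≤ : ∣ m ∣ ℕ.≤ ⌊√ H ⌋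
          ∣m∣≤ = square≤⇒≤⌊√⌋ H (ℕₚ.≤-trans (ℕₚ.≤-reflexive ∣m∣²≡∣d∣) d≤H)
          pair∈ : (a , b) ∈ cartesianProduct (range (4 ℕ.* ⌊√ H ⌋)) (range (6 ℕ.* ⌊√ H ⌋))
          pair∈ = ∈ₚ.∈-cartesianProduct⁺ (∈-range⁺ (ℕₚ.≤-trans ∣a∣≤4∣m∣ (ℕₚ.*-monoʳ-≤ 4 ∣m∣≤)))
            (∈-range⁺ (ℕₚ.≤-trans ∣b∣≤6∣m∣ (ℕₚ.*-monoʳ-≤ 6 ∣m∣≤)))
          signed : d ≡ m ℤ.* m ⊎ d ≡ ℤ.- (m ℤ.* m) → (d ∷ a ℤ.* m ∷ b ∷ a ∷ []) ∈ cover₄₄ H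
          signed (inj₁ d≡) = ≡.subst (λ d → (d ∷ a ℤ.* m ∷ b ∷ a ∷ []) ∈ cover₄₄ H) (≡.sym d≡)
            (∈ₚ.∈-++⁺ʳ (cartesianProductWith _ (range H) (range (6 ℕ.* suc ⌊√ H ⌋)))
              (∈ₚ.∈-++⁺ˡ (∈ₚ.∈-cartesianProductWith⁺ _ (∈-range⁺ ∣m∣≤) pair∈)))
          signed (inj₂ d≡) = ≡.subst (λ d → (d ∷ a ℤ.* m ∷ b ∷ a ∷ []) ∈ cover₄₄ H) (≡.sym d≡)
            (∈ₚ.∈-++⁺ʳ (cartesianProductWith _ (range H) (range (6 ℕ.* suc ⌊√ H ⌋)))
              (∈ₚ.∈-++⁺ʳ (cartesianProductWith _ (range ⌊√ H ⌋)
                  (cartesianProduct (range (4 ℕ.* ⌊√ H ⌋)) (range (6 ℕ.* ⌊√ H ⌋))))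
                (∈ₚ.∈-cartesianProductWith⁺ _ (∈-range⁺ ∣m∣≤) pair∈)))

    D₄₄-upper : ∀ H → D 4 4 H ℕ.≤ length (cover₄₄ H)
    D₄₄-upper H = length-filter-upper (λ f → em {(height f ℕ.≤ H) × ExactlyMaximal 4 f}) (box-unique 4 H) covered
      where
      covered : ∀ {f} → f ∈ box 4 H → (height f ℕ.≤ H) × ExactlyMaximal 4 f → f ∈ cover₄₄ H
      covered {d ∷ c ∷ b ∷ a ∷ []} f∈ (_ , αs@(α ∷ β ∷ γ ∷ δ ∷ []) , roots , maximal)
        with Nα ∷ Nβ ∷ Nγ ∷ Nδ ∷ [] ← all-maximal αs maximal | d≤H ∷ _ ← ∈-box⁻ {f = d ∷ c ∷ b ∷ a ∷ []} f∈ =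
        let r = roots⇒roots₄ {d} {c} {b} {a} roots
            a² , b² , c² = quartic-bounds r Nα Nβ Nγ Nδ
        in quartic∈cover (square-nonNeg (maxModulus αs)) (quartic-duality r Nα Nβ Nγ Nδ)
            (quartic-constant r Nα Nβ Nγ Nδ) a² b² c² d≤H

    ≤-budget : ∀ {H W} n → (n ≡ 0 → W ℕ.≤ H) → n ℕ.* W ℕ.≤ H → W ℕ.≤ budget H n
    ≤-budget zero            W≤H _    = W≤H ≡.refl
    ≤-budget {H} {W} (suc n) _   nW≤H = ℕₚ.≤-trans (ℕₚ.≤-reflexive (≡.sym (DivMod.m*n/n≡m W (suc n))))
      (DivMod./-monoˡ-≤ (suc n) (ℕₚ.≤-trans (ℕₚ.≤-reflexive (ℕₚ.*-comm W (suc n))) nW≤H))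

    -- As t is an integer k, synthetic division keeps u, v, w integral. Then |k||w| = |d| ≤ H bounds
    -- |w| for k ≠ 0, and bounds |k| by H because w ≠ 0; for k = 0 one has w = c.
    split∈cover : ∀ {H a b c d} (f : Split (fromℤ a) (fromℤ b) (fromℤ c) (fromℤ d)) → ∣ c ∣ ℕ.≤ H → ∣ d ∣ ℕ.≤ H →
      (d ∷ c ∷ b ∷ a ∷ []) ∈ cover₄₃ H
    split∈cover {H} {a} {b} {c} {d} f c≤H d≤H = finish (smaller-root-integral a b c d f)
      where
      open Split f
      finish : (∃ λ k → t ≈ fromℤ k) → (d ∷ c ∷ b ∷ a ∷ []) ∈ cover₄₃ H
      finish (k , t≈k) = ∈-slices⁺ {k = ∣ k ∣} (s≤s (∣k∣≤H k d≡))
          (≡.subst (_∈ slice H ∣ k ∣) f≡ (∈-slice k (cubic∈cover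
          (trans (*-cong (sym w≈w₀) (sym u≈u₀)) (trans duality (*-congˡ v≈v₀)))
          (trans (*-cong (sym w≈w₀) (sym w≈w₀)) w²≈R³)
          (≤-respˡ (*-cong u≈u₀ u≈u₀) u²≤9R) (≤-respˡ (*-cong v≈v₀ v≈v₀) v²≤9R²) ∣w∣≤budget)))
        where
        u₀ v₀ w₀ : ℤ
        u₀ = a ℤ.+ k
        v₀ = b ℤ.+ k ℤ.* u₀
        w₀ = c ℤ.+ k ℤ.* v₀
        times : ∀ {x i} → x ≈ fromℤ i → t * x ≈ fromℤ (k ℤ.* i)
        times {i = i} x≈i = trans (*-cong t≈k x≈i) (sym (fromℤ-* k i))
        u≈u₀ : u ≈ fromℤ u₀
        u≈u₀ = trans u≈ (trans (+-congˡ t≈k) (sym (fromℤ-+ a k)))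
        v≈v₀ : v ≈ fromℤ v₀
        v≈v₀ = trans v≈ (trans (+-congˡ (times u≈u₀)) (sym (fromℤ-+ b (k ℤ.* u₀))))
        w≈w₀ : w ≈ fromℤ w₀
        w≈w₀ = trans w≈ (trans (+-congˡ (times v≈v₀)) (sym (fromℤ-+ c (k ℤ.* v₀))))
        d≡ : d ≡ ℤ.- (k ℤ.* w₀)
        d≡ = fromℤ-injective (trans constant (trans (-‿cong (times w≈w₀)) (sym (fromℤ-neg (k ℤ.* w₀)))))
        add-sub : ∀ i j → i ℤ.+ j ℤ.- j ≡ i
        add-sub = Z.solve 2 (λ i j → i :+ j :- j := i)
        f≡ : multiply k (w₀ ∷ v₀ ∷ u₀ ∷ []) ≡ d ∷ c ∷ b ∷ a ∷ []
        f≡ = ≡.cong₂ _∷_ (≡.sym d≡) (≡.cong₂ _∷_ (add-sub c (k ℤ.* v₀))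
            (≡.cong₂ _∷_ (add-sub b (k ℤ.* u₀)) (≡.cong₂ _∷_ (add-sub a k) ≡.refl)))
        ∣w₀∣≢0 : ∣ w₀ ∣ ≢ 0
        ∣w₀∣≢0 eq = CircleRoots.w≉0 f (trans w≈w₀ (reflexive (≡.cong fromℤ (ℤₚ.∣i∣≡0⇒i≡0 {w₀} eq))))
        ∣d∣≡ : ∀ k → d ≡ ℤ.- (k ℤ.* w₀) → ∣ k ∣ ℕ.* ∣ w₀ ∣ ≡ ∣ d ∣
        ∣d∣≡ k d≡ = ≡.sym (≡.trans (≡.cong ∣_∣ d≡) (≡.trans (ℤₚ.∣-i∣≡∣i∣ (k ℤ.* w₀)) (ℤₚ.abs-* k w₀)))
        ∣k∣≤H : ∀ k → d ≡ ℤ.- (k ℤ.* w₀) → ∣ k ∣ ℕ.≤ H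
        ∣k∣≤H k d≡ = ℕₚ.≤-trans (ℕₚ.m≤m*n ∣ k ∣ ∣ w₀ ∣ {{ℕ.≢-nonZero ∣w₀∣≢0}})
            (ℕₚ.≤-trans (ℕₚ.≤-reflexive (∣d∣≡ k d≡)) d≤H)
        ∣w∣≤budget : ∣ w₀ ∣ ℕ.≤ budget H ∣ k ∣
        ∣w∣≤budget = ≤-budget ∣ k ∣
          (λ ∣k∣≡0 → ℕₚ.≤-trans (ℕₚ.≤-reflexive (≡.cong ∣_∣
            (≡.trans (≡.cong (λ k → c ℤ.+ k ℤ.* v₀) (ℤₚ.∣i∣≡0⇒i≡0 {k} ∣k∣≡0)) (ℤₚ.+-identityʳ c)))) c≤H)
          (ℕₚ.≤-trans (ℕₚ.≤-reflexive (∣d∣≡ k d≡)) d≤H)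
        ∈-slice : ∀ k {g} → g ∈ cover₃ (budget H ∣ k ∣) → multiply k g ∈ slice H ∣ k ∣
        ∈-slice (+ n)      g∈ = ∈ₚ.∈-++⁺ˡ (∈ₚ.∈-map⁺ (multiply (+ n)) g∈)
        ∈-slice (-[1+ n ]) g∈ = ∈ₚ.∈-++⁺ʳ (List.map (multiply (+ suc n)) (cover₃ (budget H (suc n))))
            (∈ₚ.∈-map⁺ (multiply (-[1+ n ])) g∈)

    D₄₃-upper : ∀ H → D 4 3 H ℕ.≤ length (cover₄₃ H)
    D₄₃-upper H = length-filter-upper (λ f → em {(height f ℕ.≤ H) × ExactlyMaximal 3 f}) (box-unique 4 H) covered
      where
      covered : ∀ {f} → f ∈ box 4 H → (height f ℕ.≤ H) × ExactlyMaximal 3 f → f ∈ cover₄₃ H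
      covered {d ∷ c ∷ b ∷ a ∷ []} f∈ (_ , (α ∷ β ∷ γ ∷ δ ∷ []) , roots , maximal)
        with d≤H ∷ c≤H ∷ _ ← ∈-box⁻ {f = d ∷ c ∷ b ∷ a ∷ []} f∈ =
        split∈cover (split (one-smaller (roots⇒roots₄ {d} {c} {b} {a} roots) maximal)) c≤H d≤H

-- Explicit families of polynomials for the lower bounds, and their sizes.

module Families where
  open import Data.Nat.Base using (_+_; _*_; _^_; _∸_; _/_; _≤_; _<_; ⌊_/2⌋; ⌈_/2⌉)
  open Counting
  open Covers using (budget)
  open ℕₚ.≤-Reasoning
  open ℕSolver.+-*-Solver using (solve; con; _:+_; _:*_; _:=_)

  pure-cubic : ℕ → Monic 3
  pure-cubic w = + w ∷ + 0 ∷ + 0 ∷ []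

  biquadratic : ℕ → ℕ → Monic 4
  biquadratic d b = + d ∷ + 0 ∷ + b ∷ + 0 ∷ []

  -- (X - k)(X³ + w)
  pure-quartic : ℕ → ℕ → Monic 4
  pure-quartic k w = ℤ.- + (k * w) ∷ + w ∷ + 0 ∷ ℤ.- + k ∷ []

  family₃₃ : ℕ → List (Monic 3)
  family₃₃ H = List.map (λ i → pure-cubic (suc i)) (upTo H)

  -- Here b² ≤ H ≤ 2d.
  family₄₄ : ℕ → List (Monic 4)
  family₄₄ H = cartesianProductWith (λ i b → biquadratic (⌈ H /2⌉ + i) b) (upTo (suc ⌊ H /2⌋)) (upTo (suc ⌊√ H ⌋))

  -- The number of w with k³ < w ≤ H and kw ≤ H.
  room : ℕ → ℕ → ℕ
  room H k = budget H k ∸ k * k * k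

  -- Starting w at k³ + 1 places the root k strictly inside the circle of the cube roots of -w.
  row : ℕ → ℕ → List (Monic 4)
  row H k = List.map (λ i → pure-quartic k (suc (k * k * k + i))) (upTo (room H k))

  family₄₃ : ℕ → ℕ → List (Monic 4)
  family₄₃ H j = slices (row H) (2 ^ j)

  abstract

    family₃₃-unique : ∀ H → Unique (family₃₃ H)
    family₃₃-unique H = Uniqueₚ.map⁺ (λ eq → ℕₚ.suc-injective (ℤₚ.+-injective (Vecₚ.∷-injectiveˡ eq)))
        (Uniqueₚ.upTo⁺ H)

    length-family₃₃ : ∀ H → length (family₃₃ H) ≡ H
    length-family₃₃ H = ≡.trans (Listₚ.length-map _ (upTo H)) (Listₚ.length-upTo H)

    ∈-family₃₃⁻ : ∀ {H f} → f ∈ family₃₃ H → ∃ λ w → w ≤ H × f ≡ pure-cubic w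
    ∈-family₃₃⁻ f∈ with ∈ₚ.∈-map⁻ _ f∈
    ... | i , i∈ , f≡ = suc i , ∈ₚ.∈-upTo⁻ i∈ , f≡

    family₄₄-unique : ∀ H → Unique (family₄₄ H)
    family₄₄-unique H = Uniqueₚ.cartesianProductWith⁺ (λ i b → biquadratic (⌈ H /2⌉ + i) b)
      (λ eq → ℕₚ.+-cancelˡ-≡ ⌈ H /2⌉ _ _ (ℤₚ.+-injective (Vecₚ.∷-injectiveˡ eq)) ,
        ℤₚ.+-injective (Vecₚ.∷-injectiveˡ (Vecₚ.∷-injectiveʳ (Vecₚ.∷-injectiveʳ eq))))
      (Uniqueₚ.upTo⁺ (suc ⌊ H /2⌋)) (Uniqueₚ.upTo⁺ (suc ⌊√ H ⌋))

    ∈-family₄₄⁻ : ∀ {H f} → f ∈ family₄₄ H → ∃₂ λ d b → d ≤ H × b ≤ H × b * b ≤ 4 * d × f ≡ biquadratic d b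
    ∈-family₄₄⁻ {H} f∈ with ∈ₚ.∈-cartesianProductWith⁻ _ (upTo (suc ⌊ H /2⌋)) (upTo (suc ⌊√ H ⌋)) f∈
    ... | i , b , i∈ , b∈ , f≡ = ⌈ H /2⌉ + i , b , d≤H , ℕₚ.≤-trans (m≤m² b) b²≤H , ℕₚ.≤-trans b²≤H H≤4d , f≡
      where
      m≤m² : ∀ m → m ≤ m * m
      m≤m² zero    = z≤n
      m≤m² (suc m) = ℕₚ.m≤m*n (suc m) (suc m)
      b≤S : b ≤ ⌊√ H ⌋
      b≤S = ℕ.s≤s⁻¹ (∈ₚ.∈-upTo⁻ b∈)
      b²≤H : b * b ≤ H
      b²≤H = ℕₚ.≤-trans (ℕₚ.*-mono-≤ b≤S b≤S) (⌊√⌋²≤ H)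
      d≤H : ⌈ H /2⌉ + i ≤ H
      d≤H = begin
        ⌈ H /2⌉ + i           ≤⟨ ℕₚ.+-monoʳ-≤ ⌈ H /2⌉ (ℕ.s≤s⁻¹ (∈ₚ.∈-upTo⁻ i∈)) ⟩
        ⌈ H /2⌉ + ⌊ H /2⌋     ≡⟨ ℕₚ.+-comm ⌈ H /2⌉ ⌊ H /2⌋ ⟩
        ⌊ H /2⌋ + ⌈ H /2⌉     ≡⟨ ℕₚ.⌊n/2⌋+⌈n/2⌉≡n H ⟩
        H                     ∎
      H≤4d : H ≤ 4 * (⌈ H /2⌉ + i)
      H≤4d = begin
        H                           ≡⟨ ℕₚ.⌊n/2⌋+⌈n/2⌉≡n H ⟨
        ⌊ H /2⌋ + ⌈ H /2⌉           ≤⟨ ℕₚ.+-monoˡ-≤ ⌈ H /2⌉ (ℕₚ.⌊n/2⌋≤⌈n/2⌉ H) ⟩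
        ⌈ H /2⌉ + ⌈ H /2⌉           ≤⟨ ℕₚ.m≤m+n _ _ ⟩
        ⌈ H /2⌉ + ⌈ H /2⌉ + (⌈ H /2⌉ + ⌈ H /2⌉ + 4 * i)   ≡⟨ solve 2 (λ h i → h :+ h :+ (h :+ h :+ con 4 :* i)
            := con 4 :* (h :+ i)) ≡.refl ⌈ H /2⌉ i ⟩
        4 * (⌈ H /2⌉ + i)           ∎

    -- There are ⌊H/2⌋ + 1 ≥ H/2 values of d and ⌊√H⌋ + 1 values of b. The factor 8 matches the
    -- estimate of √(H³) by 8⌊√H⌋³.
    length-family₄₄ : ∀ H → 8 * (⌊√ H ⌋ * ⌊√ H ⌋ * ⌊√ H ⌋) ≤ 16 * length (family₄₄ H)
    length-family₄₄ H = begin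
      8 * (S * S * S)                       ≤⟨ ℕₚ.*-monoʳ-≤ 8
          (ℕₚ.*-mono-≤ (ℕₚ.≤-trans (⌊√⌋²≤ H) H≤2[1+⌊H/2⌋]) (ℕₚ.n≤1+n S)) ⟩
      8 * (2 * suc ⌊ H /2⌋ * suc S)         ≡⟨ solve 2 (λ x y → con 8 :* (con 2 :* x :* y) := con 16 :* (x :* y))
          ≡.refl (suc ⌊ H /2⌋) (suc S) ⟩
      16 * (suc ⌊ H /2⌋ * suc S)            ≡⟨ ≡.cong (16 *_)
          (≡.trans (length-cartesianProductWith _ (upTo (suc ⌊ H /2⌋)) (upTo (suc S)))
                                                (≡.cong₂ _*_ (Listₚ.length-upTo (suc ⌊ H /2⌋))
                                                    (Listₚ.length-upTo (suc S)))) ⟨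
      16 * length (family₄₄ H)              ∎
      where
      S : ℕ
      S = ⌊√ H ⌋
      H≤2[1+⌊H/2⌋] : H ≤ 2 * suc ⌊ H /2⌋
      H≤2[1+⌊H/2⌋] = begin
        H                                   ≡⟨ ℕₚ.⌊n/2⌋+⌈n/2⌉≡n H ⟨
        ⌊ H /2⌋ + ⌈ H /2⌉                   ≤⟨ ℕₚ.+-mono-≤ (ℕₚ.n≤1+n ⌊ H /2⌋) (ℕₚ.⌊n/2⌋-mono (ℕₚ.n≤1+n (suc H))) ⟩
        suc ⌊ H /2⌋ + suc ⌊ H /2⌋           ≡⟨ 2*≡+ (suc ⌊ H /2⌋) ⟩
        2 * suc ⌊ H /2⌋                     ∎

    -- The coefficient -k of X³ determines the row, and the coefficient w of X the place in it.
    family₄₃-unique : ∀ H j → Unique (family₄₃ H j)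
    family₄₃-unique H j = slices-unique key keyed
      (λ k → Uniqueₚ.map⁺ (λ eq → ℕₚ.+-cancelˡ-≡ (k * k * k) _ _
        (ℕₚ.suc-injective (ℤₚ.+-injective (Vecₚ.∷-injectiveˡ (Vecₚ.∷-injectiveʳ eq))))) (Uniqueₚ.upTo⁺ _)) (2 ^ j)
      where
      key : Monic 4 → ℕ
      key (_ ∷ _ ∷ _ ∷ a ∷ []) = ∣ a ∣
      keyed : ∀ {k f} → f ∈ row H k → key f ≡ k
      keyed {k} f∈ with _ , _ , ≡.refl ← ∈ₚ.∈-map⁻ (λ i → pure-quartic k (suc (k * k * k + i))) f∈
          = ℤₚ.∣-i∣≡∣i∣ (+ k)

    ≤-budget⇒*≤ : ∀ {H w} k → w ≤ budget H k → k * w ≤ H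
    ≤-budget⇒*≤         zero    _   = z≤n
    ≤-budget⇒*≤ {H} {w} (suc k) w≤B = begin
      suc k * w              ≡⟨ ℕₚ.*-comm (suc k) w ⟩
      w * suc k              ≤⟨ ℕₚ.*-monoˡ-≤ (suc k) w≤B ⟩
      H / suc k * suc k      ≤⟨ DivMod.m/n*n≤m H (suc k) ⟩
      H                      ∎

    budget≤ : ∀ H k → budget H k ≤ H
    budget≤ H zero    = ℕₚ.≤-refl
    budget≤ H (suc k) = DivMod.m/n≤m H (suc k)

    ∈-family₄₃⁻ : ∀ {H j f} → f ∈ family₄₃ H j →
      ∃₂ λ k w → k * w ≤ H × w ≤ H × k ≤ H × k * k * k < w × f ≡ pure-quartic k w
    ∈-family₄₃⁻ {H} {j} f∈ with ∈-slices⁻ (row H) (2 ^ j) f∈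
    ... | k , _ , f∈row with ∈ₚ.∈-map⁻ (λ i → pure-quartic k (suc (k * k * k + i))) f∈row
    ...   | i , i∈ , f≡ = k , suc (k * k * k + i) , kw≤H , ℕₚ.≤-trans w≤budget (budget≤ H k) ,
      ℕₚ.≤-trans (ℕₚ.m≤m*n k (suc (k * k * k + i))) kw≤H , s≤s (ℕₚ.m≤m+n _ i) , f≡
      where
      i<room : i < room H k
      i<room = ∈ₚ.∈-upTo⁻ i∈
      w≤budget : suc (k * k * k + i) ≤ budget H k
      w≤budget = begin
        suc (k * k * k + i)          ≡⟨ ℕₚ.+-suc (k * k * k) i ⟨
        k * k * k + suc i            ≤⟨ ℕₚ.+-monoʳ-≤ (k * k * k) i<room ⟩
        k * k * k + room H k         ≡⟨ ℕₚ.m+[n∸m]≡n {k * k * k}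
            (ℕₚ.<⇒≤ (ℕₚ.m∸n≢0⇒n<m {budget H k} {k * k * k} λ room≡0 → ℕₚ.n≮0 (≡.subst (i <_) room≡0 i<room))) ⟩
        budget H k                   ∎
      kw≤H : k * suc (k * k * k + i) ≤ H
      kw≤H = ≤-budget⇒*≤ k w≤budget

    -- With q = 2ⁱ⁺¹ and 2q⁴ ≤ H the rows k < q have at least ⌊H/q⌋ + 1 - q³ > H/2q elements each.
    length-family₄₃ : ∀ {H L} → 1 ≤ L → 2 ^ L ≤ H → ∃ λ j → H * L ≤ 16 * length (family₄₃ H j)
    length-family₄₃ {H} {suc l} _ 2^L≤H = j , (begin
      H * suc l                                       ≤⟨ ℕₚ.*-monoʳ-≤ H L≤16+4j ⟩
      H * (16 + 4 * j)                                ≡⟨ solve 2 (λ H j → H :* (con 16 :+ con 4 :* j)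
          := con 4 :* (con 4 :* H :+ j :* H)) ≡.refl H j ⟩
      4 * (4 * room H 0 + j * H)                      ≤⟨ ℕₚ.*-monoʳ-≤ 4
          (sum<-dyadic-≥ (room H) block H j block≤room H≤block) ⟩
      4 * (4 * sum< (room H) (2 ^ j))                 ≡⟨ ℕₚ.*-assoc 4 4 (sum< (room H) (2 ^ j)) ⟨
      16 * sum< (room H) (2 ^ j)                      ≡⟨ ≡.cong (16 *_)
          (≡.trans (length-slices (row H) (2 ^ j)) (sum<-cong (2 ^ j)
                                                          (λ k → ≡.trans (Listₚ.length-map _ (upTo (room H k)))
                                                              (Listₚ.length-upTo (room H k))))) ⟨
      16 * length (family₄₃ H j)                      ∎)
      where
      -- For i < j this choice gives 4(i + 1) ≤ l, hence 2q⁴ = 2^(4(i+1)+1) ≤ 2^(l+1) ≤ H with q =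
      -- 2^(i+1).
      j : ℕ
      j = l / 4
      sum<-cong : ∀ {g h : ℕ → ℕ} n → (∀ k → g k ≡ h k) → sum< g n ≡ sum< h n
      sum<-cong zero    g≡h = ≡.refl
      sum<-cong (suc n) g≡h = ≡.cong₂ _+_ (sum<-cong n g≡h) (g≡h n)
      -- The additive constant is paid for by the row k = 0, which has H elements.
      L≤16+4j : suc l ≤ 16 + 4 * j
      L≤16+4j = begin
        suc l                   ≡⟨ ≡.cong suc (DivMod.m≡m%n+[m/n]*n l 4) ⟩
        suc (l ℕ.% 4 + j * 4)   ≤⟨ ℕₚ.+-monoˡ-≤ (j * 4) (DivMod.m%n<n l 4) ⟩
        4 + j * 4               ≤⟨ ℕₚ.+-mono-≤ (ℕₚ.m≤m+n 4 12) (ℕₚ.≤-reflexive (ℕₚ.*-comm j 4)) ⟩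
        16 + 4 * j              ∎
      q : ℕ → ℕ
      q i = 2 ^ suc i
      W : ℕ → ℕ
      W i = (H / q i) {{ℕₚ.m^n≢0 2 (suc i)}}
      q³ : ℕ → ℕ
      q³ i = q i * q i * q i
      block : ℕ → ℕ
      block i = suc (W i) ∸ q³ i
      q≤ : ∀ i → i < j → 2 * (q³ i * q i) ≤ H
      q≤ i i<j = begin
        2 * (q³ i * q i)        ≡⟨ ≡.cong (2 *_)
            (≡.trans (solve 1 (λ q → q :* q :* q :* q := q :* (q :* (q :* (q :* con 1)))) ≡.refl (q i))
                (ℕₚ.^-*-assoc 2 (suc i) 4)) ⟩
        2 ^ suc (suc i * 4)     ≤⟨ ℕₚ.^-monoʳ-≤ 2 (s≤s (ℕₚ.≤-trans (ℕₚ.*-monoˡ-≤ 4 i<j) (DivMod.m/n*n≤m l 4))) ⟩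
        2 ^ suc l               ≤⟨ 2^L≤H ⟩
        H                       ∎
      2q³≤W : ∀ i → i < j → 2 * q³ i ≤ W i
      2q³≤W i i<j = begin
        2 * q³ i                                                 ≡⟨ DivMod.m*n/n≡m (2 * q³ i) (q i)
            {{ℕₚ.m^n≢0 2 (suc i)}} ⟨
        (2 * q³ i * q i / q i) {{ℕₚ.m^n≢0 2 (suc i)}}            ≤⟨ DivMod./-monoˡ-≤ (q i) {{ℕₚ.m^n≢0 2 (suc i)}}
            (ℕₚ.≤-trans (ℕₚ.≤-reflexive (ℕₚ.*-assoc 2 (q³ i) (q i))) (q≤ i i<j)) ⟩
        W i                                                      ∎
      W≤budget : ∀ i k → k < q i → W i ≤ budget H k
      W≤budget i zero    _   = DivMod.m/n≤m H (q i) {{ℕₚ.m^n≢0 2 (suc i)}}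
      W≤budget i (suc k) k<q = DivMod./-monoʳ-≤ H {{ℕₚ.m^n≢0 2 (suc i)}} (ℕₚ.<⇒≤ k<q)
      block≤room : ∀ i k → i < j → k < q i → block i ≤ room H k
      block≤room i k _ k<q = begin
        -- Strictness k³ + 1 ≤ q³ absorbs the successor.
        suc (W i) ∸ q³ i              ≤⟨ ℕₚ.∸-monoʳ-≤ (suc (W i)) (ℕₚ.*-mono-< (ℕₚ.*-mono-< k<q k<q) k<q) ⟩
        W i ∸ k * k * k               ≤⟨ ℕₚ.∸-monoˡ-≤ (k * k * k) (W≤budget i k k<q) ⟩
        room H k                      ∎
      H<q[1+W] : ∀ i → H ≤ q i * suc (W i)
      H<q[1+W] i = begin
        H                                                             ≡⟨ DivMod.m≡m%n+[m/n]*n H (q i)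
            {{ℕₚ.m^n≢0 2 (suc i)}} ⟩
        (H ℕ.% q i) {{ℕₚ.m^n≢0 2 (suc i)}} + W i * q i                ≤⟨ ℕₚ.+-monoˡ-≤ (W i * q i)
            (DivMod.m%n≤n H (q i) {{ℕₚ.m^n≢0 2 (suc i)}}) ⟩
        q i + W i * q i                                               ≡⟨ ℕₚ.*-comm (suc (W i)) (q i) ⟩
        q i * suc (W i)                                               ∎
      1+W≤2block : ∀ i → i < j → suc (W i) ≤ 2 * block i
      1+W≤2block i i<j = begin
        suc (W i)                                 ≡⟨ ℕₚ.m+n∸n≡m (suc (W i)) (suc (W i)) ⟨
        suc (W i) + suc (W i) ∸ suc (W i)         ≤⟨ ℕₚ.∸-monoʳ-≤ (suc (W i) + suc (W i))
            (ℕₚ.m≤n⇒m≤1+n (2q³≤W i i<j)) ⟩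
        suc (W i) + suc (W i) ∸ 2 * q³ i          ≡⟨ ≡.cong (_∸ 2 * q³ i) (2*≡+ (suc (W i))) ⟩
        2 * suc (W i) ∸ 2 * q³ i                  ≡⟨ ℕₚ.*-distribˡ-∸ 2 (suc (W i)) (q³ i) ⟨
        2 * block i                               ∎
      H≤block : ∀ i → i < j → H ≤ 4 * (2 ^ i * block i)
      H≤block i i<j = begin
        H                             ≤⟨ H<q[1+W] i ⟩
        q i * suc (W i)               ≤⟨ ℕₚ.*-monoʳ-≤ (q i) (1+W≤2block i i<j) ⟩
        2 * 2 ^ i * (2 * block i)     ≡⟨ solve 2 (λ x y → con 2 :* x :* (con 2 :* y) := con 4 :* (x :* y)) ≡.refl
            (2 ^ i) (block i) ⟩
        4 * (2 ^ i * block i)         ∎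

-- Explicit roots of the members of the families.

module LowerBounds (em : ExcludedMiddle 0ℓ) (real : CompleteOrderedField) where
  open Classical em real hiding (zero)
  open Reals em real
  open Roots em real
  open Complex em real
  open MaximalRoots em real
  open Counting using (Bounded; ∈-box⁺; height≤; length-filter-lower)
  open Families

  private
    module S = ℂSolver

    -- Complex expressions as pairs of real ones, so that the solver over ℝ, with hypotheses on real
    -- parameters, can verify Viète's formulas componentwise.
    ℂₑ : ℕ → Set
    ℂₑ n = Expr n × Expr n

    infixl 6 _⊕_
    infixl 7 _⊗_

    _⊕_ _⊗_ : ∀ {n} → ℂₑ n → ℂₑ n → ℂₑ n
    (a , b) ⊕ (c , d) = a :+ c , b :+ d
    (a , b) ⊗ (c , d) = a :* c :- b :* d , a :* d :+ b :* c

    ⊝ : ∀ {n} → ℂₑ n → ℂₑ n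
    ⊝ (a , b) = :- a , :- b

  abstract

    height-bounded : ∀ {n H} {f : Monic n} → 1 ℕ.≤ H → Bounded H f → f ∈ box n H × height f ℕ.≤ H
    height-bounded 1≤H f≤H = ∈-box⁺ f≤H , height≤ 1≤H f≤H

  -- The roots -s and s(1 ± √-3)/2 of X³ + s³, with τ = √3/2.
  module CubeRoots {w s τ : ℝ} (0≤s : 0# ≤ s) (s³≈w : s * s * s ≈ w) (τ²≈ : τ * τ ≈ fromℕ 3 * (half * half)) where

    α β γ : ℂ
    α = realℂ (- s)
    β = (half * s) +i (τ * s)
    γ = (half * s) +i (- (τ * s))

    abstract

      cube-roots : Roots₃ 0# 0# w α β γ
      cube-roots = roots₃
        (combine₁ s 2*half (solve 3 (λ h s τ → con 0 :- proj₁ (⊝ (αₑ h s τ ⊕ βₑ h s τ ⊕ γₑ h s τ))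
            := s :* (con 2 :* h :- con 1)) half s τ) ,
         solve 3 (λ h s τ → con 0 := proj₂ (⊝ (αₑ h s τ ⊕ βₑ h s τ ⊕ γₑ h s τ))) half s τ)
        (combine₂ (- (fromℕ 2 * half * s * s)) (- (s * s)) 2*half τ²≈ (solve 3 (λ h s τ → let α = αₑ h s τ; β = βₑ h s τ; γ = γₑ h s τ in
           con 0 :- proj₁ (α ⊗ β ⊕ α ⊗ γ ⊕ β ⊗ γ)
           := (:- (con 2 :* h :* s :* s)) :* (con 2 :* h :- con 1)
               :+ (:- (s :* s)) :* (τ :* τ :- con 3 :* (h :* h))) half s τ) ,
         solve 3 (λ h s τ → let α = αₑ h s τ; β = βₑ h s τ; γ = γₑ h s τ in con 0
             := proj₂ (α ⊗ β ⊕ α ⊗ γ ⊕ β ⊗ γ)) half s τ)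
        (combine₃ (- 1#) (- (s * s * s * (fromℕ 2 * half + 1#))) (- (s * s * s)) s³≈w 2*half τ²≈ (solve 4 (λ h s τ w → let α = αₑ h s τ; β = βₑ h s τ; γ = γₑ h s τ in
           w :- proj₁ (⊝ (α ⊗ β ⊗ γ))
           := (:- con 1) :* (s :* s :* s :- w)
               :+ (:- (s :* s :* s :* (con 2 :* h :+ con 1))) :* (con 2 :* h :- con 1)
             :+ (:- (s :* s :* s)) :* (τ :* τ :- con 3 :* (h :* h))) half s τ w) ,
         solve 3 (λ h s τ → let α = αₑ h s τ; β = βₑ h s τ; γ = γₑ h s τ in con 0
             := proj₂ (⊝ (α ⊗ β ⊗ γ))) half s τ)
        where
        αₑ βₑ γₑ : ∀ {n} → Expr n → Expr n → Expr n → ℂₑ n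
        αₑ h s τ = :- s , con 0
        βₑ h s τ = h :* s , τ :* s
        γₑ h s τ = h :* s , :- (τ :* s)

      cube-root-norms : All (λ z → norm z ≈ s * s) (α ∷ β ∷ γ ∷ [])
      cube-root-norms =
        solve 1 (λ s → (:- s) :* (:- s) :+ con 0 :* con 0 := s :* s) s ∷
        combine₂ (s * s * (fromℕ 2 * half + 1#)) (s * s) 2*half τ²≈ (solve 3 (λ h s τ →
          h :* s :* (h :* s) :+ τ :* s :* (τ :* s) :- s :* s
          := s :* s :* (con 2 :* h :+ con 1) :* (con 2 :* h :- con 1) :+ s :* s :* (τ :* τ :- con 3 :* (h :* h)))
              half s τ) ∷
        combine₂ (s * s * (fromℕ 2 * half + 1#)) (s * s) 2*half τ²≈ (solve 3 (λ h s τ →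
          h :* s :* (h :* s) :+ (:- (τ :* s)) :* (:- (τ :* s)) :- s :* s
          := s :* s :* (con 2 :* h :+ con 1) :* (con 2 :* h :- con 1) :+ s :* s :* (τ :* τ :- con 3 :* (h :* h)))
              half s τ) ∷ []

  abstract

    sqrt3/2 : ∃ λ τ → 0# ≤ τ × τ * τ ≈ fromℕ 3 * (half * half)
    sqrt3/2 = square-root (*-nonNeg (fromℕ-nonNeg 3) (square-nonNeg half))

    pure-cubic-maximal : ∀ w → ExactlyMaximal 3 (pure-cubic w)
    pure-cubic-maximal w with s , 0≤s , s³≈w ← cube-root (fromℕ-nonNeg w) with τ , _ , τ²≈ ← sqrt3/2 =
      α ∷ β ∷ γ ∷ [] , roots₃⇒roots {+ w} {+ 0} {+ 0} cube-roots
          , equal-norms-maximal {αs = α ∷ β ∷ γ ∷ []} 0≤s cube-root-norms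
      where open CubeRoots 0≤s s³≈w τ²≈

    extend-roots : ∀ {w k α β γ} → Roots₃ 0# 0# w α β γ → Roots₄ (- k) 0# w (- (k * w)) (realℂ k) α β γ
    extend-roots {w} {k} {α} {β} {γ} (roots₃ e₁ e₂ e₃) = roots₄
      (≈ℂ-trans (realℂ-neg k) (S.combine₁ (realℂ 1#) e₁ (S.solve 4 (λ k α β γ →
        :- k :- (:- (k :+ α :+ β :+ γ)) := con 1 :* (con 0 :- (:- (α :+ β :+ γ)))) K α β γ)))
      (S.combine₂ (realℂ 1#) (-ᶜ K) e₂ e₁ (S.solve 4 (λ k α β γ →
        con 0 :- (k :* α :+ k :* β :+ k :* γ :+ α :* β :+ α :* γ :+ β :* γ)
        := con 1 :* (con 0 :- (α :* β :+ α :* γ :+ β :* γ)) :+ (:- k) :* (con 0 :- (:- (α :+ β :+ γ)))) K α β γ))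
      (S.combine₂ (realℂ 1#) (-ᶜ K) e₃ e₂ (S.solve 5 (λ k w α β γ →
        w :- (:- (k :* α :* β :+ k :* α :* γ :+ k :* β :* γ :+ α :* β :* γ))
        := con 1 :* (w :- (:- (α :* β :* γ))) :+ (:- k) :* (con 0 :- (α :* β :+ α :* γ :+ β :* γ))) K
            (realℂ w) α β γ))
      (≈ℂ-trans (realℂ-neg (k * w)) (≈ℂ-trans (-ℂ-cong (realℂ-* k w))
          (S.combine₁ (-ᶜ K) e₃ (S.solve 5 (λ k w α β γ →
        :- (k :* w) :- k :* α :* β :* γ := (:- k) :* (w :- (:- (α :* β :* γ)))) K (realℂ w) α β γ))))
      where
      K : ℂ
      K = realℂ k

    roots₄-cong : ∀ {a b c d a′ b′ c′ d′ α β γ δ} → a′ ≈ a → b′ ≈ b → c′ ≈ c → d′ ≈ d →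
      Roots₄ a b c d α β γ δ → Roots₄ a′ b′ c′ d′ α β γ δ
    roots₄-cong a≈ b≈ c≈ d≈ (roots₄ e₁ e₂ e₃ e₄) = roots₄ (≈ℂ-trans (realℂ-cong a≈) e₁)
        (≈ℂ-trans (realℂ-cong b≈) e₂)
      (≈ℂ-trans (realℂ-cong c≈) e₃) (≈ℂ-trans (realℂ-cong d≈) e₄)

    pure-quartic-maximal : ∀ k w → k ℕ.* k ℕ.* k ℕ.< w → ExactlyMaximal 3 (pure-quartic k w)
    pure-quartic-maximal k w k³<w with s , 0≤s , s³≈w ← cube-root (fromℕ-nonNeg w) with τ , _ , τ²≈ ← sqrt3/2 =
      realℂ (fromℕ k) ∷ α ∷ β ∷ γ ∷ [] ,
      roots₄⇒roots {ℤ.- + (k ℕ.* w)} {+ w} {+ 0} {ℤ.- + k}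
        (roots₄-cong (fromℤ-neg (+ k)) refl refl (trans (fromℤ-neg (+ (k ℕ.* w))) (-‿cong (fromℕ-* k w)))
            (extend-roots cube-roots)) ,
      one-smaller-maximal {β = realℂ (fromℕ k)} {αs = α ∷ β ∷ γ ∷ []} (fromℕ-nonNeg k) k<s (norm-realℂ (fromℕ k))
          cube-root-norms
      where
      open CubeRoots 0≤s s³≈w τ²≈
      -- Otherwise w = s³ ≤ k³.
      k<s : fromℕ k < s
      k<s = ≰⇒> λ s≤k → ℕₚ.<⇒≱ k³<w (fromℕ-cancel-≤ (≤-resp s³≈w
        (sym (trans (fromℕ-* (k ℕ.* k) k) (*-congʳ (fromℕ-* k k))))
        (*-mono-≤ 0≤s (square-nonNeg (fromℕ k)) (square-mono-≤ 0≤s s≤k) s≤k)))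

  -- X⁴ + bX² + q² = (X² - 2pX + q)(X² + 2pX + q) with roots ±p ± im.
  module BiquadraticRoots {b d q p m : ℝ} (q²≈d : q * q ≈ d)
    (p²≈ : p * p ≈ half * half * (fromℕ 2 * q - b)) (m²≈ : m * m ≈ half * half * (fromℕ 2 * q + b)) where

    α β γ δ : ℂ
    α = p +i m
    β = p +i (- m)
    γ = (- p) +i m
    δ = (- p) +i (- m)

    abstract

      p²+m²≈q : p * p + m * m ≈ q
      p²+m²≈q = combine₃ 1# 1# (q * (fromℕ 2 * half + 1#)) p²≈ m²≈ 2*half (solve 5 (λ p m q b h →
        p :* p :+ m :* m :- q := con 1 :* (p :* p :- h :* h :* (con 2 :* q :- b))
            :+ con 1 :* (m :* m :- h :* h :* (con 2 :* q :+ b))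
          :+ q :* (con 2 :* h :+ con 1) :* (con 2 :* h :- con 1)) p m q b half)

      biquadratic-roots : Roots₄ 0# b 0# d α β γ δ
      biquadratic-roots = roots₄
        (solve 2 (λ p m → con 0 := proj₁ (⊝ (αₑ p m ⊕ βₑ p m ⊕ γₑ p m ⊕ δₑ p m))) p m ,
         solve 2 (λ p m → con 0 := proj₂ (⊝ (αₑ p m ⊕ βₑ p m ⊕ γₑ p m ⊕ δₑ p m))) p m)
        (combine₃ (fromℕ 2) (- fromℕ 2) (- (b * (fromℕ 2 * half + 1#))) p²≈ m²≈ 2*half (solve 5 (λ p m q b h →
          b :- proj₁ (e₂ p m) := con 2 :* (p :* p :- h :* h :* (con 2 :* q :- b))
              :+ (:- con 2) :* (m :* m :- h :* h :* (con 2 :* q :+ b))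
            :+ (:- (b :* (con 2 :* h :+ con 1))) :* (con 2 :* h :- con 1)) p m q b half) ,
         solve 2 (λ p m → con 0 := proj₂ (e₂ p m)) p m)
        (solve 2 (λ p m → con 0 := proj₁ (e₃ p m)) p m , solve 2 (λ p m → con 0 := proj₂ (e₃ p m)) p m)
        (combine₂ (- 1#) (- (p * p + m * m + q)) q²≈d p²+m²≈q (solve 4 (λ p m q d →
          d :- proj₁ (αₑ p m ⊗ βₑ p m ⊗ γₑ p m ⊗ δₑ p m) := (:- con 1) :* (q :* q :- d)
              :+ (:- (p :* p :+ m :* m :+ q)) :* (p :* p :+ m :* m :- q)) p m q d) ,
         solve 2 (λ p m → con 0 := proj₂ (αₑ p m ⊗ βₑ p m ⊗ γₑ p m ⊗ δₑ p m)) p m)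
        where
        αₑ βₑ γₑ δₑ e₂ e₃ : ∀ {n} → Expr n → Expr n → ℂₑ n
        αₑ p m = p , m
        βₑ p m = p , :- m
        γₑ p m = :- p , m
        δₑ p m = :- p , :- m
        e₂ p m = let α = αₑ p m; β = βₑ p m; γ = γₑ p m; δ = δₑ p m in
          α ⊗ β ⊕ α ⊗ γ ⊕ α ⊗ δ ⊕ β ⊗ γ ⊕ β ⊗ δ ⊕ γ ⊗ δ
        e₃ p m = let α = αₑ p m; β = βₑ p m; γ = γₑ p m; δ = δₑ p m in
          ⊝ (α ⊗ β ⊗ γ ⊕ α ⊗ β ⊗ δ ⊕ α ⊗ γ ⊗ δ ⊕ β ⊗ γ ⊗ δ)

      biquadratic-norms : All (λ z → norm z ≈ q) (α ∷ β ∷ γ ∷ δ ∷ [])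
      biquadratic-norms = p²+m²≈q ∷
        trans (solve 2 (λ p m → p :* p :+ (:- m) :* (:- m) := p :* p :+ m :* m) p m) p²+m²≈q ∷
        trans (solve 2 (λ p m → (:- p) :* (:- p) :+ m :* m := p :* p :+ m :* m) p m) p²+m²≈q ∷
        trans (solve 2 (λ p m → (:- p) :* (:- p) :+ (:- m) :* (:- m) := p :* p :+ m :* m) p m) p²+m²≈q ∷ []

  abstract

    -- With q = √d the hypothesis reads b² ≤ (2q)², which makes p² = (2q - b)/4 nonnegative, as m² =
    -- (2q + b)/4 is anyway. All four roots then have modulus r = √q.
    biquadratic-maximal : ∀ d b → b ℕ.* b ℕ.≤ 4 ℕ.* d → ExactlyMaximal 4 (biquadratic d b)
    biquadratic-maximal d b b²≤4d
      with q , 0≤q , q²≈d ← square-root (fromℕ-nonNeg d)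
      with r , 0≤r , r²≈q ← square-root 0≤q
      with p , _ , p²≈ ← square-root (*-nonNeg (square-nonNeg half) (≤⇒0≤- (square-cancel-≤
             (*-nonNeg (fromℕ-nonNeg 2) 0≤q)
             (≤-resp (fromℕ-* b b) (trans (fromℕ-* 4 d) (combine₁ (- fromℕ 4) q²≈d (solve 2 (λ q d →
               con 4 :* d :- con 2 :* q :* (con 2 :* q) := (:- con 4) :* (q :* q :- d)) q (fromℕ d))))
               (fromℕ-mono-≤ b²≤4d)))))
      with m , _ , m²≈ ← square-root
          (*-nonNeg (square-nonNeg half) (+-nonNeg (*-nonNeg (fromℕ-nonNeg 2) 0≤q) (fromℕ-nonNeg b))) =
      α ∷ β ∷ γ ∷ δ ∷ [] , roots₄⇒roots {+ d} {+ 0} {+ b} {+ 0} biquadratic-roots ,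
      equal-norms-maximal {αs = α ∷ β ∷ γ ∷ δ ∷ []} 0≤r (All.map (λ Nz≈q → trans Nz≈q (sym r²≈q)) biquadratic-norms)
      where open BiquadraticRoots q²≈d p²≈ m²≈

    D₃₃-lower : ∀ {H} → 1 ℕ.≤ H → length (family₃₃ H) ℕ.≤ D 3 3 H
    D₃₃-lower {H} 1≤H = length-filter-lower (λ f → em {(height f ℕ.≤ H) × ExactlyMaximal 3 f})
        (family₃₃-unique H) good
      where
      good : ∀ {f} → f ∈ family₃₃ H → f ∈ box 3 H × (height f ℕ.≤ H) × ExactlyMaximal 3 f
      good f∈ with w , w≤H , ≡.refl ← ∈-family₃₃⁻ f∈ =
        let inBox , small = height-bounded 1≤H (w≤H ∷ z≤n ∷ z≤n ∷ []) in inBox , small , pure-cubic-maximal w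

    D₄₄-lower : ∀ {H} → 1 ℕ.≤ H → length (family₄₄ H) ℕ.≤ D 4 4 H
    D₄₄-lower {H} 1≤H = length-filter-lower (λ f → em {(height f ℕ.≤ H) × ExactlyMaximal 4 f})
        (family₄₄-unique H) good
      where
      good : ∀ {f} → f ∈ family₄₄ H → f ∈ box 4 H × (height f ℕ.≤ H) × ExactlyMaximal 4 f
      good f∈ with d , b , d≤H , b≤H , b²≤4d , ≡.refl ← ∈-family₄₄⁻ {H} f∈ =
        let inBox , small = height-bounded 1≤H (d≤H ∷ z≤n ∷ b≤H ∷ z≤n ∷ []) in inBox , small
            , biquadratic-maximal d b b²≤4d

    D₄₃-lower : ∀ {H} j → 1 ℕ.≤ H → length (family₄₃ H j) ℕ.≤ D 4 3 H
    D₄₃-lower {H} j 1≤H = length-filter-lower (λ f → em {(height f ℕ.≤ H) × ExactlyMaximal 3 f})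
        (family₄₃-unique H j) good
      where
      ∣-n∣≤ : ∀ {n} → n ℕ.≤ H → ∣ ℤ.- + n ∣ ℕ.≤ H
      ∣-n∣≤ {n} n≤H = ≡.subst (ℕ._≤ H) (≡.sym (ℤₚ.∣-i∣≡∣i∣ (+ n))) n≤H
      good : ∀ {f} → f ∈ family₄₃ H j → f ∈ box 4 H × (height f ℕ.≤ H) × ExactlyMaximal 3 f
      good f∈ with k , w , kw≤H , w≤H , k≤H , k³<w , ≡.refl ← ∈-family₄₃⁻ {H} {j} f∈ =
        let inBox , small = height-bounded 1≤H (∣-n∣≤ kw≤H ∷ w≤H ∷ z≤n ∷ ∣-n∣≤ k≤H ∷ []) in
        inBox , small , pure-quartic-maximal k w k³<w

-- Passage from integer estimates to real constants.

module Asymptotics (em : ExcludedMiddle 0ℓ) (real : CompleteOrderedField) where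
  open Classical em real hiding (zero)
  open Reals em real
  open Roots em real
  open Logarithms em real
  open UpperBounds em real
  open LowerBounds em real
  open Counting using (⌊√_⌋; ⌊√⌋²≤; log₂-bracket)
  open Covers using (length-cover₃; length-cover₄₄; length-cover₄₃; H≤4⌊√H⌋²)
  open Families using (length-family₃₃; length-family₄₄; length-family₄₃)

  private
    module N = ℕSolver.+-*-Solver

  -- 32 = 2 · 16 combines log H ≤ 2L with the factor 16 in the size of the family for three maximal
  -- roots. 927 is the constant of the cover for four maximal roots. Both also serve the remaining
  -- bounds.
  c₁ c₂ : ℝ
  c₁ = fromℕ 32 ⁻¹
  c₂ = fromℕ 927

  abstract

    c₁>0 : 0# < c₁
    c₁>0 = ⁻¹-pos (fromℕ-pos {32} (s≤s z≤n))

    c₂>0 : 0# < c₂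
    c₂>0 = fromℕ-pos {927} (s≤s z≤n)

    c₁*≤ : ∀ {x} n → x ≤ fromℕ (32 ℕ.* n) → c₁ * x ≤ fromℕ n
    c₁*≤ {x} n x≤32n = ≤-respʳ (combine₁ (fromℕ n) (*-inverseʳ (fromℕ 32) (>⇒≉0 (fromℕ-pos {32} (s≤s z≤n))))
        (solve 2 (λ n i → i :* (con 32 :* n) :- n := n :* (con 32 :* i :- con 1)) (fromℕ n) c₁))
      (*-monoˡ-≤ (<⇒≤ c₁>0) (≤-respʳ (fromℕ-* 32 n) x≤32n))

    ≤c₂* : ∀ {n m} → n ℕ.≤ 927 ℕ.* m → fromℕ n ≤ c₂ * fromℕ m
    ≤c₂* {n} {m} n≤927m = ≤-respʳ (fromℕ-* 927 m) (fromℕ-mono-≤ n≤927m)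

    fromℕ^3-nonNeg : ∀ n → 0# ≤ fromℕ n ^ 3
    fromℕ^3-nonNeg n = ^-nonNeg (fromℕ-nonNeg n) 3

    -- With S = ⌊√H⌋, cubing H ≤ 4S² gives H³ ≤ 64S⁶ = (8S³)².
    √H³≤8⌊√H⌋³ : ∀ {H} → 1 ℕ.≤ H → √ (fromℕ H ^ 3) ≤ fromℕ (8 ℕ.* (⌊√ H ⌋ ℕ.* ⌊√ H ⌋ ℕ.* ⌊√ H ⌋))
    √H³≤8⌊√H⌋³ {H} 1≤H = √-upper (fromℕ^3-nonNeg H) (fromℕ-nonNeg N)
      (≤-resp (fromℕ-^ H 3) (fromℕ-* N N) (fromℕ-mono-≤ H³≤N²))
      where
      S N : ℕ
      S = ⌊√ H ⌋
      N = 8 ℕ.* (S ℕ.* S ℕ.* S)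
      H³≤N² : H ℕ.^ 3 ℕ.≤ N ℕ.* N
      H³≤N² = ℕₚ.≤-trans (ℕₚ.^-monoˡ-≤ 3 (H≤4⌊√H⌋² 1≤H)) (ℕₚ.≤-reflexive (N.solve 1 (λ S →
        let Q = N.con 4 N.:* (S N.:* S); M = N.con 8 N.:* (S N.:* S N.:* S) in
        Q N.:* (Q N.:* (Q N.:* N.con 1)) N.:= M N.:* M) ≡.refl S))

    ⌊√H⌋³≤√H³ : ∀ H → fromℕ (⌊√ H ⌋ ℕ.* ⌊√ H ⌋ ℕ.* ⌊√ H ⌋) ≤ √ (fromℕ H ^ 3)
    ⌊√H⌋³≤√H³ H = √-lower (fromℕ^3-nonNeg H) (≤-resp (fromℕ-* M M) (fromℕ-^ H 3) (fromℕ-mono-≤ M²≤H³))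
      where
      S M : ℕ
      S = ⌊√ H ⌋
      M = S ℕ.* S ℕ.* S
      M²≤H³ : M ℕ.* M ℕ.≤ H ℕ.^ 3
      M²≤H³ = ℕₚ.≤-trans (ℕₚ.≤-reflexive (N.solve 1 (λ S →
          let Q = S N.:* S; M = S N.:* S N.:* S in M N.:* M N.:= Q N.:* (Q N.:* (Q N.:* N.con 1))) ≡.refl S))
        (ℕₚ.^-monoˡ-≤ 3 (⌊√⌋²≤ H))

    D₃₃-bounds : ∀ H → 1 ℕ.≤ H → (c₁ * fromℕ H ≤ fromℕ (D 3 3 H)) × (fromℕ (D 3 3 H) ≤ c₂ * fromℕ H)
    D₃₃-bounds H 1≤H =
      c₁*≤ (D 3 3 H) (fromℕ-mono-≤ (ℕₚ.≤-trans H≤D (ℕₚ.m≤n*m (D 3 3 H) 32))) ,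
      ≤c₂* {D 3 3 H} {H} (ℕₚ.≤-trans (ℕₚ.≤-trans (D₃₃-upper H) (length-cover₃ 1≤H))
          (ℕₚ.*-monoˡ-≤ H (ℕₚ.m≤m+n 24 903)))
      where
      H≤D : H ℕ.≤ D 3 3 H
      H≤D = ℕₚ.≤-trans (ℕₚ.≤-reflexive (≡.sym (length-family₃₃ H))) (D₃₃-lower 1≤H)

    D₄₄-bounds : ∀ H → 1 ℕ.≤ H → (c₁ * √ (fromℕ H ^ 3) ≤ fromℕ (D 4 4 H)) × (fromℕ (D 4 4 H) ≤ c₂ * √ (fromℕ H ^ 3))
    D₄₄-bounds H 1≤H =
      c₁*≤ (D 4 4 H) (≤-trans (√H³≤8⌊√H⌋³ 1≤H) (fromℕ-mono-≤ (ℕₚ.≤-trans (length-family₄₄ H)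
        (ℕₚ.*-mono-≤ (ℕₚ.m≤m+n 16 16) (D₄₄-lower 1≤H))))) ,
      ≤-trans (≤c₂* {D 4 4 H} {⌊√ H ⌋ ℕ.* ⌊√ H ⌋ ℕ.* ⌊√ H ⌋} (ℕₚ.≤-trans (D₄₄-upper H) (length-cover₄₄ 1≤H)))
          (*-monoˡ-≤ (<⇒≤ c₂>0) (⌊√H⌋³≤√H³ H))

    D₄₃-bounds : ∀ H → 2 ℕ.≤ H → ∀ ℓ → IsLog (fromℕ H) ℓ →
      (c₁ * (fromℕ H * ℓ) ≤ fromℕ (D 4 3 H)) × (fromℕ (D 4 3 H) ≤ c₂ * (fromℕ H * ℓ))
    D₄₃-bounds H 2≤H ℓ isLog with L , 2^L≤H , H<2^1+L ← log₂-bracket (ℕₚ.<⇒≤ 2≤H) = lower , upper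
      where
      1≤H : 1 ℕ.≤ H
      1≤H = ℕₚ.<⇒≤ 2≤H
      1≤L : 1 ℕ.≤ L
      1≤L = ℕₚ.n≢0⇒n>0 λ L≡0 → ℕₚ.<⇒≱ H<2^1+L (≡.subst (λ L → 2 ℕ.^ suc L ℕ.≤ H) (≡.sym L≡0) 2≤H)
      ℓ≤2L : ℓ ≤ fromℕ (2 ℕ.* L)
      ℓ≤2L = ≤-trans (log-upper {L = L} isLog H<2^1+L) (fromℕ-mono-≤ {suc L} {2 ℕ.* L}
        (ℕₚ.+-mono-≤ 1≤L (ℕₚ.≤-reflexive (≡.sym (ℕₚ.+-identityʳ L)))))
      H*2L≤32D : H ℕ.* (2 ℕ.* L) ℕ.≤ 32 ℕ.* D 4 3 H
      H*2L≤32D with j , HL≤16 ← length-family₄₃ {H} {L} 1≤L 2^L≤H = ℕₚ.≤-trans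
        (ℕₚ.≤-reflexive (N.solve 2 (λ H L → H N.:* (N.con 2 N.:* L) N.:= N.con 2 N.:* (H N.:* L)) ≡.refl H L))
        (ℕₚ.≤-trans (ℕₚ.*-monoʳ-≤ 2 (ℕₚ.≤-trans HL≤16 (ℕₚ.*-monoʳ-≤ 16 (D₄₃-lower j 1≤H))))
          (ℕₚ.≤-reflexive (≡.sym (ℕₚ.*-assoc 2 16 (D 4 3 H)))))
      lower : c₁ * (fromℕ H * ℓ) ≤ fromℕ (D 4 3 H)
      lower = c₁*≤ (D 4 3 H) (≤-trans (*-monoˡ-≤ (fromℕ-nonNeg H) ℓ≤2L)
        (≤-respˡ (fromℕ-* H (2 ℕ.* L)) (fromℕ-mono-≤ H*2L≤32D)))
      -- The constant 144 is relaxed to 309 so that L ≤ 3ℓ produces exactly 927 = 3 · 309.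
      D≤309HL : D 4 3 H ℕ.≤ 309 ℕ.* (H ℕ.* L)
      D≤309HL = ℕₚ.≤-trans (ℕₚ.≤-trans (D₄₃-upper H) (length-cover₄₃ {H} {L} 1≤L 1≤H H<2^1+L))
          (ℕₚ.*-monoˡ-≤ (H ℕ.* L) (ℕₚ.m≤m+n 144 165))
      upper : fromℕ (D 4 3 H) ≤ c₂ * (fromℕ H * ℓ)
      upper = ≤-trans (≤-respʳ (trans (fromℕ-* 309 (H ℕ.* L)) (*-congˡ (fromℕ-* H L))) (fromℕ-mono-≤ D≤309HL))
        (≤-respʳ (trans (solve 3 (λ k H ℓ → k :* (H :* (con 3 :* ℓ)) := (k :* con 3) :* (H :* ℓ)) (fromℕ 309)
            (fromℕ H) ℓ)
            (*-congʳ (sym (fromℕ-* 309 3))))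
          (*-monoˡ-≤ (fromℕ-nonNeg 309) (*-monoˡ-≤ (fromℕ-nonNeg H) (log-lower {L = L} isLog 1≤L 2^L≤H))))

corollary1p5 : (em : ExcludedMiddle 0ℓ) (real : CompleteOrderedField) →
    let open Classical em real in
    ∃₂ λ (c₁ c₂ : ℝ) →
    (0# < c₁) × (0# < c₂) ×
    (∀ (H : ℕ) → 1 ℕ.≤ H →
    ((c₁ * fromℕ H ≤ fromℕ (D 3 3 H)) ×
    (fromℕ (D 3 3 H) ≤ c₂ * fromℕ H)) ×
    ((c₁ * √ (fromℕ H ^ 3) ≤ fromℕ (D 4 4 H)) ×
    (fromℕ (D 4 4 H) ≤ c₂ * √ (fromℕ H ^ 3)))) ×
    (∀ (H : ℕ) → 2 ℕ.≤ H → ∀ (ℓ : ℝ) → IsLog (fromℕ H) ℓ →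
    (c₁ * (fromℕ H * ℓ) ≤ fromℕ (D 4 3 H)) ×
    (fromℕ (D 4 3 H) ≤ c₂ * (fromℕ H * ℓ)))
corollary1p5 em real = c₁ , c₂ , c₁>0 , c₂>0 , (λ H 1≤H → D₃₃-bounds H 1≤H , D₄₄-bounds H 1≤H) , D₄₃-bounds
  where open Asymptotics em real
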